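{- Let $n,k$ be integers with $1\leq k\leq n-3$ and let $G\in\mathfrak{C}'_{n,k}(k)$. Then $F(G)\geq F(L_{n,n-k})$. Moreover, if $n\neq 2k+1$, equality holds if and only if $G\cong L_{n,n-k}$, and if $n=2k+1$, equality holds if and only if $G\in\{L_{2k+1,k+1},\,Q_{2k+1,k}\}$.
   Context: All graphs are simple, finite, undirected and connected. $F(G)$ is the number of connected subgraphs of $G$ (nonempty connected subgraphs consisting of a vertex subset and a subset of edges among them; distinct subgraphs counted separately). $\mathfrak{C}_{n,k}$ is the family of connected graphs on $n$ vertices with exactly $k$ cut vertices; $\mathfrak{C}_{n,k}(g)$ is the subfamily of graphs with girth at least $g$ (trees have infinite girth), and $\mathfrak{C}'_{n,k}(g)$ is the set of non-tree graphs in $\mathfrak{C}_{n,k}(g)$. $L_{n,n-k}$ is obtained by identifying an end vertex of the path $P_{k+1}$ with a vertex of the cycle $C_{n-k}$. The path-star tree $P_{m,r}$ is obtained by identifying one end vertex of the path $P_m$ with the center of the star $K_{1,r}$; its path-part pendant vertex is the other end of $P_m$. $Q_{n,k}$ is the graph obtained by identifying a vertex of the cycle $C_{n-k-1}$ with the path-part pendant vertex of $P_{k,2}$. -}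

module Defs where

open import Data.Nat using (ℕ; zero; suc; _+_; _∸_; _≡ᵇ_; _≤_)
open import Data.Nat.Properties using ()
open import Data.Bool using (Bool; true; false; _∧_; _∨_; not; if_then_else_)
open import Data.Bool.Properties using (∨-comm)
open import Data.Fin using (Fin; toℕ)
open import Data.Fin.Properties using () renaming (_≟_ to _≟ᶠ_)
open import Data.List using (List; []; _∷_; map; filter; allFin; upTo; length; _++_; concatMap)
open import Data.Bool.ListAction using (any; all)
open import Data.Nat.ListAction using (sum)
open import Data.List.Relation.Unary.Unique.Propositional using (Unique)
open import Data.Product using (_×_; _,_; proj₁; proj₂; Σ)
open import Relation.Nullary using (¬_)
open import Relation.Nullary.Decidable using (⌊_⌋)
open import Relation.Binary.PropositionalEquality using (_≡_; refl; cong₂)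
open import Function.Bundles using (_⤖_; Bijection)

record Graph (n : ℕ) : Set where
  field
    adj    : Fin n → Fin n → Bool
    sym    : ∀ i j → adj i j ≡ adj j i
    irrefl : ∀ i → adj i i ≡ false
open Graph public

_==_ : {n : ℕ} → Fin n → Fin n → Bool
i == j = ⌊ i ≟ᶠ j ⌋

edges : {n : ℕ} → Graph n → List (Fin n × Fin n)
edges {n} G = concatMap (λ i → map (λ j → (i , j))
                 (filter (λ j → Data.Nat._<?_ (toℕ i) (toℕ j)) (filter (λ j → adj G i j Data.Bool.≟ true) (allFin n))))
              (allFin n)
  where import Data.Nat
        import Data.Bool

_∈ᵇ_ : {n : ℕ} → Fin n → List (Fin n) → Bool
v ∈ᵇ S = any (λ u → u == v) S

sublists : {A : Set} → List A → List (List A)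
sublists []       = [] ∷ []
sublists (x ∷ xs) = let r = sublists xs in map (x ∷_) r ++ r

edgesWithin : {n : ℕ} → List (Fin n) → List (Fin n × Fin n) → List (Fin n × Fin n)
edgesWithin S E = filter (λ e → ((proj₁ e ∈ᵇ S) ∧ (proj₂ e ∈ᵇ S)) Data.Bool.≟ true) E
  where import Data.Bool

reach : {n : ℕ} → List (Fin n × Fin n) → Fin n → ℕ → Fin n → Bool
reach E s zero    v = s == v
reach E s (suc k) v = reach E s k v ∨
  any (λ e → (reach E s k (proj₁ e) ∧ (proj₂ e == v)) ∨ (reach E s k (proj₂ e) ∧ (proj₁ e == v))) E

-- the (spanning) graph (S , E) is connected: S nonempty and every vertex of S
-- is joined to the first one by a walk (of length ≤ n, which suffices) in E
connectedB : {n : ℕ} → List (Fin n) → List (Fin n × Fin n) → Bool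
connectedB         []      E = false
connectedB {n} (s ∷ S) E = all (reach E s n) (s ∷ S)

Connected : {n : ℕ} → Graph n → Set
Connected {n} G = connectedB (allFin n) (edges G) ≡ true

count : {A : Set} → (A → Bool) → List A → ℕ
count p xs = length (filter (λ x → p x Data.Bool.≟ true) xs)
  where import Data.Bool

F : {n : ℕ} → Graph n → ℕ
F {n} G = sum (map (λ S → count (connectedB S) (sublists (edgesWithin S (edges G))))
                   (sublists (allFin n)))

isCut : {n : ℕ} → Graph n → Fin n → Bool
isCut {n} G v = not (connectedB S (edgesWithin S (edges G)))
  where S = filter (λ u → not (u == v) Data.Bool.≟ true) (allFin n)
        import Data.Bool

numCut : {n : ℕ} → Graph n → ℕ
numCut {n} G = count (isCut G) (allFin n)

consecAdj : {n : ℕ} → Graph n → Fin n → List (Fin n) → Set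
consecAdj G first []       = ⊤' where open import Data.Unit using () renaming (⊤ to ⊤')
consecAdj G first (v ∷ []) = adj G v first ≡ true
consecAdj G first (v ∷ w ∷ vs) = (adj G v w ≡ true) × consecAdj G first (w ∷ vs)

IsCycle : {n : ℕ} → Graph n → List (Fin n) → Set
IsCycle G []       = Data.Empty.⊥ where import Data.Empty
IsCycle G (v ∷ vs) = (3 ≤ length (v ∷ vs)) × Unique (v ∷ vs) × consecAdj G v (v ∷ vs)

-- girth at least g (trees have infinite girth, so satisfy this for all g)
GirthAtLeast : {n : ℕ} → Graph n → ℕ → Set
GirthAtLeast {n} G g = ∀ (c : List (Fin n)) → IsCycle G c → g ≤ length c

IsTree : {n : ℕ} → Graph n → Set
IsTree {n} G = Connected G × (∀ (c : List (Fin n)) → ¬ IsCycle G c)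

InC' : (n k g : ℕ) → Graph n → Set
InC' n k g G = Connected G × (numCut G ≡ k) × GirthAtLeast G g × ¬ IsTree G

_≅_ : {n : ℕ} → Graph n → Graph n → Set
_≅_ {n} G H = Σ (Fin n ⤖ Fin n) λ f →
  ∀ i j → adj G i j ≡ adj H (Bijection.to f i) (Bijection.to f j)

≡ᵇ-sym : ∀ a b → (a ≡ᵇ b) ≡ (b ≡ᵇ a)
≡ᵇ-sym zero zero = refl
≡ᵇ-sym zero (suc b) = refl
≡ᵇ-sym (suc a) zero = refl
≡ᵇ-sym (suc a) (suc b) = ≡ᵇ-sym a b

≡ᵇ-refl : ∀ a → (a ≡ᵇ a) ≡ true
≡ᵇ-refl zero = refl
≡ᵇ-refl (suc a) = ≡ᵇ-refl a

edgeB : List (ℕ × ℕ) → ℕ → ℕ → Bool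
edgeB es a b = any (λ p → (proj₁ p ≡ᵇ a) ∧ (proj₂ p ≡ᵇ b)) es

fromEdges : (n : ℕ) → List (ℕ × ℕ) → Graph n
fromEdges n es = record
  { adj = λ i j → not (toℕ i ≡ᵇ toℕ j) ∧ (edgeB es (toℕ i) (toℕ j) ∨ edgeB es (toℕ j) (toℕ i))
  ; sym = λ i j → cong₂ _∧_ (Relation.Binary.PropositionalEquality.cong not (≡ᵇ-sym (toℕ i) (toℕ j)))
                            (∨-comm (edgeB es (toℕ i) (toℕ j)) _)
  ; irrefl = λ i → Relation.Binary.PropositionalEquality.cong (λ b → not b ∧ (edgeB es (toℕ i) (toℕ i) ∨ edgeB es (toℕ i) (toℕ i))) (≡ᵇ-refl (toℕ i))
  }
  where import Relation.Binary.PropositionalEquality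

pathEdges : List ℕ → List (ℕ × ℕ)
pathEdges (a ∷ b ∷ xs) = (a , b) ∷ pathEdges (b ∷ xs)
pathEdges _            = []

cycleEdges : ℕ → List (ℕ × ℕ)
cycleEdges m = pathEdges (upTo m) ++ ((m ∸ 1 , 0) ∷ [])

-- L n k  represents  L_{n,n-k}: cycle C_{n-k} on 0 … n-k-1, and a path
-- P_{k+1} with vertex sequence 0, n-k, n-k+1, …, n-1 attached at 0
L : (n k : ℕ) → Graph n
L n k = fromEdges n (cycleEdges (n ∸ k) ++ pathEdges (0 ∷ map ((n ∸ k) +_) (upTo k)))

lastOr : ℕ → List ℕ → ℕ
lastOr d []       = d
lastOr d (x ∷ xs) = lastOr x xs

-- Q n k  represents  Q_{n,k}: cycle C_{c} (c = n-k-1) on 0 … c-1, the path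
-- P_k with vertex sequence 0, c, c+1, …, c+k-2 attached at 0 (its path-part
-- pendant vertex), and two leaves n-2, n-1 joined to the last path vertex
-- (the centre of the star K_{1,2})
Q : (n k : ℕ) → Graph n
Q n k = fromEdges n (cycleEdges c ++ pathEdges pathSeq ++ ((ctr , n ∸ 2) ∷ (ctr , n ∸ 1) ∷ []))
  where c       = n ∸ k ∸ 1
        pathSeq = 0 ∷ map (c +_) (upTo (k ∸ 1))
        ctr     = lastOr 0 pathSeq

{-# OPTIONS --safe #-}
-- Connected subgraphs of a connected vertex set S through a vertex u are told apart by their boundary: for v ≠ u the
-- component of u in S − v has boundary {v}, and for non-cut v, w the component of u in S − {v, w} has boundary {v, w}.
-- Together with the deletion of non-bridge edges this gives F_u(S) ≥ |S| + m(m + 1)/2 + 1 as soon as S contains a cycle,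
-- where m is the number of non-cut vertices other than u.
--
-- The theorem follows by induction on |S|. Without cut vertices, F(S) ≥ F_u(S) + F(S − u) ≥ |S|² + 1. A leaf v at u
-- contributes 1 + F_u(S − v); if u is still a cut vertex of S − v, then F_u(S − v) is the product of the counts of two
-- sides, and the girth enters because a connected graph with a cycle of length g has at least g non-cut vertices. In the
-- critical case, where the second side is a single edge and the first is a cycle of length c with a tail, the surplus is
-- (c − 1)(c − k); it vanishes for c = k, which produces Q. If there are cut vertices but no leaves, then S splits at a cut
-- vertex into two sides that both contain a cycle, and the product of their counts is already too large.
module Submission where

open import Defs renaming (sym to adj-sym; irrefl to adj-irrefl)
open import Data.Bool using (Bool; true; false; _∧_; _∨_; not)
import Data.Bool as Bool
open import Data.Bool.ListAction using (any; all)
open import Data.Bool.Properties using (∨-comm)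
open import Data.Empty using (⊥; ⊥-elim)
open import Data.Fin as Fin using (Fin; toℕ; fromℕ<; #_)
open import Data.Fin.Properties using (any?; all?; toℕ-injective; toℕ<n; toℕ-fromℕ<) renaming (_≟_ to _≟ᶠ_)
open import Data.List using (List; []; _∷_; _++_; map; filter; length; allFin; concatMap; applyUpTo; upTo; replicate)
import Data.List.Properties as Listₚ
open import Data.List.Membership.Propositional using (_∈_; find; lose)
open import Data.List.Membership.Propositional.Properties
open import Data.List.Relation.Unary.All as All using (All; []; _∷_)
import Data.List.Relation.Unary.All.Properties as Allₚ
open import Data.List.Relation.Unary.AllPairs using (AllPairs; []; _∷_)
import Data.List.Relation.Unary.AllPairs.Properties as AllPairsₚ
open import Data.List.Relation.Unary.Any as Any using (here; there)
open import Data.List.Relation.Unary.Linked using (Linked; [-]; _∷_)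
open import Data.List.Relation.Unary.Unique.Propositional using (Unique)
import Data.List.Relation.Unary.Unique.Propositional.Properties as Uniqueₚ
open import Data.Nat as ℕ using (ℕ; zero; suc; _+_; _*_; _∸_; _≤_; _<_; _≡ᵇ_; z≤n; s≤s)
open import Data.Nat.ListAction using (sum)
open import Data.Nat.Properties using (*-cancelˡ-≤; *-comm; *-identityʳ; *-mono-≤; *-monoʳ-≤; *-monoˡ-≤; +-assoc; +-cancelʳ-≤; +-cancelˡ-<; +-cancelˡ-≡; +-comm; +-identityʳ; +-mono-≤; +-monoʳ-<; +-monoʳ-≤; +-monoˡ-≤; +-suc; 0≢1+n; 1+n≢0; 1+n≢n; <-asym; <-cmp; <-irrefl; <-trans; <-≤-trans; <⇒≤; <⇒≱; m+[n∸m]≡n; m+n∸m≡n; m+n∸n≡m; m+n≡0⇒m≡0; m+n≡0⇒n≡0; m∸n+n≡m; m∸n≡0⇒m≤n; m∸n≤m; m≤m+n; m≤n+m; m≤n⇒m<n∨m≡n; m≤n⇒m≤1+n; n≤0⇒n≡0; n≤1+n; suc-injective; ∸-+-assoc; ∸-monoˡ-≤; ≤-antisym; ≤-pred; ≤-refl; ≤-reflexive; ≤-total; ≤-trans; ≤∧≢⇒<; ≮⇒≥; module ≤-Reasoning)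
open import Data.Nat.Solver using (module +-*-Solver)
open +-*-Solver using (solve; _:=_; _:+_; _:*_; con)
open import Data.Product using (_×_; _,_; proj₁; proj₂; Σ; ∃)
open import Data.Sum as Sum using (_⊎_; inj₁; inj₂)
open import Function using (_∘_; id)
open import Function.Bundles using (_⇔_; mk⇔; _⤖_; mk⤖; Bijection)
open import Relation.Binary.Construct.Closure.ReflexiveTransitive as Star using (Star; ε; _◅_; _◅◅_; reverse)
open import Relation.Binary.Definitions using (tri<; tri≈; tri>)
open import Relation.Binary.PropositionalEquality using (_≡_; _≢_; refl; sym; trans; cong; cong₂; subst; subst₂)
open import Relation.Nullary using (¬_; Dec; yes; no)
open import Relation.Nullary.Decidable using (⌊_⌋; _×-dec_; _⊎-dec_; _→-dec_; ¬?; toWitness)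

-- Finite vertex sets and counting up to an equivalence

-- The minimum depends only on the number m of non-cut vertices and the number k of cut vertices:
-- with m = n - k it is m² + 1 + k(k + 1)/2 + k(1 + m(m + 1)/2). A leaf attached to a non-cut vertex
-- turns that vertex into a cut vertex and raises k; a leaf attached to a cut vertex raises m. The
-- two increments of the formula are what the rooted bounds have to match. All counting takes place
-- in vertex subsets `S` of one fixed graph. The girth hypothesis, that cycles are at least as long
-- as `S` has cut vertices, survives the deletion of a leaf, which never raises the number of cut
-- vertices. The rooted bounds hold for any girth, and the sides of a splitting are bounded by them
-- alone, without induction. For the equality case every bound carries an alternative: one more
-- subgraph, or an extremal shape. The decisive surplus is one extra rooted subgraph for each
-- non-cut vertex, other than the root, off a chosen cycle. It forces a new leaf to continue the
-- tail at its end.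

∧-intro : ∀ {a b} → a ≡ true → b ≡ true → a ∧ b ≡ true
∧-intro refl refl = refl

∧-left : ∀ {a b} → a ∧ b ≡ true → a ≡ true
∧-left {true} _ = refl

∧-right : ∀ {a b} → a ∧ b ≡ true → b ≡ true
∧-right {true} p = p

∨-elim : ∀ {a b} → a ∨ b ≡ true → a ≡ true ⊎ b ≡ true
∨-elim {true} _ = inj₁ refl
∨-elim {false} p = inj₂ p

∨-introˡ : ∀ {a b} → a ≡ true → a ∨ b ≡ true
∨-introˡ refl = refl

∨-introʳ : ∀ {a b} → b ≡ true → a ∨ b ≡ true
∨-introʳ {true} _ = refl
∨-introʳ {false} p = p

true≢false : ∀ {b} → b ≡ true → b ≢ false
true≢false refl ()

bool-ext : ∀ {a b} → (a ≡ true → b ≡ true) → (b ≡ true → a ≡ true) → a ≡ b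
bool-ext {true} f g = sym (f refl)
bool-ext {false} {true} f g = g refl
bool-ext {false} {false} f g = refl

⌊⌋-intro : ∀ {A : Set} (d : Dec A) → A → ⌊ d ⌋ ≡ true
⌊⌋-intro (yes _) _ = refl
⌊⌋-intro (no ¬a) a = ⊥-elim (¬a a)

⌊⌋-elim : ∀ {A : Set} (d : Dec A) → ⌊ d ⌋ ≡ true → A
⌊⌋-elim (yes a) _ = a

==-refl : ∀ {n} (i : Fin n) → (i == i) ≡ true
==-refl i = ⌊⌋-intro (i ≟ᶠ i) refl

==⇒≡ : ∀ {n} {i j : Fin n} → (i == j) ≡ true → i ≡ j
==⇒≡ {i = i} {j} p = ⌊⌋-elim (i ≟ᶠ j) p

not-true : ∀ {b} → not b ≡ true → ¬ (b ≡ true)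
not-true {true} ()
not-true {false} _ ()

true-not : ∀ {b} → ¬ (b ≡ true) → not b ≡ true
true-not {true} p = ⊥-elim (p refl)
true-not {false} p = refl

-- Pigeonhole by cancellation: the head of `xs` is located in `ys` and removed there, and uniqueness
-- keeps the remaining elements of `xs` away from the removed position.
unique⊆⇒length≤ : ∀ {A : Set} {xs ys : List A} → Unique xs → (∀ {x} → x ∈ xs → x ∈ ys) → length xs ≤ length ys
unique⊆⇒length≤ {xs = []} _ _ = z≤n
unique⊆⇒length≤ {xs = x ∷ xs} (x∉ ∷ u) sub with ∈-∃++ (sub (here refl))
... | as , bs , refl = subst (suc (length xs) ≤_) (sym len) (s≤s (unique⊆⇒length≤ u sub′))
  where
  len : length (as ++ x ∷ bs) ≡ suc (length (as ++ bs))
  len = trans (Listₚ.length-++ as) (trans (+-suc (length as) (length bs)) (cong suc (sym (Listₚ.length-++ as))))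
  sub′ : ∀ {y} → y ∈ xs → y ∈ as ++ bs
  sub′ {y} y∈ with ∈-++⁻ as (sub (there y∈))
  ... | inj₁ p = ∈-++⁺ˡ p
  ... | inj₂ (here refl) = ⊥-elim (All.lookup x∉ y∈ refl)
  ... | inj₂ (there p) = ∈-++⁺ʳ as p

VSet : ℕ → Set
VSet n = Fin n → Bool

infix 4 _∋_
-- A record rather than the bare equation, so that `S` and `v` can be inferred by unification even
-- where `S v` would reduce.
record _∋_ {n : ℕ} (S : VSet n) (v : Fin n) : Set where
  constructor mem
  field
    is-mem : S v ≡ true
open _∋_ public

infix 4 _⊑_
_⊑_ : ∀ {n} → VSet n → VSet n → Set
S ⊑ S′ = ∀ i → S ∋ i → S′ ∋ i

infixl 6 _─_
_─_ : ∀ {n} → VSet n → Fin n → VSet n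
(S ─ v) i = S i ∧ not (i == v)

─-intro : ∀ {n} {S : VSet n} {v i} → S ∋ i → i ≢ v → S ─ v ∋ i
─-intro p i≢v = mem (∧-intro (is-mem p) (true-not (λ e → i≢v (==⇒≡ e))))

─-⊑ : ∀ {n} {S : VSet n} {v i} → S ─ v ∋ i → S ∋ i
─-⊑ p = mem (∧-left (is-mem p))

─-≢ : ∀ {n} {S : VSet n} {v i} → S ─ v ∋ i → i ≢ v
─-≢ {S = S} {v} {i} p refl = not-true (∧-right {S i} (is-mem p)) (==-refl v)

elems : ∀ {n} → VSet n → List (Fin n)
elems {n} S = filter (λ i → S i Bool.≟ true) (allFin n)

card : ∀ {n} → VSet n → ℕ
card S = length (elems S)

∈-elems⁺ : ∀ {n} {S : VSet n} {i} → S ∋ i → i ∈ elems S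
∈-elems⁺ {S = S} {i} p = ∈-filter⁺ (λ i → S i Bool.≟ true) (∈-allFin i) (is-mem p)

∈-elems⁻ : ∀ {n} (S : VSet n) {i} → i ∈ elems S → S ∋ i
∈-elems⁻ S p = mem (proj₂ (∈-filter⁻ (λ i → S i Bool.≟ true) {xs = allFin _} p))

elems-unique : ∀ {n} (S : VSet n) → Unique (elems S)
elems-unique {n} S = Uniqueₚ.filter⁺ (λ i → S i Bool.≟ true) (Uniqueₚ.allFin⁺ n)

length≤card : ∀ {n} {S : VSet n} {xs} → Unique xs → (∀ {x} → x ∈ xs → S ∋ x) → length xs ≤ card S
length≤card u f = unique⊆⇒length≤ u (λ p → ∈-elems⁺ (f p))

card≤length : ∀ {n} {S : VSet n} {xs} → (∀ i → S ∋ i → i ∈ xs) → card S ≤ length xs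
card≤length {S = S} f = unique⊆⇒length≤ (elems-unique S) (λ p → f _ (∈-elems⁻ S p))

card-mono : ∀ {n} {S S′ : VSet n} → S ⊑ S′ → card S ≤ card S′
card-mono {S = S} f = length≤card (elems-unique S) (λ p → f _ (∈-elems⁻ S p))

card-cong : ∀ {n} {S S′ : VSet n} → S ⊑ S′ → S′ ⊑ S → card S ≡ card S′
card-cong f g = ≤-antisym (card-mono f) (card-mono g)

card-∪ : ∀ {n} {S A B : VSet n} → (∀ i → S ∋ i → A ∋ i ⊎ B ∋ i) → card S ≤ card A + card B
card-∪ {S = S} {A} {B} f = subst (card S ≤_) (Listₚ.length-++ (elems A)) (card≤length {S = S} h)
  where
  h : ∀ i → S ∋ i → i ∈ elems A ++ elems B
  h i p with f i p
  ... | inj₁ a = ∈-++⁺ˡ (∈-elems⁺ a)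
  ... | inj₂ b = ∈-++⁺ʳ (elems A) (∈-elems⁺ b)

card-⊎ : ∀ {n} {S A B : VSet n} → A ⊑ S → B ⊑ S → (∀ i → A ∋ i → B ∋ i → ⊥) → card A + card B ≤ card S
card-⊎ {S = S} {A} {B} f g d = subst (_≤ card S) (Listₚ.length-++ (elems A))
  (length≤card (Uniqueₚ.++⁺ (elems-unique A) (elems-unique B) (λ (p , q) → d _ (∈-elems⁻ A p) (∈-elems⁻ B q))) h)
  where
  h : ∀ {i} → i ∈ elems A ++ elems B → S ∋ i
  h p with ∈-++⁻ (elems A) p
  ... | inj₁ a = f _ (∈-elems⁻ A a)
  ... | inj₂ b = g _ (∈-elems⁻ B b)

card-─ : ∀ {n} {S : VSet n} {v} → S ∋ v → card S ≡ suc (card (S ─ v))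
card-─ {S = S} {v} p = ≤-antisym (card≤length {S = S} h₁) (length≤card (All.tabulate (λ q e → ─-≢ {S = S} (∈-elems⁻ (S ─ v) q) (sym e)) ∷ elems-unique (S ─ v)) h₂)
  where
  h₁ : ∀ i → S ∋ i → i ∈ v ∷ elems (S ─ v)
  h₁ i q with i ≟ᶠ v
  ... | yes refl = here refl
  ... | no ne = there (∈-elems⁺ (─-intro {S = S} q ne))
  h₂ : ∀ {i} → i ∈ v ∷ elems (S ─ v) → S ∋ i
  h₂ (here refl) = p
  h₂ (there q) = ─-⊑ {S = S} (∈-elems⁻ (S ─ v) q)

card-∌ : ∀ {n} {S : VSet n} {v} → ¬ (S ∋ v) → card (S ─ v) ≡ card S
card-∌ {S = S} p = card-cong {S′ = S} (λ i → ─-⊑ {S = S}) (λ i q → ─-intro {S = S} q (λ { refl → p q }))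

card-pos : ∀ {n} {S : VSet n} {v} → S ∋ v → 1 ≤ card S
card-pos {S = S} p = subst (1 ≤_) (sym (card-─ {S = S} p)) (s≤s z≤n)

module Counting {A : Set} (_≈_ : A → A → Set) where

  Distinct : List A → Set
  Distinct = AllPairs (λ x y → ¬ x ≈ y)

  -- Subgraphs are pairs of Boolean functions and can only be compared pointwise. Cardinalities are
  -- therefore expressed through lists of pairwise inequivalent members.
  AtLeast : (A → Set) → ℕ → Set
  AtLeast P N = Σ (List A) λ xs → All P xs × Distinct xs × N ≤ length xs

  atLeast-≤ : ∀ {P M N} → M ≤ N → AtLeast P N → AtLeast P M
  atLeast-≤ p (xs , a , d , l) = xs , a , d , ≤-trans p l

  atLeast-mono : ∀ {P Q N} → (∀ {x} → P x → Q x) → AtLeast P N → AtLeast Q N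
  atLeast-mono f (xs , a , d , l) = xs , All.map f a , d , l

  atLeast-one : ∀ {P} x → P x → AtLeast P 1
  atLeast-one x p = x ∷ [] , p ∷ [] , [] ∷ [] , s≤s z≤n

  atLeast-+ : ∀ {P Q M N} → (∀ {x y} → P x → Q y → ¬ x ≈ y) → AtLeast P M → AtLeast Q N → AtLeast (λ x → P x ⊎ Q x) (M + N)
  atLeast-+ dis (xs , a , d , l) (ys , b , e , l′) =
    xs ++ ys , Allₚ.++⁺ (All.map inj₁ a) (All.map inj₂ b) ,
    AllPairsₚ.++⁺ d e (All.map (λ p → All.map (dis p) b) a) ,
    subst (_ ≤_) (sym (Listₚ.length-++ xs)) (+-mono-≤ l l′)

  atLeast-index : ∀ {I : Set} {P} (is : List I) (f : I → A) → Unique is → (∀ {i} → i ∈ is → P (f i)) →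
    (∀ {i j} → i ∈ is → j ∈ is → f i ≈ f j → i ≡ j) → AtLeast P (length is)
  atLeast-index {I} {P} is f u p inj = map f is , Allₚ.map⁺ (All.tabulate p) , AllPairsₚ.map⁺ (go is u inj) , ≤-reflexive (sym (Listₚ.length-map f is))
    where
    go : ∀ (js : List I) → Unique js → (∀ {i j} → i ∈ js → j ∈ js → f i ≈ f j → i ≡ j) → AllPairs (λ x y → ¬ f x ≈ f y) js
    go [] _ _ = []
    go (j ∷ js) (q ∷ u) inj = All.tabulate (λ m e → All.lookup q m (inj (here refl) (there m) e)) ∷ go js u (λ a b → inj (there a) (there b))

  -- Upper bounds on the number of solutions are phrased as bounds on every lower bound.
  AtMost : (A → Set) → ℕ → Set
  AtMost P N = ∀ {M} → AtLeast P M → M ≤ N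

  atMost-code : ∀ {B : Set} {P} (code : A → B) (ys : List B) → (∀ {x} → P x → code x ∈ ys) →
    (∀ {x y} → P x → P y → code x ≡ code y → x ≈ y) → AtMost P (length ys)
  atMost-code {P = P} code ys listed inj (xs , a , d , l) =
    ≤-trans l (subst (_≤ length ys) (Listₚ.length-map code xs) (unique⊆⇒length≤ (AllPairsₚ.map⁺ (go a d)) h))
    where
    go : ∀ {xs} → All P xs → Distinct xs → AllPairs (λ x y → ¬ code x ≡ code y) xs
    go [] [] = []
    go (p ∷ ps) (q ∷ qs) = All.zipWith (λ (py , ne) e → ne (inj p py e)) (ps , q) ∷ go ps qs
    h : ∀ {y} → y ∈ map code xs → y ∈ ys
    h m with ∈-map⁻ code m
    ... | x , x∈ , refl = listed (All.lookup a x∈)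

  atMost-split : ∀ {P Q R M N} (b : A → Bool) → (∀ {x} → P x → b x ≡ true → Q x) → (∀ {x} → P x → b x ≡ false → R x) →
    AtMost Q M → AtMost R N → AtMost P (M + N)
  atMost-split {P} {Q} {R} b q r mQ mR (xs , a , d , l) = ≤-trans l (subst (_≤ _) (len xs) (+-mono-≤
      (mQ (filter b? xs , Allₚ.filter⁺ b? a ⟨∘⟩ q , AllPairsₚ.filter⁺ b? d , ≤-refl))
      (mR (filter c? xs , Allₚ.filter⁺ c? a ⟨∘′⟩ r , AllPairsₚ.filter⁺ c? d , ≤-refl))))
    where
    b? : ∀ x → Dec (b x ≡ true)
    b? x = b x Bool.≟ true
    c? : ∀ x → Dec (b x ≡ false)
    c? x = b x Bool.≟ false
    _⟨∘⟩_ : All P (filter b? xs) → (∀ {x} → P x → b x ≡ true → Q x) → All Q (filter b? xs)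
    a′ ⟨∘⟩ f = All.zipWith (λ (x , y) → f x y) (a′ , Allₚ.all-filter b? xs)
    _⟨∘′⟩_ : All P (filter c? xs) → (∀ {x} → P x → b x ≡ false → R x) → All R (filter c? xs)
    a′ ⟨∘′⟩ f = All.zipWith (λ (x , y) → f x y) (a′ , Allₚ.all-filter c? xs)
    len : ∀ ys → length (filter b? ys) + length (filter c? ys) ≡ length ys
    len [] = refl
    len (y ∷ ys) with b y
    ... | true = cong suc (len ys)
    ... | false = trans (+-suc _ _) (cong suc (len ys))

module _ {A B : Set} {_≈A_ : A → A → Set} {_≈B_ : B → B → Set} where
  private
    module CA = Counting _≈A_
    module CB = Counting _≈B_

  atLeast-inject : ∀ {P Q N} (f : A → B) → (∀ {x} → P x → Q (f x)) → (∀ {x y} → P x → P y → f x ≈B f y → x ≈A y) →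
    CA.AtLeast P N → CB.AtLeast Q N
  atLeast-inject {P} f p inj (xs , a , d , l) = map f xs , Allₚ.map⁺ (All.map p a) , AllPairsₚ.map⁺ (go a d) , subst (_ ≤_) (sym (Listₚ.length-map f xs)) l
    where
    go : ∀ {xs} → All P xs → CA.Distinct xs → AllPairs (λ x y → ¬ f x ≈B f y) xs
    go [] [] = []
    go (p ∷ ps) (q ∷ qs) = All.zipWith (λ (py , ne) e → ne (inj p py e)) (ps , q) ∷ go ps qs

  atMost-inject : ∀ {P Q N} (f : A → B) → (∀ {x} → P x → Q (f x)) → (∀ {x y} → P x → P y → f x ≈B f y → x ≈A y) →
    CB.AtMost Q N → CA.AtMost P N
  atMost-inject f p inj m = m ∘ atLeast-inject f p inj

module _ {A : Set} {_≈_ : A → A → Set} where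
  open Counting _≈_

  atLeast-* : ∀ {P Q R : A → Set} {M N} (f : A → A → A) → (∀ {x y} → P x → Q y → R (f x y)) →
    (∀ {x x′ y y′} → P x → P x′ → Q y → Q y′ → f x y ≈ f x′ y′ → x ≈ x′ × y ≈ y′) →
    AtLeast P M → AtLeast Q N → AtLeast R (M * N)
  atLeast-* {P} {Q} {R} {M} {N} f r inj (xs , a , d , l) (ys , b , e , l′) = go-list xs , go-all a , go-dis a d , ≤-trans (*-mono-≤ l l′) (≤-reflexive (go-len xs))
    where
    go-list : List A → List A
    go-list [] = []
    go-list (x ∷ xs) = map (f x) ys ++ go-list xs
    go-len : ∀ xs → length xs * length ys ≡ length (go-list xs)
    go-len [] = refl
    go-len (x ∷ xs) = sym (trans (Listₚ.length-++ (map (f x) ys)) (cong₂ _+_ (Listₚ.length-map (f x) ys) (sym (go-len xs))))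
    go-all : ∀ {xs} → All P xs → All R (go-list xs)
    go-all [] = []
    go-all (p ∷ ps) = Allₚ.++⁺ (Allₚ.map⁺ (All.map (r p) b)) (go-all ps)
    row : ∀ {x ys} → P x → All Q ys → Distinct ys → Distinct (map (f x) ys)
    row p [] [] = []
    row p (q ∷ qs) (n ∷ ns) = Allₚ.map⁺ (All.zipWith (λ (qy , ne) e → ne (proj₂ (inj p p q qy e))) (qs , n)) ∷ row p qs ns
    off : ∀ {x y xs} → P x → Q y → All P xs → All (λ z → ¬ x ≈ z) xs → All (λ z → ¬ f x y ≈ z) (go-list xs)
    off p q [] [] = []
    off p q (p′ ∷ ps) (n ∷ ns) = Allₚ.++⁺ (Allₚ.map⁺ (All.map (λ q′ e → n (proj₁ (inj p p′ q q′ e))) b)) (off p q ps ns)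
    go-dis : ∀ {xs} → All P xs → Distinct xs → Distinct (go-list xs)
    go-dis [] [] = []
    go-dis (p ∷ ps) (n ∷ ns) = AllPairsₚ.++⁺ (row p b e) (go-dis ps ns) (Allₚ.map⁺ (All.map (λ q → off p q ps n) b))

-- A copy of the decision procedure that with-abstraction does not identify with the one inside _==_.
infix 4 _≡?_
_≡?_ : ∀ {n} (i j : Fin n) → Dec (i ≡ j)
i ≡? j with i ≟ᶠ j
... | yes p = yes p
... | no p = no p

-- Reachability and induced connectivity

any-intro : ∀ {A : Set} (p : A → Bool) {xs x} → x ∈ xs → p x ≡ true → any p xs ≡ true
any-intro p (here refl) q = ∨-introˡ q
any-intro p {y ∷ _} (there m) q = ∨-introʳ {p y} (any-intro p m q)

any-elim : ∀ {A : Set} (p : A → Bool) xs → any p xs ≡ true → ∃ λ x → x ∈ xs × p x ≡ true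
any-elim p (x ∷ xs) q with ∨-elim {p x} q
... | inj₁ r = x , here refl , r
... | inj₂ r with any-elim p xs r
...   | y , m , s = y , there m , s

all-intro : ∀ {A : Set} (p : A → Bool) xs → (∀ {x} → x ∈ xs → p x ≡ true) → all p xs ≡ true
all-intro p [] f = refl
all-intro p (x ∷ xs) f = ∧-intro (f (here refl)) (all-intro p xs (λ m → f (there m)))

all-elim : ∀ {A : Set} (p : A → Bool) {xs x} → all p xs ≡ true → x ∈ xs → p x ≡ true
all-elim p q (here refl) = ∧-left q
all-elim p {y ∷ _} q (there m) = all-elim p (∧-right {p y} q) m

∈ᵇ-intro : ∀ {n} {v : Fin n} {S} → v ∈ S → (v ∈ᵇ S) ≡ true
∈ᵇ-intro {v = v} m = any-intro (_== v) m (==-refl v)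

∈ᵇ-elim : ∀ {n} {v : Fin n} S → (v ∈ᵇ S) ≡ true → v ∈ S
∈ᵇ-elim {v = v} S p with any-elim (_== v) S p
... | u , m , e = subst (_∈ S) (==⇒≡ e) m

Step : ∀ {n} → List (Fin n × Fin n) → Fin n → Fin n → Set
Step E i j = (i , j) ∈ E ⊎ (j , i) ∈ E

module _ {n : ℕ} (E : List (Fin n × Fin n)) (s : Fin n) where

  private
    hop : ℕ → Fin n → Fin n × Fin n → Bool
    hop k v e = (reach E s k (proj₁ e) ∧ (proj₂ e == v)) ∨ (reach E s k (proj₂ e) ∧ (proj₁ e == v))

  reach-sound : ∀ k v → reach E s k v ≡ true → Star (Step E) s v
  reach-sound zero v p = subst (Star (Step E) s) (==⇒≡ p) ε
  reach-sound (suc k) v p with ∨-elim {reach E s k v} p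
  ... | inj₁ q = reach-sound k v q
  ... | inj₂ q with any-elim (hop k v) E q
  ...   | (a , b) , m , r with ∨-elim {reach E s k a ∧ (b == v)} r
  ...     | inj₁ t = reach-sound k a (∧-left t) ◅◅ (inj₁ (subst (λ z → (a , z) ∈ E) (==⇒≡ (∧-right {reach E s k a} t)) m) ◅ ε)
  ...     | inj₂ t = reach-sound k b (∧-left t) ◅◅ (inj₂ (subst (λ z → (z , b) ∈ E) (==⇒≡ (∧-right {reach E s k b} t)) m) ◅ ε)

  private
    reach-mono : ∀ k v → reach E s k v ≡ true → reach E s (suc k) v ≡ true
    reach-mono k v p = ∨-introˡ p

    reach-step : ∀ k {i j} → reach E s k i ≡ true → Step E i j → reach E s (suc k) j ≡ true
    reach-step k {i} {j} p (inj₁ m) = ∨-introʳ {reach E s k j} (any-intro (hop k j) m (∨-introˡ (∧-intro p (==-refl j))))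
    reach-step k {i} {j} p (inj₂ m) = ∨-introʳ {reach E s k j} (any-intro (hop k j) m (∨-introʳ {reach E s k j ∧ (i == j)} (∧-intro p (==-refl j))))

    Closed : ℕ → Set
    Closed k = ∀ {i j} → reach E s k i ≡ true → Step E i j → reach E s k j ≡ true

    -- The sets of vertices reached within k steps grow strictly until they are closed.
    grow : ∀ k → Closed k ⊎ suc k ≤ card (reach E s k)
    grow zero = inj₂ (card-pos {S = reach E s 0} (mem (==-refl s)))
    grow (suc k) with any? (λ j → (reach E s (suc k) j ∧ not (reach E s k j)) Bool.≟ true)
    ... | no ¬new = inj₁ λ {i} {j} p st → reach-mono k j (old j (reach-step k (old i p) st))
      where
      old : ∀ j → reach E s (suc k) j ≡ true → reach E s k j ≡ true
      old j p with reach E s k j in eq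
      ... | true = refl
      ... | false = ⊥-elim (¬new (j , ∧-intro (trans (cong (_∨ any (hop k j) E) eq) p) (cong not eq)))
    ... | yes (j , new) with grow k
    ...   | inj₁ c = inj₁ λ {i} {j} p st → reach-mono k j (c (back i p) st)
      where
      back : ∀ i → reach E s (suc k) i ≡ true → reach E s k i ≡ true
      back i p with ∨-elim {reach E s k i} p
      ... | inj₁ q = q
      ... | inj₂ q with any-elim (hop k i) E q
      ...   | (a , b) , m , r with ∨-elim {reach E s k a ∧ (b == i)} r
      ...     | inj₁ t = subst (λ z → reach E s k z ≡ true) (==⇒≡ (∧-right {reach E s k a} t)) (c (∧-left t) (inj₁ m))
      ...     | inj₂ t = subst (λ z → reach E s k z ≡ true) (==⇒≡ (∧-right {reach E s k b} t)) (c (∧-left t) (inj₂ m))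
    ...   | inj₂ big = inj₂ (subst (suc (suc k) ≤_) (sym (card-─ {S = reach E s (suc k)} (mem (∧-left new)))) (s≤s (≤-trans big (card-mono sub))))
      where
      sub : reach E s k ⊑ reach E s (suc k) ─ j
      sub i p = ─-intro (mem (reach-mono k i (is-mem p))) λ { refl → not-true (∧-right {reach E s (suc k) j} new) (is-mem p) }

  reach-complete : ∀ {v} → Star (Step E) s v → reach E s n v ≡ true
  reach-complete w = go start w
    where
    closed : Closed n
    closed with grow n
    ... | inj₁ c = c
    -- A set still growing after `n` steps would have more than `n` elements.
    ... | inj₂ big = ⊥-elim (<-irrefl refl (≤-trans big (subst (card (reach E s n) ≤_) (Listₚ.length-tabulate id) (Listₚ.length-filter (λ i → reach E s n i Bool.≟ true) (allFin n)))))
    start : reach E s n s ≡ true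
    start = up n
      where
      up : ∀ k → reach E s k s ≡ true
      up zero = ==-refl s
      up (suc k) = reach-mono k s (up k)
    go : ∀ {i v} → reach E s n i ≡ true → Star (Step E) i v → reach E s n v ≡ true
    go p ε = p
    go p (st ◅ w) = go (closed p st) w

step-sym : ∀ {n} {E : List (Fin n × Fin n)} {i j} → Step E i j → Step E j i
step-sym (inj₁ p) = inj₂ p
step-sym (inj₂ p) = inj₁ p

connectedB-sound : ∀ {n} L (E : List (Fin n × Fin n)) → connectedB L E ≡ true →
  ∃ λ s → s ∈ L × (∀ {v} → v ∈ L → Star (Step E) s v)
connectedB-sound {n} (s ∷ L) E p = s , here refl , λ {v} m → reach-sound E s n v (all-elim (reach E s n) p m)

-- The search starts at the head of the list; the walk from `s` to that head, reversed, moves the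
-- root there.
connectedB-complete : ∀ {n} L (E : List (Fin n × Fin n)) {s} → s ∈ L → (∀ {v} → v ∈ L → Star (Step E) s v) → connectedB L E ≡ true
connectedB-complete {n} (r ∷ L) E m w = all-intro (reach E r n) (r ∷ L) λ q → reach-complete E r (reverse step-sym (w (here refl)) ◅◅ w q)

full : ∀ {n} → VSet n
full _ = true

module Induced {n : ℕ} (G : Graph n) where

  Adj : Fin n → Fin n → Set
  Adj i j = adj G i j ≡ true

  Adj-sym : ∀ {i j} → Adj i j → Adj j i
  Adj-sym {i} {j} p = trans (adj-sym G j i) p

  Adj-≢ : ∀ {i j} → Adj i j → i ≢ j
  Adj-≢ {i} p refl = true≢false p (adj-irrefl G i)

  ∈-edges⁺ : ∀ {i j} → Adj i j → toℕ i < toℕ j → (i , j) ∈ edges G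
  ∈-edges⁺ {i} {j} p q = ∈-concatMap⁺ _ {xs = allFin n} (lose (∈-allFin i)
    (∈-map⁺ (i ,_) (∈-filter⁺ (λ j → toℕ i ℕ.<? toℕ j) (∈-filter⁺ (λ j → adj G i j Bool.≟ true) (∈-allFin j) p) q)))

  ∈-edges⁻ : ∀ {i j} → (i , j) ∈ edges G → Adj i j × toℕ i < toℕ j
  ∈-edges⁻ m with find (∈-concatMap⁻ _ {xs = allFin n} m)
  ... | i , _ , m′ with ∈-map⁻ (i ,_) m′
  ...   | j , m″ , refl with ∈-filter⁻ (λ j → toℕ i ℕ.<? toℕ j) {xs = filter (λ j → adj G i j Bool.≟ true) (allFin n)} m″
  ...     | m‴ , lt = proj₂ (∈-filter⁻ (λ j → adj G i j Bool.≟ true) {xs = allFin n} m‴) , lt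

  Ind : VSet n → Fin n → Fin n → Set
  Ind X i j = X ∋ i × X ∋ j × Adj i j

  Ind-sym : ∀ {X i j} → Ind X i j → Ind X j i
  Ind-sym (a , b , c) = b , a , Adj-sym c

  Ind-mono : ∀ {X Y} → X ⊑ Y → ∀ {i j} → Ind X i j → Ind Y i j
  Ind-mono f (a , b , c) = f _ a , f _ b , c

  Walk : VSet n → Fin n → Fin n → Set
  Walk X = Star (Ind X)

  ConnV : VSet n → Set
  ConnV X = ∃ λ r → X ∋ r × (∀ i → X ∋ i → Walk X r i)

  walk-sym : ∀ {X i j} → Walk X i j → Walk X j i
  walk-sym = reverse Ind-sym

  conn-walk : ∀ {X} → ConnV X → ∀ {i j} → X ∋ i → X ∋ j → Walk X i j
  conn-walk (r , _ , w) p q = walk-sym (w _ p) ◅◅ w _ q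

  conn-cong : ∀ {X Y} → X ⊑ Y → Y ⊑ X → ConnV X → ConnV Y
  conn-cong f g (r , p , w) = r , f r p , λ i q → Star.map (Ind-mono f) (w i (g i q))

  private
    lst : VSet n → List (Fin n × Fin n)
    lst X = edgesWithin (elems X) (edges G)

    lst⁺ : ∀ {X i j} → Ind X i j → toℕ i < toℕ j → (i , j) ∈ lst X
    lst⁺ {X} (a , b , c) lt = ∈-filter⁺ (λ e → ((proj₁ e ∈ᵇ elems X) ∧ (proj₂ e ∈ᵇ elems X)) Bool.≟ true) (∈-edges⁺ c lt)
      (∧-intro (∈ᵇ-intro {S = elems X} (∈-elems⁺ {S = X} a)) (∈ᵇ-intro {S = elems X} (∈-elems⁺ {S = X} b)))

    lst⁻ : ∀ {X i j} → (i , j) ∈ lst X → Ind X i j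
    lst⁻ {X} {i} {j} m with ∈-filter⁻ (λ e → ((proj₁ e ∈ᵇ elems X) ∧ (proj₂ e ∈ᵇ elems X)) Bool.≟ true) {xs = edges G} m
    ... | m′ , p = ∈-elems⁻ X (∈ᵇ-elim (elems X) (∧-left p)) , ∈-elems⁻ X (∈ᵇ-elim (elems X) (∧-right {i ∈ᵇ elems X} p)) , proj₁ (∈-edges⁻ m′)

    step⁺ : ∀ {X i j} → Ind X i j → Step (lst X) i j
    step⁺ {X} {i} {j} p@(_ , _ , c) with <-cmp (toℕ i) (toℕ j)
    ... | tri< lt _ _ = inj₁ (lst⁺ p lt)
    ... | tri≈ _ e _ = ⊥-elim (Adj-≢ c (toℕ-injective e))
    ... | tri> _ _ gt = inj₂ (lst⁺ (Ind-sym p) gt)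

    step⁻ : ∀ {X i j} → Step (lst X) i j → Ind X i j
    step⁻ (inj₁ m) = lst⁻ m
    step⁻ (inj₂ m) = Ind-sym (lst⁻ m)

  -- Outside this block only soundness and completeness of the search are visible, so it never
  -- unfolds during later proofs.
  abstract
    connB : VSet n → Bool
    connB X = connectedB (elems X) (edgesWithin (elems X) (edges G))

    connB-sound : ∀ {X} → connB X ≡ true → ConnV X
    connB-sound {X} p with connectedB-sound (elems X) (lst X) p
    ... | s , m , w = s , ∈-elems⁻ X m , λ i q → Star.map step⁻ (w (∈-elems⁺ {S = X} q))

    connB-complete : ∀ {X} → ConnV X → connB X ≡ true
    connB-complete {X} (r , p , w) = connectedB-complete (elems X) (lst X) (∈-elems⁺ {S = X} p) (λ m → Star.map step⁺ (w _ (∈-elems⁻ X m)))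

    comp : Fin n → VSet n → VSet n
    comp u X i = reach (edgesWithin (elems X) (edges G)) u n i

    comp-sound : ∀ {u X i} → comp u X ∋ i → Walk X u i
    comp-sound {u} {X} {i} p = Star.map step⁻ (reach-sound (lst X) u n i (is-mem p))

    comp-complete : ∀ {u X i} → Walk X u i → comp u X ∋ i
    comp-complete {u} {X} w = mem (reach-complete (lst X) u (Star.map step⁺ w))

    -- The link between `isCut` and cut vertices of vertex sets. It holds by computation, because
    -- `elems (full ─ v)` unfolds to the filter in `isCut`, and so belongs where `connB` is
    -- transparent.
    isCut-connB : ∀ v → isCut G v ≡ not (connB (full ─ v))
    isCut-connB v = refl

  walk-end : ∀ {X i j} → X ∋ i → Walk X i j → X ∋ j
  walk-end p ε = p
  walk-end p ((_ , q , _) ◅ w) = walk-end q w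

  comp-⊑ : ∀ {u X} → X ∋ u → comp u X ⊑ X
  comp-⊑ p i q = walk-end p (comp-sound q)

  comp-step : ∀ {u X i j} → comp u X ∋ i → Ind X i j → comp u X ∋ j
  comp-step p st = comp-complete (comp-sound p ◅◅ (st ◅ ε))

  comp-root : ∀ {u X} → comp u X ∋ u
  comp-root = comp-complete ε

  comp-conn : ∀ {u X} → ConnV (comp u X)
  comp-conn {u} {X} = u , comp-root {u} {X} , λ i p → go comp-root (comp-sound p)
    where
    go : ∀ {i j} → comp u X ∋ i → Walk X i j → Walk (comp u X) i j
    go p ε = ε
    go p (st@(_ , _ , c) ◅ w) = (p , comp-step p st , c) ◅ go (comp-step p st) w

  connected⇒ : Connected G → ConnV full
  connected⇒ p with connectedB-sound (allFin n) (edges G) p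
  ... | s , _ , w = s , mem refl , λ i _ → Star.map st (w (∈-allFin i))
    where
    st : ∀ {i j} → Step (edges G) i j → Ind full i j
    st (inj₁ m) = mem refl , mem refl , proj₁ (∈-edges⁻ m)
    st (inj₂ m) = mem refl , mem refl , Adj-sym (proj₁ (∈-edges⁻ m))

-- Connected subgraphs and F

record Sub (n : ℕ) : Set where
  constructor subgraph
  field
    V : VSet n
    E : Fin n → Fin n → Bool
open Sub public

infix 4 _≐_
_≐_ : ∀ {n} → Sub n → Sub n → Set
T ≐ T′ = (∀ i → V T i ≡ V T′ i) × (∀ i j → E T i j ≡ E T′ i j)

Edge : ∀ {n} → Sub n → Fin n → Fin n → Set
Edge T i j = E T i j ≡ true

edge-resp : ∀ {n} {T T′ : Sub n} → T ≐ T′ → ∀ {i j} → Edge T i j → Edge T′ i j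
edge-resp (_ , e) {i} {j} p = trans (sym (e i j)) p

vertex-resp : ∀ {n} {T T′ : Sub n} → T ≐ T′ → V T ⊑ V T′
vertex-resp (e , _) i p = mem (trans (sym (e i)) (is-mem p))

≐-sym : ∀ {n} {T T′ : Sub n} → T ≐ T′ → T′ ≐ T
≐-sym (e , f) = (λ i → sym (e i)) , (λ i j → sym (f i j))

≐-intro : ∀ {n} {T T′ : Sub n} → V T ⊑ V T′ → V T′ ⊑ V T → (∀ {i j} → Edge T i j → Edge T′ i j) → (∀ {i j} → Edge T′ i j → Edge T i j) → T ≐ T′
≐-intro vs vs′ es es′ = (λ i → bool-ext (λ p → is-mem (vs i (mem p))) (λ p → is-mem (vs′ i (mem p)))) , λ i j → bool-ext es es′

filter∈sublists : ∀ {A : Set} {P : A → Set} (P? : ∀ x → Dec (P x)) xs → filter P? xs ∈ sublists xs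
filter∈sublists P? [] = here refl
filter∈sublists P? (x ∷ xs) with P? x
... | yes _ = ∈-++⁺ˡ (∈-map⁺ (x ∷_) (filter∈sublists P? xs))
... | no _ = ∈-++⁺ʳ (map (x ∷_) (sublists xs)) (filter∈sublists P? xs)

sublists-⊆ : ∀ {A : Set} (xs : List A) {ys} → ys ∈ sublists xs → ∀ {y} → y ∈ ys → y ∈ xs
sublists-⊆ [] (here refl) ()
sublists-⊆ (x ∷ xs) m q with ∈-++⁻ (map (x ∷_) (sublists xs)) m
... | inj₂ m′ = there (sublists-⊆ xs m′ q)
... | inj₁ m′ with ∈-map⁻ (x ∷_) m′
sublists-⊆ (x ∷ xs) m (here refl) | inj₁ m′ | zs , m″ , refl = here refl
sublists-⊆ (x ∷ xs) m (there q) | inj₁ m′ | zs , m″ , refl = there (sublists-⊆ xs m″ q)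

sublists-ext : ∀ {A : Set} {xs ys zs : List A} → Unique xs → ys ∈ sublists xs → zs ∈ sublists xs →
  (∀ {x} → x ∈ ys → x ∈ zs) → (∀ {x} → x ∈ zs → x ∈ ys) → ys ≡ zs
sublists-ext {xs = []} _ (here refl) (here refl) _ _ = refl
sublists-ext {xs = x ∷ xs} (x∉ ∷ u) my mz f g with ∈-++⁻ (map (x ∷_) (sublists xs)) my | ∈-++⁻ (map (x ∷_) (sublists xs)) mz
... | inj₂ a | inj₂ b = sublists-ext u a b f g
... | inj₁ a | inj₂ b with ∈-map⁻ (x ∷_) a
...   | ys′ , _ , refl = ⊥-elim (All.lookup x∉ (sublists-⊆ xs b (f (here refl))) refl)
sublists-ext {xs = x ∷ xs} (x∉ ∷ u) my mz f g | inj₂ a | inj₁ b with ∈-map⁻ (x ∷_) b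
...   | zs′ , _ , refl = ⊥-elim (All.lookup x∉ (sublists-⊆ xs a (g (here refl))) refl)
sublists-ext {xs = x ∷ xs} (x∉ ∷ u) my mz f g | inj₁ a | inj₁ b with ∈-map⁻ (x ∷_) a | ∈-map⁻ (x ∷_) b
...   | ys′ , a′ , refl | zs′ , b′ , refl = cong (x ∷_) (sublists-ext u a′ b′
          (λ m → drop (sublists-⊆ xs a′ m) (f (there m))) (λ m → drop (sublists-⊆ xs b′ m) (g (there m))))
  where
  drop : ∀ {y ws} → y ∈ xs → y ∈ x ∷ ws → y ∈ ws
  drop m (here refl) = ⊥-elim (All.lookup x∉ m refl)
  drop m (there q) = q

sublists-unique : ∀ {A : Set} {xs : List A} → Unique xs → Unique (sublists xs)
sublists-unique [] = [] ∷ []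
sublists-unique {xs = x ∷ xs} (x∉ ∷ u) = Uniqueₚ.++⁺ (Uniqueₚ.map⁺ Listₚ.∷-injectiveʳ (sublists-unique u)) (sublists-unique u) dis
  where
  dis : ∀ {v} → (v ∈ map (x ∷_) (sublists xs) × v ∈ sublists xs) → ⊥
  dis (p , q) with ∈-map⁻ (x ∷_) p
  ... | ys , _ , refl = All.lookup x∉ (sublists-⊆ xs q (here refl)) refl

pairings : ∀ {A B : Set} → (A → List B) → List A → List (A × B)
pairings h xs = concatMap (λ x → map (x ,_) (h x)) xs

pairings-unique : ∀ {A B : Set} (h : A → List B) {xs} → Unique xs → (∀ {x} → x ∈ xs → Unique (h x)) → Unique (pairings h xs)
pairings-unique h [] _ = []
pairings-unique h {x ∷ xs} (x∉ ∷ u) uh = Uniqueₚ.++⁺ (Uniqueₚ.map⁺ (λ { refl → refl }) (uh (here refl))) (pairings-unique h u (uh ∘ there)) dis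
  where
  dis : ∀ {v} → (v ∈ map (x ,_) (h x) × v ∈ pairings h xs) → ⊥
  dis (p , q) with ∈-map⁻ (x ,_) p | find (∈-concatMap⁻ _ {xs = xs} q)
  ... | _ , _ , refl | y , y∈ , r with ∈-map⁻ (y ,_) r
  ...   | _ , _ , refl = All.lookup x∉ y∈ refl

∈-pairings⁺ : ∀ {A B : Set} (h : A → List B) {xs x y} → x ∈ xs → y ∈ h x → (x , y) ∈ pairings h xs
∈-pairings⁺ h {xs} m q = ∈-concatMap⁺ _ {xs = xs} (lose m (∈-map⁺ (_ ,_) q))

∈-pairings⁻ : ∀ {A B : Set} (h : A → List B) xs {x y} → (x , y) ∈ pairings h xs → x ∈ xs × y ∈ h x
∈-pairings⁻ h xs m with find (∈-concatMap⁻ _ {xs = xs} m)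
... | x , x∈ , q with ∈-map⁻ (x ,_) q
...   | y , y∈ , refl = x∈ , y∈

-- Turns the sum in the definition of `F` into the length of a single list of pairs.
length-pairings : ∀ {A B : Set} (h : A → List B) xs → sum (map (length ∘ h) xs) ≡ length (pairings h xs)
length-pairings h [] = refl
length-pairings h (x ∷ xs) = sym (trans (Listₚ.length-++ (map (x ,_) (h x))) (cong₂ _+_ (Listₚ.length-map (x ,_) (h x)) (sym (length-pairings h xs))))

module Subgraphs {n : ℕ} (G : Graph n) where
  open Induced G
  open Counting (_≐_ {n}) public

  -- Edges form a symmetric relation, in contrast to the increasing pairs listed by `edges`. The
  -- root provides nonemptiness, the walks from it connectedness.
  record InS (S : VSet n) (T : Sub n) : Set where
    field
      V⊑ : V T ⊑ S
      E-sym : ∀ {i j} → Edge T i j → Edge T j i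
      E-V : ∀ {i j} → Edge T i j → V T ∋ i
      E-adj : ∀ {i j} → Edge T i j → Adj i j
      root : Fin n
      root∈ : V T ∋ root
      walk : ∀ i → V T ∋ i → Star (Edge T) root i
  open InS public

  InU : VSet n → Fin n → Sub n → Set
  InU S u T = InS S T × V T ∋ u

  InS-mono : ∀ {S S′ T} → S ⊑ S′ → InS S T → InS S′ T
  InS-mono f p = record { V⊑ = λ i q → f i (V⊑ p i q) ; E-sym = E-sym p ; E-V = E-V p ; E-adj = E-adj p ; root = root p ; root∈ = root∈ p ; walk = walk p }

  walk-any : ∀ {S T} → InS S T → ∀ {i j} → V T ∋ i → V T ∋ j → Star (Edge T) i j
  walk-any p {i} {j} a b = reverse (E-sym p) (walk p i a) ◅◅ walk p j b

  private
    within : List (Fin n) → List (Fin n × Fin n)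
    within S = edgesWithin S (edges G)

    inner : List (Fin n) → List (List (Fin n × Fin n))
    inner S = filter (λ E′ → connectedB S E′ Bool.≟ true) (sublists (within S))

    -- The subgraphs in the form in which `F` enumerates them: a vertex list with an edge list on
    -- it. Decoding gives the lower bound for the number of subgraphs, encoding the upper one.
    codes : List (List (Fin n) × List (Fin n × Fin n))
    codes = pairings inner (sublists (allFin n))

    length-codes : length codes ≡ F G
    length-codes = sym (length-pairings inner (sublists (allFin n)))

    edges-unique : Unique (edges G)
    edges-unique = pairings-unique _ (Uniqueₚ.allFin⁺ n) (λ {i} _ → Uniqueₚ.filter⁺ _ (Uniqueₚ.filter⁺ (λ j → adj G i j Bool.≟ true) (Uniqueₚ.allFin⁺ n)))

    within-unique : ∀ S → Unique (within S)
    within-unique S = Uniqueₚ.filter⁺ _ edges-unique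

    codes-unique : Unique codes
    codes-unique = pairings-unique inner (sublists-unique (Uniqueₚ.allFin⁺ n)) (λ {S} _ → Uniqueₚ.filter⁺ (λ E′ → connectedB S E′ Bool.≟ true) (sublists-unique (within-unique S)))

    within⁺ : ∀ {S i j} → i ∈ S → j ∈ S → (i , j) ∈ edges G → (i , j) ∈ within S
    within⁺ {S} a b m = ∈-filter⁺ (λ e → ((proj₁ e ∈ᵇ S) ∧ (proj₂ e ∈ᵇ S)) Bool.≟ true) m (∧-intro (∈ᵇ-intro {S = S} a) (∈ᵇ-intro {S = S} b))

    within⁻ : ∀ {S i j} → (i , j) ∈ within S → i ∈ S × j ∈ S × (i , j) ∈ edges G
    within⁻ {S} {i} m with ∈-filter⁻ (λ e → ((proj₁ e ∈ᵇ S) ∧ (proj₂ e ∈ᵇ S)) Bool.≟ true) {xs = edges G} m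
    ... | m′ , p = ∈ᵇ-elim S (∧-left p) , ∈ᵇ-elim S (∧-right {i ∈ᵇ S} p) , m′

    pairB : List (Fin n × Fin n) → Fin n → Fin n → Bool
    pairB E′ i j = any (λ e → (proj₁ e == i) ∧ (proj₂ e == j)) E′

    pairB⁺ : ∀ {E′ i j} → (i , j) ∈ E′ → pairB E′ i j ≡ true
    pairB⁺ {E′} {i} {j} m = any-intro (λ e → (proj₁ e == i) ∧ (proj₂ e == j)) m (∧-intro (==-refl i) (==-refl j))

    pairB⁻ : ∀ E′ {i j} → pairB E′ i j ≡ true → (i , j) ∈ E′
    pairB⁻ E′ {i} {j} p with any-elim (λ e → (proj₁ e == i) ∧ (proj₂ e == j)) E′ p
    ... | (a , b) , m , q with ==⇒≡ {i = a} {i} (∧-left q) | ==⇒≡ {i = b} {j} (∧-right {a == i} q)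
    ...   | refl | refl = m

    decode : List (Fin n) × List (Fin n × Fin n) → Sub n
    decode (S , E′) = subgraph (_∈ᵇ S) (λ i j → pairB E′ i j ∨ pairB E′ j i)

    step⇒ : ∀ {S E′ i j} → Step E′ i j → Edge (decode (S , E′)) i j
    step⇒ (inj₁ m) = ∨-introˡ (pairB⁺ m)
    step⇒ {E′ = E′} {i} {j} (inj₂ m) = ∨-introʳ {pairB E′ i j} (pairB⁺ m)

    step⇐ : ∀ {S} E′ {i j} → Edge (decode (S , E′)) i j → Step E′ i j
    step⇐ E′ {i} {j} p with ∨-elim {pairB E′ i j} p
    ... | inj₁ q = inj₁ (pairB⁻ E′ q)
    ... | inj₂ q = inj₂ (pairB⁻ E′ q)

    codes⁻ : ∀ {S E′} → (S , E′) ∈ codes → S ∈ sublists (allFin n) × E′ ∈ sublists (within S) × connectedB S E′ ≡ true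
    codes⁻ {S} m with ∈-pairings⁻ inner (sublists (allFin n)) m
    ... | a , b = a , ∈-filter⁻ (λ E′ → connectedB S E′ Bool.≟ true) {xs = sublists (within S)} b

    step-within : ∀ {S E′} → E′ ∈ sublists (within S) → ∀ {i j} → Step E′ i j → i ∈ S × Adj i j
    step-within {S} b (inj₁ m) with within⁻ {S} (sublists-⊆ (within S) b m)
    ... | p , _ , q = p , proj₁ (∈-edges⁻ q)
    step-within {S} b (inj₂ m) with within⁻ {S} (sublists-⊆ (within S) b m)
    ... | _ , p , q = p , Adj-sym (proj₁ (∈-edges⁻ q))

    decode-InS : ∀ {c} → c ∈ codes → InS full (decode c)
    decode-InS {S , E′} m with codes⁻ m
    ... | a , b , c with connectedB-sound S E′ c
    ...   | s , s∈ , w = record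
      { V⊑ = λ _ _ → mem refl
      ; E-sym = λ p → step⇒ {S} (step-sym (step⇐ {S} E′ p))
      ; E-V = λ p → mem (∈ᵇ-intro (proj₁ (step-within {S} b (step⇐ {S} E′ p))))
      ; E-adj = λ p → proj₂ (step-within {S} b (step⇐ {S} E′ p))
      ; root = s ; root∈ = mem (∈ᵇ-intro s∈) ; walk = λ i p → Star.map (step⇒ {S}) (w (∈ᵇ-elim S (is-mem p))) }

    decode-inj : ∀ {c d} → c ∈ codes → d ∈ codes → decode c ≐ decode d → c ≡ d
    decode-inj {S , E₁} {S′ , E₂} p q e with codes⁻ p | codes⁻ q
    ... | a , b , _ | a′ , b′ , _ with sublists-ext (Uniqueₚ.allFin⁺ n) a a′
            (λ m → ∈ᵇ-elim S′ (is-mem (vertex-resp e _ (mem (∈ᵇ-intro m))))) (λ m → ∈ᵇ-elim S (is-mem (vertex-resp (≐-sym e) _ (mem (∈ᵇ-intro m)))))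
    ...   | refl = cong (S ,_) (sublists-ext (within-unique S) b b′ (h b b′ e) (h b′ b (≐-sym e)))
      where
      h : ∀ {E₁ E₂} → E₁ ∈ sublists (within S) → E₂ ∈ sublists (within S) → decode (S , E₁) ≐ decode (S , E₂) → ∀ {x} → x ∈ E₁ → x ∈ E₂
      h {E₁} {E₂} b b′ e {i , j} m with step⇐ {S} E₂ (edge-resp {T = decode (S , E₁)} {T′ = decode (S , E₂)} e (step⇒ {S} (inj₁ m)))
      ... | inj₁ r = r
      -- Listed edges are increasing pairs, so an edge never occurs in both orientations.
      ... | inj₂ r = ⊥-elim (<-asym (proj₂ (∈-edges⁻ (proj₂ (proj₂ (within⁻ {S} (sublists-⊆ (within S) b m))))))
                                       (proj₂ (∈-edges⁻ (proj₂ (proj₂ (within⁻ {S} (sublists-⊆ (within S) b′ r)))))))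

    chosen : (T : Sub n) → List (Fin n × Fin n)
    chosen T = filter (λ e → E T (proj₁ e) (proj₂ e) Bool.≟ true) (within (elems (V T)))

    chosen⁺ : ∀ {S T} → InS S T → ∀ {i j} → Edge T i j → toℕ i < toℕ j → (i , j) ∈ chosen T
    chosen⁺ {S} {T} t p lt = ∈-filter⁺ (λ e → E T (proj₁ e) (proj₂ e) Bool.≟ true)
      (within⁺ {elems (V T)} (∈-elems⁺ {S = V T} (E-V t p)) (∈-elems⁺ {S = V T} (E-V t (E-sym t p))) (∈-edges⁺ (E-adj t p) lt)) p

    chosen⁻ : ∀ T {i j} → (i , j) ∈ chosen T → Edge T i j
    chosen⁻ T m = proj₂ (∈-filter⁻ (λ e → E T (proj₁ e) (proj₂ e) Bool.≟ true) {xs = within (elems (V T))} m)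

    chosen-step : ∀ {S T} → InS S T → ∀ {i j} → Edge T i j → Step (chosen T) i j
    chosen-step t {i} {j} p with <-cmp (toℕ i) (toℕ j)
    ... | tri< lt _ _ = inj₁ (chosen⁺ t p lt)
    ... | tri≈ _ e _ = ⊥-elim (Adj-≢ (E-adj t p) (toℕ-injective e))
    ... | tri> _ _ gt = inj₂ (chosen⁺ t (E-sym t p) gt)

    encode : Sub n → List (Fin n) × List (Fin n × Fin n)
    encode T = elems (V T) , chosen T

    encode∈ : ∀ {T} → InS full T → encode T ∈ codes
    encode∈ {T} t = ∈-pairings⁺ inner (filter∈sublists (λ i → V T i Bool.≟ true) (allFin n))
      (∈-filter⁺ (λ E′ → connectedB (elems (V T)) E′ Bool.≟ true) (filter∈sublists (λ e → E T (proj₁ e) (proj₂ e) Bool.≟ true) (within (elems (V T))))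
        (connectedB-complete (elems (V T)) (chosen T) (∈-elems⁺ {S = V T} (root∈ t)) (λ m → Star.map (chosen-step t) (walk t _ (∈-elems⁻ (V T) m)))))

    encode-inj : ∀ {T T′} → InS full T → InS full T′ → encode T ≡ encode T′ → T ≐ T′
    encode-inj {T} {T′} t t′ e = ≐-intro (vv {T} {T′} e₁) (vv {T′} {T} (sym e₁)) (ee t t′ e₂) (ee t′ t (sym e₂))
      where
      e₁ : elems (V T) ≡ elems (V T′)
      e₁ = cong proj₁ e
      e₂ : chosen T ≡ chosen T′
      e₂ = cong proj₂ e
      vv : ∀ {T T′} → elems (V T) ≡ elems (V T′) → V T ⊑ V T′
      vv {T} {T′} e i p = ∈-elems⁻ (V T′) (subst (i ∈_) e (∈-elems⁺ {S = V T} p))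
      ee : ∀ {T T′} → InS full T → InS full T′ → chosen T ≡ chosen T′ → ∀ {i j} → Edge T i j → Edge T′ i j
      ee {T} {T′} t t′ e p with chosen-step t p
      ... | inj₁ m = chosen⁻ T′ (subst (_ ∈_) e m)
      ... | inj₂ m = E-sym t′ (chosen⁻ T′ (subst (_ ∈_) e m))

  -- Together with `F-atMost` this is all that is used about `F`: every bound on it passes through
  -- lists of inequivalent connected subgraphs.
  F-atLeast : AtLeast (InS full) (F G)
  F-atLeast = subst (AtLeast (InS full)) length-codes (atLeast-index codes decode codes-unique decode-InS decode-inj)

  F-atMost : AtMost (InS full) (F G)
  F-atMost = subst (AtMost (InS full)) length-codes (atMost-code encode codes encode∈ encode-inj)

-- Cut vertices, splittings and leaves

card-single : ∀ {n} (v : Fin n) → card (_== v) ≤ 1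
card-single v = card≤length {S = _== v} {xs = v ∷ []} (λ i p → here (==⇒≡ (is-mem p)))

infixl 6 _⊕_
_⊕_ : ∀ {n} → VSet n → Fin n → VSet n
(X ⊕ v) i = X i ∨ (i == v)

⊕-old : ∀ {n} {X : VSet n} {v i} → X ∋ i → X ⊕ v ∋ i
⊕-old p = mem (∨-introˡ (is-mem p))

⊕-new : ∀ {n} {X : VSet n} {v} → X ⊕ v ∋ v
⊕-new {X = X} {v} = mem (∨-introʳ {X v} (==-refl v))

⊕-elim : ∀ {n} {X : VSet n} {v i} → X ⊕ v ∋ i → X ∋ i ⊎ i ≡ v
⊕-elim {X = X} {v} {i} p with ∨-elim {X i} (is-mem p)
... | inj₁ q = inj₁ (mem q)
... | inj₂ q = inj₂ (==⇒≡ q)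

infixl 6 _∖_
_∖_ : ∀ {n} → VSet n → VSet n → VSet n
(S ∖ X) i = S i ∧ not (X i)

∖-intro : ∀ {n} {S X : VSet n} {i} → S ∋ i → ¬ (X ∋ i) → S ∖ X ∋ i
∖-intro p q = mem (∧-intro (is-mem p) (true-not (q ∘ mem)))

∖-⊑ : ∀ {n} {S X : VSet n} {i} → S ∖ X ∋ i → S ∋ i
∖-⊑ p = mem (∧-left (is-mem p))

∖-∌ : ∀ {n} {S X : VSet n} {i} → S ∖ X ∋ i → ¬ (X ∋ i)
∖-∌ {S = S} {i = i} p q = not-true (∧-right {S i} (is-mem p)) (is-mem q)

∋? : ∀ {n} (S : VSet n) i → Dec (S ∋ i)
∋? S i with S i Bool.≟ true
... | yes p = yes (mem p)
... | no p = no (p ∘ is-mem)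

⊑? : ∀ {n} (S X : VSet n) → (∃ λ b → S ∋ b × ¬ (X ∋ b)) ⊎ S ⊑ X
⊑? S X with any? (∋? (S ∖ X))
... | yes (b , p) = inj₁ (b , ∖-⊑ p , ∖-∌ p)
... | no ¬p = inj₂ sub
  where
  sub : S ⊑ X
  sub i q with ∋? X i
  ... | yes r = r
  ... | no r = ⊥-elim (¬p (i , ∖-intro q r))

⊕-card : ∀ {n} {X : VSet n} {v} → ¬ (X ∋ v) → card (X ⊕ v) ≡ suc (card X)
⊕-card {X = X} {v} p = trans (card-─ {S = X ⊕ v} (⊕-new {X = X})) (cong suc (card-cong {S = X ⊕ v ─ v} {X} h (λ i q → ─-intro {S = X ⊕ v} (⊕-old {X = X} q) (λ { refl → p q }))))
  where
  h : X ⊕ v ─ v ⊑ X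
  h i q with ⊕-elim (─-⊑ q)
  ... | inj₁ r = r
  ... | inj₂ r = ⊥-elim (─-≢ q r)

module Cuts {n : ℕ} (G : Graph n) where
  open Induced G public

  conn? : ∀ X → Dec (ConnV X)
  conn? X with connB X Bool.≟ true
  ... | yes p = yes (connB-sound p)
  ... | no p = no (λ c → p (connB-complete c))

  -- Cut and non-cut vertices are relative to the subgraph induced on `S`. The empty set is not
  -- connected, so the vertex of a one-element `S` counts as a cut vertex.
  nc : VSet n → VSet n
  nc S v = S v ∧ connB (S ─ v)

  cut : VSet n → VSet n
  cut S v = S v ∧ not (connB (S ─ v))

  nc-intro : ∀ {S v} → S ∋ v → ConnV (S ─ v) → nc S ∋ v
  nc-intro p c = mem (∧-intro (is-mem p) (connB-complete c))

  nc-∈ : ∀ {S v} → nc S ∋ v → S ∋ v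
  nc-∈ p = mem (∧-left (is-mem p))

  nc-conn : ∀ {S v} → nc S ∋ v → ConnV (S ─ v)
  nc-conn {S} {v} p = connB-sound (∧-right {S v} (is-mem p))

  cut-intro : ∀ {S v} → S ∋ v → ¬ ConnV (S ─ v) → cut S ∋ v
  cut-intro p c = mem (∧-intro (is-mem p) (true-not (λ q → c (connB-sound q))))

  cut-∈ : ∀ {S v} → cut S ∋ v → S ∋ v
  cut-∈ p = mem (∧-left (is-mem p))

  cut-¬conn : ∀ {S v} → cut S ∋ v → ¬ ConnV (S ─ v)
  cut-¬conn {S} {v} p c = not-true (∧-right {S v} (is-mem p)) (connB-complete c)

  card-nc-cut : ∀ S → card (nc S) + card (cut S) ≡ card S
  card-nc-cut S = ≤-antisym (card-⊎ {S = S} {nc S} {cut S} (λ i → nc-∈ {S}) (λ i → cut-∈ {S}) (λ i p q → cut-¬conn {S} q (nc-conn {S} p)))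
    (card-∪ {S = S} {nc S} {cut S} h)
    where
    h : ∀ i → S ∋ i → nc S ∋ i ⊎ cut S ∋ i
    h i p with conn? (S ─ i)
    ... | yes c = inj₁ (nc-intro p c)
    ... | no c = inj₂ (cut-intro p c)

  conn-extend : ∀ {X S} → ConnV X → X ⊑ S → (∀ i → S ∋ i → ∃ λ y → X ∋ y × Walk S y i) → ConnV S
  conn-extend (r , p , w) f h = r , f r p , λ i q → let (y , a , b) = h i q in Star.map (Ind-mono f) (w y a) ◅◅ b

  conn-add : ∀ {X S v y} → ConnV X → X ⊑ S → S ∋ v → X ∋ y → Adj y v → (∀ i → S ∋ i → X ∋ i ⊎ i ≡ v) → ConnV S
  conn-add {X} {S} {v} {y} c f s p a h = conn-extend c f go
    where
    go : ∀ i → S ∋ i → ∃ λ y → X ∋ y × Walk S y i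
    go i q with h i q
    ... | inj₁ r = i , r , ε
    ... | inj₂ refl = y , p , (f y p , s , a) ◅ ε

  exit : ∀ {S X a b} → Walk S a b → X ∋ a → ¬ (X ∋ b) → ∃ λ i → ∃ λ j → X ∋ i × ¬ (X ∋ j) × Ind S i j
  exit ε p q = ⊥-elim (q p)
  exit {S} {X} {a} (_◅_ {j = j} st w) p q with ∋? X j
  ... | yes r = exit w r q
  ... | no r = a , j , p , r , st

  neighbour : ∀ {S v b} → ConnV S → S ∋ v → S ∋ b → b ≢ v → ∃ λ y → S ∋ y × Adj v y
  neighbour c p q ne with conn-walk c p q
  ... | ε = ⊥-elim (ne refl)
  ... | (_ , r , a) ◅ _ = _ , r , a

  -- The connected set `X` is enlarged along edges leaving it until a single vertex of `S` is
  -- missing; that last vertex can be deleted from `S`.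
  removable : ∀ {S X b} → ConnV S → ConnV X → X ⊑ S → S ∋ b → ¬ (X ∋ b) → ∃ λ v → S ∋ v × ¬ (X ∋ v) × ConnV (S ─ v)
  removable {S} {X} cS cX f p q = go (card S) cX f p q (m≤n+m (card S) (card X))
    where
    go : ∀ d {X b} → ConnV X → X ⊑ S → S ∋ b → ¬ (X ∋ b) → card S ≤ card X + d → ∃ λ v → S ∋ v × ¬ (X ∋ v) × ConnV (S ─ v)
    go d {X} {b} cX@(r , r∈ , _) f p q le with exit (conn-walk cS (f r r∈) p) r∈ q
    ... | i , j , i∈ , j∉ , (_ , j∈ , a) with ⊑? S (X ⊕ j)
    ...   | inj₂ all = j , j∈ , j∉ , conn-cong {X} (λ t u → ─-intro (f t u) (λ { refl → j∉ u })) back cX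
      where
      back : S ─ j ⊑ X
      back t u with ⊕-elim (all t (─-⊑ u))
      ... | inj₁ v = v
      ... | inj₂ e = ⊥-elim (─-≢ u e)
    go zero {X} {b} cX f p q le | i , j , i∈ , j∉ , (_ , j∈ , a) | inj₁ _ =
      ⊥-elim (<-irrefl refl (≤-trans (subst (_≤ card S) (⊕-card {X = X} j∉) (card-mono {S = X ⊕ j} sub)) (subst (card S ≤_) (+-identityʳ _) le)))
      where
      sub : X ⊕ j ⊑ S
      sub t u with ⊕-elim u
      ... | inj₁ v = f t v
      ... | inj₂ refl = j∈
    go (suc d) {X} {b} cX f p q le | i , j , i∈ , j∉ , (_ , j∈ , a) | inj₁ (b′ , p′ , q′)
      with go d {X ⊕ j} (conn-add {X} cX (λ t → ⊕-old) (⊕-new) i∈ a (λ t → ⊕-elim)) sub p′ q′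
              (subst (card S ≤_) (trans (+-suc (card X) d) (cong (_+ d) (sym (⊕-card {X = X} j∉)))) le)
      where
      sub : X ⊕ j ⊑ S
      sub t u with ⊕-elim u
      ... | inj₁ v = f t v
      ... | inj₂ refl = j∈
    ... | v , a₁ , a₂ , a₃ = v , a₁ , (λ z → a₂ (⊕-old z)) , a₃

  -- Deleting a non-cut vertex v can only create the non-cut vertex it hangs on, which v itself makes up for.
  nc-delete : ∀ {S v b} → ConnV S → nc S ∋ v → S ∋ b → b ≢ v → card (nc (S ─ v)) ≤ card (nc S)
  nc-delete {S} {v} {b} c v∈ b∈ b≢v with neighbour c (nc-∈ {S} v∈) b∈ b≢v
  ... | y , y∈ , a = subst (card (nc (S ─ v)) ≤_) (sym (trans (card-─ {S = nc S} v∈) (sym (+-comm (card (nc S ─ v)) 1))))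
        (≤-trans (card-∪ {S = nc (S ─ v)} {nc S ─ v} {_== y} h) (+-monoʳ-≤ _ (card-single y)))
    where
    h : ∀ w → nc (S ─ v) ∋ w → nc S ─ v ∋ w ⊎ (_== y) ∋ w
    h w p with w ≡? y
    ... | yes refl = inj₂ (mem (==-refl y))
    ... | no w≢y = inj₁ (─-intro (nc-intro (─-⊑ (nc-∈ p)) conn) w≢v)
      where
      w≢v : w ≢ v
      w≢v = ─-≢ (nc-∈ p)
      conn : ConnV (S ─ w)
      conn = conn-add {S ─ v ─ w} {S ─ w} {v} {y} (nc-conn p)
        (λ i q → ─-intro (─-⊑ (─-⊑ q)) (─-≢ q))
        (─-intro (nc-∈ v∈) (λ e → w≢v (sym e)))
        (─-intro (─-intro y∈ (λ e → Adj-≢ a (sym e))) (λ e → w≢y (sym e))) (Adj-sym a) cov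
        where
        cov : ∀ i → S ─ w ∋ i → S ─ v ─ w ∋ i ⊎ i ≡ v
        cov i q with i ≡? v
        ... | yes e = inj₂ e
        ... | no ne = inj₁ (─-intro (─-intro (─-⊑ q) ne) (─-≢ q))

  record Split (S : VSet n) (u : Fin n) : Set where
    field
      A B : VSet n
      A⊑ : A ⊑ S
      B⊑ : B ⊑ S
      cover : ∀ i → S ∋ i → A ∋ i ⊎ B ∋ i
      u∈A : A ∋ u
      u∈B : B ∋ u
      meet : ∀ {i} → A ∋ i → B ∋ i → i ≡ u
      nocross : ∀ {i j} → A ∋ i → B ∋ j → Adj i j → i ≡ u ⊎ j ≡ u
      connA : ConnV A
      connB′ : ConnV B
      a₀ : ∃ λ a → A ∋ a × a ≢ u
      b₀ : ∃ λ b → B ∋ b × b ≢ u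

  swap : ∀ {S u} → Split S u → Split S u
  swap s = record
    { A = B ; B = A ; A⊑ = B⊑ ; B⊑ = A⊑ ; cover = λ i p → Sum.swap (cover i p) ; u∈A = u∈B ; u∈B = u∈A
    ; meet = λ p q → meet q p ; nocross = λ p q a → Sum.swap (nocross q p (Adj-sym a))
    ; connA = connB′ ; connB′ = connA ; a₀ = b₀ ; b₀ = a₀ }
    where open Split s

  module _ {S : VSet n} {u : Fin n} (s : Split S u) where
    open Split s

    private
      -- Folding B onto u turns walks of S into walks of A.
      ρ : Fin n → Fin n
      ρ x with ∋? A x
      ... | yes _ = x
      ... | no _ = u

      ρ-A : ∀ {x} → A ∋ x → ρ x ≡ x
      ρ-A {x} p with ∋? A x
      ... | yes _ = refl
      ... | no q = ⊥-elim (q p)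

      inB : ∀ {x} → S ∋ x → ¬ (A ∋ x) → B ∋ x
      inB {x} p q with cover x p
      ... | inj₁ a = ⊥-elim (q a)
      ... | inj₂ b = b

      fold : ∀ {Y} → (∀ {i} → Y ∋ i → S ∋ i) → ∀ {x y} → Ind Y x y → Star (Ind (λ i → A i ∧ Y i)) (ρ x) (ρ y)
      fold f {x} {y} (p , q , a) with ∋? A x | ∋? A y
      ... | yes x∈ | yes y∈ = (mem (∧-intro (is-mem x∈) (is-mem p)) , mem (∧-intro (is-mem y∈) (is-mem q)) , a) ◅ ε
      ... | no _ | no _ = ε
      ... | yes x∈ | no y∉ with nocross x∈ (inB (f q) y∉) a
      ...   | inj₁ refl = ε
      ...   | inj₂ refl = ⊥-elim (y∉ u∈A)
      fold f {x} {y} (p , q , a) | no x∉ | yes y∈ with nocross y∈ (inB (f p) x∉) (Adj-sym a)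
      ...   | inj₁ refl = ε
      ...   | inj₂ refl = ⊥-elim (x∉ u∈A)

    split-conn⁻ : ∀ {w} → w ≢ u → ConnV (S ─ w) → ConnV (A ─ w)
    split-conn⁻ {w} ne c = u , ─-intro u∈A (ne ∘ sym) , λ i p →
      Star.map (Ind-mono (λ j q → ─-intro (mem (∧-left {A j} (is-mem q))) (─-≢ {S = S} (mem (∧-right {A j} (is-mem q))))))
        (subst₂ (Star (Ind (λ i → A i ∧ (S ─ w) i))) (ρ-A u∈A) (ρ-A (─-⊑ p))
          (Star.kleisliStar ρ (fold (─-⊑)) (conn-walk c (─-intro (A⊑ u u∈A) (ne ∘ sym)) (─-intro (A⊑ i (─-⊑ p)) (─-≢ p)))))

    split-conn⁺ : ∀ {w} → A ∋ w → w ≢ u → ConnV (A ─ w) → ConnV (S ─ w)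
    split-conn⁺ {w} w∈ ne c = conn-extend c (λ i p → ─-intro (A⊑ i (─-⊑ p)) (─-≢ p)) go
      where
      go : ∀ i → S ─ w ∋ i → ∃ λ y → A ─ w ∋ y × Walk (S ─ w) y i
      go i p with cover i (─-⊑ p)
      ... | inj₁ a = i , ─-intro a (─-≢ p) , ε
      ... | inj₂ b = u , ─-intro u∈A (ne ∘ sym) , Star.map (Ind-mono (λ j q → ─-intro (B⊑ j q) (λ { refl → ne (meet w∈ q) }))) (conn-walk connB′ u∈B b)

    split-nc⁺ : nc A ─ u ⊑ nc S ─ u
    split-nc⁺ i p = ─-intro (nc-intro (A⊑ i i∈) (split-conn⁺ i∈ (─-≢ p) (nc-conn (─-⊑ p)))) (─-≢ p)
      where
      i∈ : A ∋ i
      i∈ = nc-∈ (─-⊑ p)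

    split-nc⁻ : ∀ {i} → nc S ─ u ∋ i → A ∋ i → nc A ─ u ∋ i
    split-nc⁻ {i} p q = ─-intro (nc-intro q (split-conn⁻ (─-≢ p) (nc-conn (─-⊑ p)))) (─-≢ p)

  module _ {S : VSet n} {u : Fin n} (s : Split S u) where
    open Split s

    -- For a vertex other than `u`, its deletion disconnects `S` exactly when it disconnects the
    -- side containing it, because the other side stays attached through `u`.
    split-nc : card (nc S ─ u) ≡ card (nc A ─ u) + card (nc B ─ u)
    split-nc = ≤-antisym (card-∪ {S = nc S ─ u} {nc A ─ u} {nc B ─ u} h)
      (card-⊎ {S = nc S ─ u} {nc A ─ u} {nc B ─ u} (split-nc⁺ s) (split-nc⁺ (swap s))
         (λ i p q → ─-≢ p (meet (nc-∈ (─-⊑ p)) (nc-∈ (─-⊑ q)))))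
      where
      h : ∀ i → nc S ─ u ∋ i → nc A ─ u ∋ i ⊎ nc B ─ u ∋ i
      h i p with cover i (nc-∈ (─-⊑ p))
      ... | inj₁ a = inj₁ (split-nc⁻ s p a)
      ... | inj₂ b = inj₂ (split-nc⁻ (swap s) p b)

    split-card : suc (card S) ≡ card A + card B
    split-card = trans (cong suc (trans le (+-comm (card A) _))) (trans (cong (_+ card A) (sym (card-─ {S = B} u∈B))) (+-comm (card B) (card A)))
      where
      h : ∀ i → S ∋ i → A ∋ i ⊎ B ─ u ∋ i
      h i p with cover i p | i ≡? u
      ... | _ | yes refl = inj₁ u∈A
      ... | inj₁ a | _ = inj₁ a
      ... | inj₂ b | no ne = inj₂ (─-intro b ne)
      le : card S ≡ card A + card (B ─ u)
      le = ≤-antisym (card-∪ {S = S} {A} {B ─ u} h)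
        (card-⊎ {S = S} {A} {B ─ u} A⊑ (λ i p → B⊑ i (─-⊑ {S = B} p)) (λ i p q → ─-≢ {S = B} q (meet p (─-⊑ {S = B} q))))

  -- One side is the component of `r` in `S − u` together with `u`, the other is all the rest,
  -- possibly several components. The cut property ensures that the rest has a vertex besides `u`.
  split-at : ∀ {S u r} → ConnV S → cut S ∋ u → S ∋ r → r ≢ u → Split S u
  split-at {S} {u} {r} c u∈cut r∈ r≢u = record
    { A = D ⊕ u ; B = S ∖ D
    ; A⊑ = λ i p → A⊑′ i (⊕-elim p)
    ; B⊑ = λ i → ∖-⊑
    ; cover = cov
    ; u∈A = ⊕-new ; u∈B = uB
    ; meet = λ {i} p q → meet′ (⊕-elim p) q
    ; nocross = λ p q a → cross (⊕-elim p) q a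
    ; connA = conn₁ ; connB′ = u , uB , λ i p → walk-sym (toU p (conn-walk c (∖-⊑ p) u∈))
    ; a₀ = r , ⊕-old (comp-root {r} {S ─ u}) , r≢u
    ; b₀ = other }
    where
    u∈ : S ∋ u
    u∈ = cut-∈ u∈cut
    D : VSet n
    D = comp r (S ─ u)
    r∈′ : S ─ u ∋ r
    r∈′ = ─-intro r∈ r≢u
    D⊑ : D ⊑ S ─ u
    D⊑ = comp-⊑ r∈′
    u∉ : ¬ (D ∋ u)
    u∉ p = ─-≢ (D⊑ u p) refl
    uB : S ∖ D ∋ u
    uB = ∖-intro u∈ u∉
    A⊑′ : ∀ i → D ∋ i ⊎ i ≡ u → S ∋ i
    A⊑′ i (inj₁ p) = ─-⊑ (D⊑ i p)
    A⊑′ i (inj₂ refl) = u∈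
    cov : ∀ i → S ∋ i → D ⊕ u ∋ i ⊎ S ∖ D ∋ i
    cov i p with ∋? D i
    ... | yes q = inj₁ (⊕-old q)
    ... | no q = inj₂ (∖-intro p q)
    meet′ : ∀ {i} → D ∋ i ⊎ i ≡ u → S ∖ D ∋ i → i ≡ u
    meet′ (inj₁ p) q = ⊥-elim (∖-∌ q p)
    meet′ (inj₂ e) q = e
    closed : ∀ {i j} → D ∋ i → S ∋ j → j ≢ u → Adj i j → D ∋ j
    closed p q ne a = comp-step p (D⊑ _ p , ─-intro q ne , a)
    cross : ∀ {i j} → D ∋ i ⊎ i ≡ u → S ∖ D ∋ j → Adj i j → i ≡ u ⊎ j ≡ u
    cross (inj₂ e) q a = inj₁ e
    cross {i} {j} (inj₁ p) q a with j ≡? u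
    ... | yes e = inj₂ e
    ... | no ne = ⊥-elim (∖-∌ q (closed p (∖-⊑ q) ne a))
    conn₁ : ConnV (D ⊕ u)
    conn₁ with exit (conn-walk c r∈ u∈) comp-root u∉
    ... | i , j , i∈ , j∉ , (_ , j∈ , a) with j ≡? u
    ...   | yes refl = conn-add {D} comp-conn (λ t → ⊕-old) (⊕-new) i∈ a (λ t → ⊕-elim)
    ...   | no ne = ⊥-elim (j∉ (closed i∈ j∈ ne a))
    toU : ∀ {b} → S ∖ D ∋ b → Walk S b u → Walk (S ∖ D) b u
    toU p ε = ε
    toU {b} p (_◅_ {j = j} (_ , j∈ , a) w) with b ≡? u
    ... | yes refl = ε
    ... | no ne = (p , j∈B , a) ◅ toU j∈B w
      where
      j∈B : S ∖ D ∋ j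
      j∈B = ∖-intro j∈ (λ q → ∖-∌ p (closed q (∖-⊑ p) ne (Adj-sym a)))
    other : ∃ λ b → S ∖ D ∋ b × b ≢ u
    other with ⊑? (S ─ u) D
    ... | inj₁ (b , p , q) = b , ∖-intro (─-⊑ p) q , ─-≢ p
    ... | inj₂ sub = ⊥-elim (cut-¬conn u∈cut (conn-cong {D} D⊑ sub comp-conn))

  Leaf : VSet n → Fin n → Fin n → Set
  Leaf S v u = S ∋ v × S ∋ u × Adj v u × (∀ {y} → S ∋ y → Adj v y → y ≡ u)

  -- Sending `v` to `u` and fixing all other vertices turns each step of a walk into a step or a
  -- halt.
  leaf-conn : ∀ {S v u} → ConnV S → Leaf S v u → ConnV (S ─ v)
  leaf-conn {S} {v} {u} c (v∈ , u∈ , a , only) = u , ─-intro u∈ u≢v , λ i p →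
    subst₂ (Walk (S ─ v)) (ρ-≢ u≢v) (ρ-≢ (─-≢ p)) (Star.kleisliStar ρ fold (conn-walk c u∈ (─-⊑ p)))
    where
    u≢v : u ≢ v
    u≢v e = Adj-≢ a (sym e)
    ρ : Fin n → Fin n
    ρ x with x ≡? v
    ... | yes _ = u
    ... | no _ = x
    ρ-≢ : ∀ {x} → x ≢ v → ρ x ≡ x
    ρ-≢ {x} p with x ≡? v
    ... | yes q = ⊥-elim (p q)
    ... | no _ = refl
    fold : ∀ {x y} → Ind S x y → Walk (S ─ v) (ρ x) (ρ y)
    fold {x} {y} (p , q , b) with x ≡? v | y ≡? v
    ... | yes refl | yes refl = ε
    ... | yes refl | no _ with only q b
    ...   | refl = ε
    fold {x} {y} (p , q , b) | no _ | yes refl with only p (Adj-sym b)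
    ...   | refl = ε
    fold {x} {y} (p , q , b) | no x≢ | no y≢ = (─-intro p x≢ , ─-intro q y≢ , b) ◅ ε

  leaf-split : ∀ {S v u b} → ConnV S → Leaf S v u → S ∋ b → b ≢ v → b ≢ u → Split S u
  leaf-split {S} {v} {u} {b} c l@(v∈ , u∈ , a , only) b∈ b≢v b≢u = record
    { A = S ─ v ; B = (_== u) ⊕ v
    ; A⊑ = λ i → ─-⊑
    ; B⊑ = λ i p → B⊑′ (⊕-elim p)
    ; cover = cov
    ; u∈A = ─-intro u∈ u≢v ; u∈B = ⊕-old (mem (==-refl u))
    ; meet = λ p q → meet′ p (⊕-elim q)
    ; nocross = λ p q e → cross p (⊕-elim q) e
    ; connA = leaf-conn c l
    ; connB′ = conn-add {_== u} (u , mem (==-refl u) , λ i p → subst (Star _ u) (sym (==⇒≡ (is-mem p))) ε) (λ i → ⊕-old) (⊕-new) (mem (==-refl u)) (Adj-sym a) (λ i → ⊕-elim)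
    ; a₀ = b , ─-intro b∈ b≢v , b≢u
    ; b₀ = v , ⊕-new , (λ e → u≢v (sym e)) }
    where
    u≢v : u ≢ v
    u≢v e = Adj-≢ a (sym e)
    B⊑′ : ∀ {i} → (_== u) ∋ i ⊎ i ≡ v → S ∋ i
    B⊑′ (inj₁ p) = subst (S ∋_) (sym (==⇒≡ (is-mem p))) u∈
    B⊑′ (inj₂ refl) = v∈
    cov : ∀ i → S ∋ i → S ─ v ∋ i ⊎ (_== u) ⊕ v ∋ i
    cov i p with i ≡? v
    ... | yes refl = inj₂ (⊕-new)
    ... | no ne = inj₁ (─-intro p ne)
    meet′ : ∀ {i} → S ─ v ∋ i → (_== u) ∋ i ⊎ i ≡ v → i ≡ u
    meet′ p (inj₁ q) = ==⇒≡ (is-mem q)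
    meet′ p (inj₂ e) = ⊥-elim (─-≢ p e)
    cross : ∀ {i j} → S ─ v ∋ i → (_== u) ∋ j ⊎ j ≡ v → Adj i j → i ≡ u ⊎ j ≡ u
    cross p (inj₁ q) e = inj₂ (==⇒≡ (is-mem q))
    cross p (inj₂ refl) e = inj₁ (only (─-⊑ p) (Adj-sym e))

-- Cycles

module Cycles {n : ℕ} (G : Graph n) where
  open Cuts G

  -- A cycle is a periodic closed walk, injective on every period; this makes rotation trivial.
  record Cyc : Set where
    field
      len : ℕ
      at : ℕ → Fin n
      3≤len : 3 ≤ len
      per : ∀ i → at (len + i) ≡ at i
      step : ∀ i → Adj (at i) (at (suc i))
      inj : ∀ p {i j} → i < len → j < len → at (p + i) ≡ at (p + j) → i ≡ j
  open Cyc public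

  _within_ : Cyc → VSet n → Set
  c within S = ∀ i → S ∋ at c i

  rotate : ℕ → Cyc → Cyc
  rotate p c = record
    { len = len c ; at = λ i → at c (p + i) ; 3≤len = 3≤len c
    ; per = λ i → trans (cong (at c) (trans (sym (+-assoc p (len c) i)) (trans (cong (_+ i) (+-comm p (len c))) (+-assoc (len c) p i)))) (per c (p + i))
    ; step = λ i → subst (λ z → Adj (at c (p + i)) (at c z)) (sym (+-suc p i)) (step c (p + i))
    ; inj = λ q {i} {j} i< j< e → inj c (p + q) i< j< (trans (cong (at c) (+-assoc p q i)) (trans e (cong (at c) (sym (+-assoc p q j))))) }

  module _ (c : Cyc) where

    0<len : 0 < len c
    0<len = ≤-trans (s≤s z≤n) (3≤len c)

    1<len : 1 < len c
    1<len = ≤-trans (s≤s (s≤s z≤n)) (3≤len c)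

    len-suc : ∃ λ l → len c ≡ suc l
    len-suc with len c | 3≤len c
    ... | suc l | _ = l , refl

    -- Reduction of an index modulo the length. All shifts `t` are included because the inductive
    -- step compares the successors of both indices.
    index : ∀ i → ∃ λ j → j < len c × (∀ t → at c (t + j) ≡ at c (t + i))
    index zero = 0 , 0<len , λ _ → refl
    index (suc i) with index i
    ... | j , j< , e with m≤n⇒m<n∨m≡n j<
    ...   | inj₁ lt = suc j , lt , λ t → trans (cong (at c) (+-suc t j)) (trans (e (suc t)) (cong (at c) (sym (+-suc t i))))
    ...   | inj₂ refl = 0 , 0<len , λ t → trans (cong (at c) (+-identityʳ t)) (trans (sym (per c t))
              (trans (cong (at c) (trans (+-comm (len c) t) (+-suc t j))) (trans (e (suc t)) (cong (at c) (sym (+-suc t i))))))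

    cset : VSet n
    cset v = ⌊ any? (λ (i : Fin (len c)) → at c (toℕ i) ≟ᶠ v) ⌋

    cset-elim : ∀ {v} → cset ∋ v → ∃ λ i → i < len c × at c i ≡ v
    cset-elim {v} p with ⌊⌋-elim (any? (λ (i : Fin (len c)) → at c (toℕ i) ≟ᶠ v)) (is-mem p)
    ... | i , e = toℕ i , toℕ<n i , e

    cset-intro : ∀ i → cset ∋ at c i
    cset-intro i with index i
    ... | j , j< , e = mem (⌊⌋-intro (any? _) (fromℕ< j< , trans (cong (at c) (toℕ-fromℕ< j<)) (e 0)))

    cset-⊑ : ∀ {S} → c within S → cset ⊑ S
    cset-⊑ f v p with cset-elim p
    ... | i , _ , refl = f i

    vertices : List (Fin n)
    vertices = applyUpTo (at c) (len c)

    vertices-unique : Unique vertices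
    vertices-unique = Uniqueₚ.applyUpTo⁺₁ (at c) (len c) (λ i<j j<n e → <-irrefl (inj c 0 (<-trans i<j j<n) j<n e) i<j)

    len≤card : ∀ {S} → c within S → len c ≤ card S
    len≤card {S} f = subst (_≤ card S) (Listₚ.length-applyUpTo (at c) (len c)) (length≤card vertices-unique h)
      where
      h : ∀ {x} → x ∈ vertices → S ∋ x
      h m with ∈-applyUpTo⁻ (at c) m
      ... | i , _ , refl = f i

    arc : ∀ {X} p j → (∀ t → t ≤ j → X ∋ at c (p + t)) → Walk X (at c p) (at c (p + j))
    arc {X} p zero f = subst (λ z → Walk X (at c p) (at c z)) (sym (+-identityʳ p)) ε
    arc {X} p (suc j) f = arc p j (λ t le → f t (m≤n⇒m≤1+n le)) ◅◅
      ((f j (n≤1+n j) , f (suc j) ≤-refl , subst (λ z → Adj (at c (p + j)) (at c z)) (sym (+-suc p j)) (step c (p + j))) ◅ ε)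

  rotate-within : ∀ p c {S} → c within S → rotate p c within S
  rotate-within p c f i = f (p + i)

  cset-rotate : ∀ p c {v} → cset c ∋ v → cset (rotate p c) ∋ v
  cset-rotate zero c q with cset-elim c q
  ... | i , _ , refl = cset-intro (rotate 0 c) i
  cset-rotate (suc p) c {v} q with cset-elim (rotate p c) (cset-rotate p c q)
  ... | suc i , _ , refl = subst (cset (rotate (suc p) c) ∋_) (cong (at c) (sym (+-suc p i))) (cset-intro (rotate (suc p) c) i)
  ... | zero , _ , refl with len-suc c
  ...   | l , eq = subst (cset (rotate (suc p) c) ∋_) (trans (cong (at c) (trans (sym (+-suc p l)) (trans (cong (p +_) (sym eq)) (trans (+-comm p (len c)) (cong (len c +_) (sym (+-identityʳ p))))))) (per c (p + 0))) (cset-intro (rotate (suc p) c) l)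

  cset-conn : ∀ c → ConnV (cset c)
  cset-conn c = at c 0 , cset-intro c 0 , λ v p → let (i , _ , e) = cset-elim c p in subst (Walk _ _) e (arc c 0 i (λ t _ → cset-intro c t))

  -- Without `at c p` the cycle is the arc starting at the next vertex.
  cset-delete : ∀ c p → ConnV (cset c ─ at c p)
  cset-delete c p = at c′ 1 , ─-intro (sub _ (cset-intro c′ 1)) (λ e → 0≢1+n (sym (inj c p (1<len c) (0<len c) (trans e (cong (at c) (sym (+-identityʳ p))))))) , go
    where
    c′ : Cyc
    c′ = rotate p c
    sub : cset c′ ⊑ cset c
    sub = cset-⊑ c′ (λ i → cset-intro c (p + i))
    go : ∀ v → cset c ─ at c p ∋ v → Walk (cset c ─ at c p) (at c′ 1) v
    go v q with cset-elim c′ (cset-rotate p c (─-⊑ q))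
    ... | zero , _ , refl = ⊥-elim (─-≢ q (cong (at c) (+-identityʳ p)))
    ... | suc i , i< , refl = arc c′ 1 i λ t le → ─-intro (sub _ (cset-intro c′ (suc t)))
            (λ e → 0≢1+n (sym (inj c p (≤-trans (s≤s (s≤s le)) i<) (0<len c) (trans e (cong (at c) (sym (+-identityʳ p)))))))

  -- Vertices off the cycle are deleted one by one without disconnecting the set, and by `nc-delete`
  -- the number of non-cut vertices never grows on the way. In the end only the cycle is left, all
  -- of whose vertices are non-cut.
  len≤nc : ∀ {S} c → ConnV S → c within S → len c ≤ card (nc S)
  len≤nc {S} c cS f = go (card S) S refl cS f
    where
    go : ∀ d S → card S ≡ d → ConnV S → c within S → len c ≤ card (nc S)
    go d S eq cS f with ⊑? S (cset c)
    ... | inj₂ sub = len≤card c (λ i → nc-intro (f i) (conn-cong (λ j p → ─-intro (cset-⊑ c f j (─-⊑ p)) (─-≢ p)) (λ j p → ─-intro (sub j (─-⊑ p)) (─-≢ p)) (cset-delete c i)))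
    go zero S eq cS f | inj₁ (b , b∈ , _) = ⊥-elim (<-irrefl refl (subst (1 ≤_) eq (card-pos b∈)))
    go (suc d) S eq cS f | inj₁ (b , b∈ , b∉) with removable cS (cset-conn c) (cset-⊑ c f) b∈ b∉
    ... | v , v∈ , v∉ , cv = ≤-trans
            (go d (S ─ v) (suc-injective (trans (sym (card-─ v∈)) eq)) cv (λ i → ─-intro (f i) (≢v i)))
            (nc-delete cS (nc-intro v∈ cv) (f 0) (≢v 0))
      where
      ≢v : ∀ i → at c i ≢ v
      ≢v i e = v∉ (subst (cset c ∋_) e (cset-intro c i))

  Deg2 : VSet n → Fin n → Set
  Deg2 S v = ∃ λ y → ∃ λ z → y ≢ z × Ind S v y × Ind S v z

  on-cycle-deg2 : ∀ {S} c → c within S → ∀ i → Deg2 S (at c i)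
  on-cycle-deg2 {S} c f i with len-suc c
  ... | l , eq = at c (suc i) , at c (i + l) ,
      (λ e → <-irrefl (inj c i (1<len c) (subst (l <_) (sym eq) ≤-refl) (trans (cong (at c) (+-comm i 1)) e)) (≤-pred (subst (3 ≤_) eq (3≤len c)))) ,
      (f i , f (suc i) , step c i) ,
      (f i , f (i + l) , Adj-sym (subst (Adj (at c (i + l))) (trans (cong (at c) (trans (sym (+-suc i l)) (trans (cong (i +_) (sym eq)) (+-comm i (len c))))) (per c i)) (step c (i + l))))

  leaf-¬deg2 : ∀ {S v u} → Leaf S v u → ¬ Deg2 S v
  leaf-¬deg2 (_ , _ , _ , only) (y , z , ne , (_ , y∈ , a) , (_ , z∈ , b)) = ne (trans (only y∈ a) (sym (only z∈ b)))

  within-leaf : ∀ {S v u} c → c within S → Leaf S v u → c within (S ─ v)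
  within-leaf c f l i = ─-intro (f i) (λ e → leaf-¬deg2 l (subst (Deg2 _) e (on-cycle-deg2 c f i)))

  ind? : ∀ S i j → Dec (Ind S i j)
  ind? S i j = ∋? S i ×-dec ∋? S j ×-dec (adj G i j Bool.≟ true)

  leaf-or-deg2 : ∀ {S v b} → ConnV S → S ∋ v → S ∋ b → b ≢ v → (∃ λ u → Leaf S v u) ⊎ Deg2 S v
  leaf-or-deg2 {S} {v} c v∈ b∈ ne with any? (λ y → any? (λ z → ¬? (y ≟ᶠ z) ×-dec ind? S v y ×-dec ind? S v z))
  ... | yes d = inj₂ d
  ... | no ¬d with neighbour c v∈ b∈ ne
  ...   | y , y∈ , a = inj₁ (y , v∈ , y∈ , a , λ {z} z∈ b → only z∈ b)
    where
    only : ∀ {z} → S ∋ z → Adj v z → z ≡ y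
    only {z} z∈ b with z ≡? y
    ... | yes e = e
    ... | no ne = ⊥-elim (¬d (z , y , ne , (v∈ , z∈ , b) , (v∈ , y∈ , a)))

  -- A cycle changes sides only at `u` and meets `u` at most once per period. Rotated to start at
  -- `u` if it passes there, it stays on the side of its next vertex.
  split-cycle : ∀ {S u} (s : Split S u) c → c within S → (∃ λ c′ → c′ within Split.A s) ⊎ (∃ λ c′ → c′ within Split.B s)
  split-cycle {S} {u} s c f with ∋? (cset c) u
  ... | yes p with cset-elim c p
  ...   | q , _ , refl = choose (cover _ (f (q + 1)))
    where
    open Split s
    c′ : Cyc
    c′ = rotate q c
    at≢ : ∀ j → suc j < len c → at c′ (suc j) ≢ at c q
    at≢ j lt e with inj c q lt (0<len c) (trans e (cong (at c) (sym (+-identityʳ q))))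
    ... | ()
    side : (s : Split S (at c q)) → Split.A s ∋ at c′ 1 → c′ within Split.A s
    side s p i with index c′ i
    ... | zero , _ , e = subst (Split.A s ∋_) (trans (cong (at c) (sym (+-identityʳ q))) (e 0)) (Split.u∈A s)
    ... | suc j , j< , e = subst (Split.A s ∋_) (e 0) (go j j<)
      where
      go : ∀ j → suc j < len c → Split.A s ∋ at c′ (suc j)
      go zero _ = p
      go (suc j) lt with Split.cover s (at c′ (suc (suc j))) (f (q + suc (suc j)))
      ... | inj₁ a = a
      ... | inj₂ b with Split.nocross s (go j (<-trans ≤-refl lt)) b (step c′ (suc j))
      ...   | inj₁ e = ⊥-elim (at≢ j (<-trans ≤-refl lt) e)
      ...   | inj₂ e = ⊥-elim (at≢ (suc j) lt e)
    choose : A ∋ at c (q + 1) ⊎ B ∋ at c (q + 1) → (∃ λ c′ → c′ within A) ⊎ (∃ λ c′ → c′ within B)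
    choose (inj₁ a) = inj₁ (c′ , side s a)
    choose (inj₂ b) = inj₂ (c′ , side (swap s) b)
  split-cycle {S} {u} s c f | no u∉ = choose (Split.cover s _ (f 0))
    where
    at≢ : ∀ i → at c i ≢ u
    at≢ i e = u∉ (subst (cset c ∋_) e (cset-intro c i))
    side : (s : Split S u) → Split.A s ∋ at c 0 → c within Split.A s
    side s p zero = p
    side s p (suc i) with Split.cover s (at c (suc i)) (f (suc i))
    ... | inj₁ a = a
    ... | inj₂ b with Split.nocross s (side s p i) b (step c i)
    ...   | inj₁ e = ⊥-elim (at≢ i e)
    ...   | inj₂ e = ⊥-elim (at≢ (suc i) e)
    choose : Split.A s ∋ at c 0 ⊎ Split.B s ∋ at c 0 → (∃ λ c′ → c′ within Split.A s) ⊎ (∃ λ c′ → c′ within Split.B s)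
    choose (inj₁ a) = inj₁ (c , side s a)
    choose (inj₂ b) = inj₂ (c , side (swap s) b)

  isCycle-applyUpTo : ∀ {l} {h : ℕ → Fin n} → 3 ≤ suc l → (∀ {i j} → i < j → j < suc l → h i ≢ h j) → (∀ i → i < l → Adj (h i) (h (suc i))) → Adj (h l) (h 0) →
    IsCycle G (applyUpTo h (suc l))
  isCycle-applyUpTo {l} {h} 3≤ dis adj last = subst (3 ≤_) (sym (Listₚ.length-applyUpTo h (suc l))) 3≤ , Uniqueₚ.applyUpTo⁺₁ h (suc l) dis , consec l h (h 0) adj last
    where
    consec : ∀ l (h : ℕ → Fin n) first → (∀ i → i < l → Adj (h i) (h (suc i))) → Adj (h l) first → consecAdj G first (applyUpTo h (suc l))
    consec zero h first f a = a
    consec (suc l) h first f a = f 0 (s≤s z≤n) , consec l (h ∘ suc) first (λ i lt → f (suc i) (s≤s lt)) a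

  cyc⇒isCycle : ∀ c → IsCycle G (vertices c)
  cyc⇒isCycle c with len-suc c
  ... | l , eq = subst (λ m → IsCycle G (applyUpTo (at c) m)) (sym eq) (isCycle-applyUpTo (subst (3 ≤_) eq (3≤len c))
        (λ i<j j< e → <-irrefl (inj c 0 (<-trans i<j (conv j<)) (conv j<) e) i<j) (λ i _ → step c i)
        (subst (Adj (at c l)) (trans (cong (at c) (trans (sym eq) (sym (+-identityʳ (len c))))) (per c 0)) (step c l)))
    where
    conv : ∀ {j} → j < suc l → j < len c
    conv {j} = subst (j <_) (sym eq)

  girth⇒len : ∀ {k} → GirthAtLeast G k → ∀ c → k ≤ len c
  girth⇒len {k} h c = subst (k ≤_) (Listₚ.length-applyUpTo (at c) (len c)) (h (vertices c) (cyc⇒isCycle c))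

  module _ {v : Fin n} {vs : List (Fin n)} (cyc : IsCycle G (v ∷ vs)) where

    private
      l g : ℕ
      l = length vs
      g = suc l

      nth : List (Fin n) → ℕ → Fin n
      nth [] _ = v
      nth (x ∷ xs) zero = x
      nth (x ∷ xs) (suc i) = nth xs i

      nth-∈ : ∀ xs {i} → i < length xs → nth xs i ∈ xs
      nth-∈ (x ∷ xs) {zero} _ = here refl
      nth-∈ (x ∷ xs) {suc i} (s≤s lt) = there (nth-∈ xs lt)

      nth-inj : ∀ {xs} → Unique xs → ∀ {i j} → i < length xs → j < length xs → nth xs i ≡ nth xs j → i ≡ j
      nth-inj (_ ∷ _) {zero} {zero} _ _ _ = refl
      nth-inj {x ∷ xs} (q ∷ _) {zero} {suc j} _ (s≤s b) e = ⊥-elim (All.lookup q (nth-∈ xs b) e)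
      nth-inj {x ∷ xs} (q ∷ _) {suc i} {zero} (s≤s a) _ e = ⊥-elim (All.lookup q (nth-∈ xs a) (sym e))
      nth-inj (_ ∷ u) {suc i} {suc j} (s≤s a) (s≤s b) e = cong suc (nth-inj u a b e)

      nth-adj : ∀ {f} x xs i → consecAdj G f (x ∷ xs) → i < length xs → Adj (nth (x ∷ xs) i) (nth xs i)
      nth-adj x (y ∷ ys) zero (a , _) _ = a
      nth-adj x (y ∷ ys) (suc i) (_ , c) (s≤s lt) = nth-adj y ys i c lt

      nth-last : ∀ {f} x xs → consecAdj G f (x ∷ xs) → Adj (nth (x ∷ xs) (length xs)) f
      nth-last x [] a = a
      nth-last x (y ∷ ys) (_ , c) = nth-last y ys c

      next : ℕ → ℕ
      next i with i ℕ.≟ l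
      ... | yes _ = 0
      ... | no _ = suc i

      -- The residue modulo `g`, obtained by iterating `next`, which unrolls the list into a
      -- periodic walk.
      idx : ℕ → ℕ
      idx zero = 0
      idx (suc i) = next (idx i)

      idx-< : ∀ i → idx i < g
      idx-< zero = s≤s z≤n
      idx-< (suc i) with idx i ℕ.≟ l
      ... | yes _ = s≤s z≤n
      ... | no ne = s≤s (≤∧≢⇒< (≤-pred (idx-< i)) ne)

      idx-small : ∀ {i} → i < g → idx i ≡ i
      idx-small {zero} _ = refl
      idx-small {suc i} (s≤s lt) rewrite idx-small {i} (m≤n⇒m≤1+n lt) with i ℕ.≟ l
      ... | yes e = ⊥-elim (<-irrefl e lt)
      ... | no _ = refl

      idx-per : ∀ i → idx (g + i) ≡ idx i
      idx-per zero rewrite +-identityʳ l | idx-small {l} ≤-refl with l ℕ.≟ l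
      ... | yes _ = refl
      ... | no ne = ⊥-elim (ne refl)
      idx-per (suc i) = trans (cong (idx ∘ suc) (+-suc l i)) (cong next (idx-per i))

      pos : ℕ → Fin n
      pos i = nth (v ∷ vs) (idx i)

      pos-step : ∀ i → Adj (pos i) (pos (suc i))
      pos-step i with idx i ℕ.≟ l | idx-< i
      ... | yes e | _ = subst (λ z → Adj (nth (v ∷ vs) z) v) (sym e) (nth-last v vs (proj₂ (proj₂ cyc)))
      ... | no ne | lt = nth-adj v vs (idx i) (proj₂ (proj₂ cyc)) (≤∧≢⇒< (≤-pred lt) ne)

      -- Induction on the shift: passing from `p` to `suc p` moves each index up by one and the last
      -- index `l` back to 0.
      pos-inj : ∀ p {i j} → i < g → j < g → pos (p + i) ≡ pos (p + j) → i ≡ j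
      pos-inj zero {i} {j} a b e = trans (sym (idx-small a)) (trans (nth-inj (proj₁ (proj₂ cyc)) (idx-< i) (idx-< j) e) (idx-small b))
      pos-inj (suc p) {i} {j} a b e with m≤n⇒m<n∨m≡n a | m≤n⇒m<n∨m≡n b
      ... | inj₁ a′ | inj₁ b′ = suc-injective (pos-inj p a′ b′ (trans (cong pos (+-suc p i)) (trans e (cong pos (sym (+-suc p j))))))
      ... | inj₂ refl | inj₂ refl = refl
      ... | inj₁ a′ | inj₂ refl = ⊥-elim (1+n≢0 (pos-inj p {suc i} {0} a′ (s≤s z≤n) (trans (cong pos (+-suc p i)) (trans e (wrap p)))))
        where
        wrap : ∀ p → pos (suc p + l) ≡ pos (p + 0)
        wrap p = trans (cong pos (+-comm (suc p) l)) (trans (cong pos (+-suc l p)) (trans (cong (nth (v ∷ vs)) (idx-per p)) (cong pos (sym (+-identityʳ p)))))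
      ... | inj₂ refl | inj₁ b′ = ⊥-elim (1+n≢0 (pos-inj p {suc j} {0} b′ (s≤s z≤n) (trans (cong pos (+-suc p j)) (trans (sym e) (wrap p)))))
        where
        wrap : ∀ p → pos (suc p + l) ≡ pos (p + 0)
        wrap p = trans (cong pos (+-comm (suc p) l)) (trans (cong pos (+-suc l p)) (trans (cong (nth (v ∷ vs)) (idx-per p)) (cong pos (sym (+-identityʳ p)))))

    isCycle⇒cyc : ∃ λ c → len c ≡ suc (length vs) × (∀ {S} → (∀ {x} → x ∈ v ∷ vs → S ∋ x) → c within S)
    isCycle⇒cyc = record { len = g ; at = pos ; 3≤len = proj₁ cyc ; per = λ i → cong (nth (v ∷ vs)) (idx-per i) ; step = pos-step ; inj = pos-inj } , refl ,
      λ f i → f (nth-∈ (v ∷ vs) (idx-< i))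

  module _ {S : VSet n} {x : Fin n} (deg2 : ∀ {v} → S ∋ v → v ≢ x → Deg2 S v) where

    private
      chord : ∀ {f} v as {z bs} → Linked Adj (v ∷ as ++ z ∷ bs) → Adj z f → consecAdj G f (v ∷ as ++ z ∷ [])
      chord v [] (a ∷ _) b = a , b
      chord v (y ∷ ys) (a ∷ c) b = a , chord y ys c b

      All-++ˡ : ∀ {P : Fin n → Set} xs {ys} → All P (xs ++ ys) → All P xs
      All-++ˡ xs = Allₚ.++⁻ˡ xs

      unique-++ˡ : ∀ xs {ys : List (Fin n)} → Unique (xs ++ ys) → Unique xs
      unique-++ˡ [] _ = []
      unique-++ˡ (x ∷ xs) (p ∷ u) = All-++ˡ xs p ∷ unique-++ˡ xs u

      -- The path from `v` to `x` is prolonged at `v` by a neighbour other than `w`. A neighbour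
      -- already on the path closes a cycle; otherwise the path grows, which ends because a path
      -- without repetition has at most `n` vertices. Membership of `x` in the rest of the path
      -- gives `v ≢ x`, hence two neighbours of `v`.
      extend : ∀ d v w ps → Linked Adj (v ∷ w ∷ ps) → Unique (v ∷ w ∷ ps) → All (S ∋_) (v ∷ w ∷ ps) → x ∈ w ∷ ps → n < length (v ∷ w ∷ ps) + d → ∃ λ c → c within S
      extend zero v w ps ch u s m lt = ⊥-elim (<-irrefl refl (<-≤-trans lt (subst (_≤ n) (sym (+-identityʳ _)) (subst (length (v ∷ w ∷ ps) ≤_) (Listₚ.length-tabulate id) (unique⊆⇒length≤ u (λ {y} _ → ∈-allFin y))))))
      extend (suc d) v w ps ch u@(v∉ ∷ _) s@(v∈ ∷ _) m lt with deg2 v∈ (λ e → All.lookup v∉ m e)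
      ... | y , z , y≢z , y-ind , z-ind = pick
        where
        try : ∀ t → t ≢ w → Ind S v t → ∃ λ c → c within S
        try t t≢w (_ , t∈ , a) with Any.any? (t ≡?_) (v ∷ w ∷ ps)
        ... | no t∉ = extend d t v (w ∷ ps) (Adj-sym a ∷ ch) (Allₚ.¬Any⇒All¬ _ t∉ ∷ u) (t∈ ∷ s) (there m) (subst (n <_) (+-suc _ d) lt)
        ... | yes (here e) = ⊥-elim (Adj-≢ a (sym e))
        ... | yes (there (here e)) = ⊥-elim (t≢w e)
        ... | yes (there (there q)) with ∈-∃++ q
        ...   | as , bs , refl with isCycle⇒cyc {v} {w ∷ as ++ t ∷ []} (s≤s (s≤s (≤-trans (s≤s z≤n) (subst (1 ≤_) (sym (Listₚ.length-++ as)) (m≤n+m 1 (length as))))) ,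
                   unique-++ˡ (v ∷ w ∷ as ++ t ∷ []) (subst (λ r → Unique (v ∷ w ∷ r)) (sym (Listₚ.++-assoc as (t ∷ []) bs)) u) , chord v (w ∷ as) ch (Adj-sym a))
        ...     | c , _ , f = c , f (All.lookup (All-++ˡ (v ∷ w ∷ as ++ t ∷ []) (subst (λ r → All (S ∋_) (v ∷ w ∷ r)) (sym (Listₚ.++-assoc as (t ∷ []) bs)) s)))
        pick : ∃ λ c → c within S
        pick with y ≡? w
        ... | no ne = try y ne y-ind
        ... | yes refl = try z (y≢z ∘ sym) z-ind

    deg2⇒cycle : ∀ {y} → S ∋ x → S ∋ y → Adj x y → ∃ λ c → c within S
    deg2⇒cycle {y} x∈ y∈ a = extend n y x [] (Adj-sym a ∷ [-]) (((λ e → Adj-≢ a (sym e)) ∷ []) ∷ [] ∷ []) (y∈ ∷ x∈ ∷ []) (here refl) (m≤n⇒m≤1+n (≤-refl))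

  -- The leaf has to avoid `x`: when `x` is the vertex at which a larger set splits, a leaf of a
  -- side away from `x` is a leaf of the whole set.
  find-leaf : ∀ {S x} → ConnV S → S ∋ x → (∃ λ b → S ∋ b × b ≢ x) → (∃ λ v → ∃ λ u → v ≢ x × Leaf S v u) ⊎ (∃ λ c → c within S)
  find-leaf {S} {x} c x∈ (b , b∈ , b≢x) with any? (λ v → ∋? S v ×-dec ¬? (v ≟ᶠ x) ×-dec ¬? (any? (λ y → any? (λ z → ¬? (y ≟ᶠ z) ×-dec ind? S v y ×-dec ind? S v z))))
  ... | yes (v , v∈ , v≢x , ¬d) with leaf-or-deg2 c v∈ x∈ (v≢x ∘ sym)
  ...   | inj₁ (u , l) = inj₁ (v , u , v≢x , l)
  ...   | inj₂ d = ⊥-elim (¬d d)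
  find-leaf {S} {x} c x∈ (b , b∈ , b≢x) | no none with neighbour c x∈ b∈ b≢x
  ...   | y , y∈ , a = inj₂ (deg2⇒cycle d x∈ y∈ a)
    where
    d : ∀ {v} → S ∋ v → v ≢ x → Deg2 S v
    d {v} v∈ v≢x with any? (λ y → any? (λ z → ¬? (y ≟ᶠ z) ×-dec ind? S v y ×-dec ind? S v z))
    ... | yes r = r
    ... | no r = ⊥-elim (none (v , v∈ , v≢x , r))

  -- Leaves lie on no cycle, so they can be stripped until a cycle appears or a single vertex
  -- remains.
  cycle-or-acyclic : ∀ S → ConnV S → (∃ λ c → c within S) ⊎ (∀ c → ¬ (c within S))
  cycle-or-acyclic S cS = go (card S) S refl cS
    where
    go : ∀ d S → card S ≡ d → ConnV S → (∃ λ c → c within S) ⊎ (∀ c → ¬ (c within S))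
    go d S eq cS@(r , r∈ , _) with ⊑? S (_== r)
    ... | inj₂ sub = inj₂ λ c f → <-irrefl refl (≤-trans (<-trans ≤-refl (3≤len c)) (≤-trans (len≤card c f) (≤-trans (card-mono sub) (card-single r))))
    go zero S eq cS@(r , r∈ , _) | inj₁ _ = ⊥-elim (<-irrefl refl (subst (1 ≤_) eq (card-pos r∈)))
    go (suc d) S eq cS@(r , r∈ , _) | inj₁ (b , b∈ , ne) with find-leaf cS r∈ (b , b∈ , λ e → ne (mem (trans (cong (_== r) e) (==-refl r))))
    ... | inj₂ c = inj₁ c
    ... | inj₁ (v , u , _ , l) with go d (S ─ v) (suc-injective (trans (sym (card-─ (proj₁ l))) eq)) (leaf-conn cS l)
    ...   | inj₁ (c , f) = inj₁ (c , λ i → ─-⊑ (f i))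
    ...   | inj₂ h = inj₂ (λ c f → h c (within-leaf c f l))

-- Rooted lower bounds

choose2 : ℕ → ℕ
choose2 zero = 0
choose2 (suc l) = l + choose2 l

triangle : ℕ → ℕ
triangle zero = 0
triangle (suc l) = suc l + triangle l

triangle-choose2 : ∀ l → triangle l ≡ l + choose2 l
triangle-choose2 zero = refl
triangle-choose2 (suc l) = cong (suc l +_) (triangle-choose2 l)

module _ {A : Set} {_≈_ : A → A → Set} where
  open Counting _≈_

  atLeast-Σ : ∀ {I : Set} {P : I → A → Set} {k} {is : List I} → Unique is → (∀ {i} → i ∈ is → AtLeast (P i) k) →
    (∀ {i j x y} → i ∈ is → j ∈ is → P i x → P j y → x ≈ y → i ≡ j) → AtLeast (λ x → ∃ λ i → i ∈ is × P i x) (length is * k)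
  atLeast-Σ {is = []} _ _ _ = [] , [] , [] , z≤n
  atLeast-Σ {P = P} {is = i ∷ is} (q ∷ u) al dis = atLeast-mono join
    (atLeast-+ (λ { a (j , j∈ , b) e → All.lookup q j∈ (dis (here refl) (there j∈) a b e) }) (al (here refl)) (atLeast-Σ u (al ∘ there) (λ a b → dis (there a) (there b))))
    where
    join : ∀ {x} → P i x ⊎ (∃ λ j → j ∈ is × P j x) → ∃ λ j → j ∈ i ∷ is × P j x
    join (inj₁ p) = i , here refl , p
    join (inj₂ (j , j∈ , p)) = j , there j∈ , p

Same : ∀ {n} → Fin n × Fin n → Fin n × Fin n → Set
Same (i , j) (a , b) = (i ≡ a × j ≡ b) ⊎ (i ≡ b × j ≡ a)

same? : ∀ {n} (e f : Fin n × Fin n) → Dec (Same e f)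
same? (i , j) (a , b) = ((i ≟ᶠ a) ×-dec (j ≟ᶠ b)) ⊎-dec ((i ≟ᶠ b) ×-dec (j ≟ᶠ a))

same-flip : ∀ {n} {i j : Fin n} {e} → Same (i , j) e → Same (j , i) e
same-flip (inj₁ (p , q)) = inj₂ (q , p)
same-flip (inj₂ (p , q)) = inj₁ (q , p)

module Rooted {n : ℕ} (G : Graph n) where
  open Cuts G
  open Cycles G
  open Subgraphs G

  indSub : VSet n → Sub n
  indSub X = subgraph X (λ i j → (X i ∧ X j) ∧ adj G i j)

  indSub-edge⁺ : ∀ {X i j} → Ind X i j → Edge (indSub X) i j
  indSub-edge⁺ (p , q , a) = ∧-intro (∧-intro (is-mem p) (is-mem q)) a

  indSub-edge⁻ : ∀ {X i j} → Edge (indSub X) i j → Ind X i j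
  indSub-edge⁻ {X} {i} {j} e = mem (∧-left (∧-left {X i ∧ X j} e)) , mem (∧-right {X i} (∧-left {X i ∧ X j} e)) , ∧-right {X i ∧ X j} e

  Spans : VSet n → Sub n → Set
  Spans X T = InS X T × X ⊑ V T

  indSub-spans : ∀ {X} → ConnV X → Spans X (indSub X)
  indSub-spans {X} (r , p , w) = record
    { V⊑ = λ _ q → q ; E-sym = λ e → indSub-edge⁺ {X} (Ind-sym (indSub-edge⁻ {X} e)) ; E-V = λ e → proj₁ (indSub-edge⁻ {X} e)
    ; E-adj = λ e → proj₂ (proj₂ (indSub-edge⁻ {X} e)) ; root = r ; root∈ = p ; walk = λ i q → Star.map (indSub-edge⁺ {X}) (w i q) } , λ _ q → q

  without : Fin n × Fin n → Sub n → Sub n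
  without e T = subgraph (V T) (λ i j → E T i j ∧ not ⌊ same? (i , j) e ⌋)

  Avoid : VSet n → Fin n × Fin n → Fin n → Fin n → Set
  Avoid X e i j = Ind X i j × ¬ Same (i , j) e

  NonBridge : VSet n → Fin n × Fin n → Set
  NonBridge X (a , b) = Ind X a b × Star (Avoid X (a , b)) a b

  private
    without-edge⁺ : ∀ {X e i j} → Avoid X e i j → Edge (without e (indSub X)) i j
    without-edge⁺ {X} {e} {i} {j} (p , ns) = ∧-intro (indSub-edge⁺ {X} p) (true-not (λ q → ns (⌊⌋-elim (same? (i , j) e) q)))

    without-edge⁻ : ∀ {X e i j} → Edge (without e (indSub X)) i j → Avoid X e i j
    without-edge⁻ {X} {e} {i} {j} q = indSub-edge⁻ {X} (∧-left q) , λ s → not-true (∧-right {E (indSub X) i j} q) (⌊⌋-intro (same? (i , j) e) s)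

    avoid-sym : ∀ {X e i j} → Avoid X e i j → Avoid X e j i
    avoid-sym (p , ns) = Ind-sym p , (ns ∘ same-flip)

  without-spans : ∀ {X e} → ConnV X → NonBridge X e → Spans X (without e (indSub X))
  without-spans {X} {e@(a , b)} (r , p , w) (_ , alt) = record
    { V⊑ = λ _ q → q ; E-sym = λ q → without-edge⁺ {X} {e} (avoid-sym (without-edge⁻ {X} {e} q)) ; E-V = λ q → proj₁ (proj₁ (without-edge⁻ {X} {e} q))
    ; E-adj = λ q → proj₂ (proj₂ (proj₁ (without-edge⁻ {X} {e} q))) ; root = r ; root∈ = p
    ; walk = λ i q → Star.map (without-edge⁺ {X} {e}) (Star.kleisliStar id detour (w i q)) } , λ _ q → q
    where
    detour : ∀ {i j} → Ind X i j → Star (Avoid X e) i j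
    detour {i} {j} st with same? (i , j) e
    ... | no ns = (st , ns) ◅ ε
    ... | yes (inj₁ (refl , refl)) = alt
    ... | yes (inj₂ (refl , refl)) = reverse avoid-sym alt

  -- One subgraph keeps all edges of `G` on `X`, each of the others omits one non-bridge edge; the
  -- omitted edge tells them apart.
  spanning : ∀ {X es} → ConnV X → All (NonBridge X) es → AllPairs (λ e f → ¬ Same e f) es → AtLeast (Spans X) (suc (length es))
  spanning {X} {es} c nb ds = indSub X ∷ map (λ e → without e (indSub X)) es ,
      indSub-spans c ∷ Allₚ.map⁺ (All.map (without-spans c) nb) ,
      Allₚ.map⁺ (All.map (λ { {a , b} (i , _) q → proj₂ (without-edge⁻ {X} {a , b} (edge-resp q (indSub-edge⁺ {X} i))) (inj₁ (refl , refl)) }) nb) ∷ AllPairsₚ.map⁺ (go nb ds) ,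
      s≤s (≤-reflexive (sym (Listₚ.length-map (λ e → without e (indSub X)) es)))
    where
    go : ∀ {es} → All (NonBridge X) es → AllPairs (λ e f → ¬ Same e f) es → AllPairs (λ e f → ¬ without e (indSub X) ≐ without f (indSub X)) es
    go [] [] = []
    go (_ ∷ nb) (d ∷ ds) = All.zipWith (λ { {a , b} ((i , _) , ns) q → proj₂ (without-edge⁻ {X} {a , b} (edge-resp q (without-edge⁺ {X} (i , ns ∘ flip-same)))) (inj₁ (refl , refl)) }) (nb , d) ∷ go nb ds
      where
      flip-same : ∀ {e f : Fin n × Fin n} → Same e f → Same f e
      flip-same (inj₁ (refl , refl)) = inj₁ (refl , refl)
      flip-same (inj₂ (refl , refl)) = inj₂ (refl , refl)

  -- Adjacency is taken in `G` and not in `T`. The boundary thus depends on the vertex set of `T`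
  -- alone and is unchanged when edges of `T` are deleted.
  Boundary : VSet n → Sub n → Fin n → Set
  Boundary S T v = S ∋ v × ¬ (V T ∋ v) × ∃ λ i → V T ∋ i × Adj i v

  boundary-resp : ∀ {S T T′ v} → T ≐ T′ → Boundary S T v → Boundary S T′ v
  boundary-resp e (p , q , i , r , a) = p , (λ x → q (vertex-resp (≐-sym e) _ x)) , i , vertex-resp e i r , a

  spans-boundary : ∀ {S X T v} → Spans X T → Boundary S T v → Boundary S (indSub X) v
  spans-boundary (t , f) (p , q , i , r , a) = p , (λ x → q (f _ x)) , i , V⊑ t i r , a

  boundary-spans : ∀ {S X T v} → Spans X T → Boundary S (indSub X) v → Boundary S T v
  boundary-spans (t , f) (p , q , i , r , a) = p , (λ x → q (V⊑ t _ x)) , i , f i r , a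

  spans-InU : ∀ {S X T u} → X ⊑ S → X ∋ u → Spans X T → InU S u T
  spans-InU f u∈ (t , g) = InS-mono f t , g _ u∈

  -- The component of u after deleting a set of vertices is recovered from its boundary, so different boundaries
  -- give different subgraphs.
  module _ {S : VSet n} {u : Fin n} (cS : ConnV S) (u∈ : S ∋ u) where

    private
      only₁ : ∀ {v w} → Boundary S (indSub (comp u (S ─ v))) w → S ─ v ∋ u → w ≡ v
      only₁ {v} {w} (p , q , i , r , a) u∈′ with w ≡? v
      ... | yes e = e
      ... | no ne = ⊥-elim (q (comp-step r (comp-⊑ u∈′ i r , ─-intro p ne , a)))

      has₁ : ∀ {v} → S ∋ v → S ─ v ∋ u → Boundary S (indSub (comp u (S ─ v))) v
      has₁ {v} v∈ u∈′ with exit {X = comp u (S ─ v)} (conn-walk cS u∈ v∈) comp-root (λ p → ─-≢ (comp-⊑ u∈′ v p) refl)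
      ... | i , j , i∈ , j∉ , (_ , j∈ , a) with only₁ {v} {j} (j∈ , j∉ , i , i∈ , a) u∈′
      ...   | refl = j∈ , j∉ , i , i∈ , a

      only₂ : ∀ {v w x} → Boundary S (indSub (comp u (S ─ v ─ w))) x → S ─ v ─ w ∋ u → x ≡ v ⊎ x ≡ w
      only₂ {v} {w} {x} (p , q , i , r , a) u∈′ with x ≡? v | x ≡? w
      ... | yes e | _ = inj₁ e
      ... | no _ | yes e = inj₂ e
      ... | no ne | no ne′ = ⊥-elim (q (comp-step r (comp-⊑ u∈′ i r , ─-intro (─-intro p ne) ne′ , a)))

      -- Since `S − w` is connected, a walk in it from `u` to `v` must leave the component of `u` in
      -- `S − {v, w}`, and it can only do so at `v`. Exchanging the roles gives `w`.
      has₂ : ∀ {v w} → nc S ─ u ∋ v → nc S ─ u ∋ w → v ≢ w → let T = indSub (comp u (S ─ v ─ w)) in Boundary S T v × Boundary S T w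
      has₂ {v} {w} p q ne = hit w v (nc-conn (─-⊑ q)) (nc-∈ (─-⊑ p)) (─-≢ p) (─-≢ q) ne only₂ (λ z → ─-≢ (─-⊑ (comp-⊑ u∈′ v z)) refl)
                          , hit v w (nc-conn (─-⊑ p)) (nc-∈ (─-⊑ q)) (─-≢ q) (─-≢ p) (ne ∘ sym) (λ b u∈ → Sum.swap (only₂ b u∈)) (λ z → ─-≢ (comp-⊑ u∈′ w z) refl)
        where
        u∈′ : S ─ v ─ w ∋ u
        u∈′ = ─-intro (─-intro u∈ (─-≢ p ∘ sym)) (─-≢ q ∘ sym)
        T = indSub (comp u (S ─ v ─ w))
        hit : ∀ a b → ConnV (S ─ a) → S ∋ b → b ≢ u → a ≢ u → b ≢ a → (∀ {x} → Boundary S T x → S ─ v ─ w ∋ u → x ≡ b ⊎ x ≡ a) → ¬ (V T ∋ b) → Boundary S T b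
        hit a b ca b∈ b≢u a≢u b≢a only b∉ with exit {X = V T} (conn-walk ca (─-intro u∈ (a≢u ∘ sym)) (─-intro b∈ b≢a)) comp-root b∉
        ... | i , j , i∈ , j∉ , (_ , j∈ , adj) with only {j} (─-⊑ j∈ , j∉ , i , i∈ , adj) u∈′
        ...   | inj₁ refl = ─-⊑ j∈ , j∉ , i , i∈ , adj
        ...   | inj₂ e = ⊥-elim (─-≢ j∈ e)

      One Two : Sub n → Set
      One T = ∃ λ v → Boundary S T v × (∀ w → Boundary S T w → w ≡ v)
      Two T = ∃ λ v → ∃ λ w → v ≢ w × Boundary S T v × Boundary S T w

      one-two : ∀ {T T′} → One T → Two T′ → ¬ T ≐ T′
      one-two (v , _ , only) (x , y , ne , bx , by) e = ne (trans (only x (boundary-resp (≐-sym e) bx)) (sym (only y (boundary-resp (≐-sym e) by))))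

      -- The clause confining the boundary to `xs` separates the pairs without the head of the list
      -- from the pairs containing it.
      pairs : ∀ {xs} → Unique xs → (∀ {x} → x ∈ xs → nc S ─ u ∋ x) →
        AtLeast (λ T → InU S u T × Two T × (∀ v → Boundary S T v → v ∈ xs)) (choose2 (length xs))
      pairs {[]} _ _ = [] , [] , [] , z≤n
      pairs {x ∷ xs} (q ∷ un) f = atLeast-mono join (atLeast-+ dis
          (atLeast-index {P = λ T → InU S u T × Two T × (∀ v → Boundary S T v → v ∈ x ∷ xs) × Boundary S T x} xs (λ y → indSub (comp u (S ─ x ─ y))) un make inj′)
          (pairs un (f ∘ there)))
        where
        u∈′ : ∀ {y} → y ∈ xs → S ─ x ─ y ∋ u
        u∈′ m = ─-intro (─-intro u∈ (─-≢ (f (here refl)) ∘ sym)) (─-≢ (f (there m)) ∘ sym)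
        both : ∀ {y} → y ∈ xs → let T = indSub (comp u (S ─ x ─ y)) in Boundary S T x × Boundary S T y
        both m = has₂ (f (here refl)) (f (there m)) (All.lookup q m)
        make : ∀ {y} → y ∈ xs → let T = indSub (comp u (S ─ x ─ y)) in InU S u T × Two T × (∀ v → Boundary S T v → v ∈ x ∷ xs) × Boundary S T x
        make {y} m = spans-InU (λ i p → ─-⊑ (─-⊑ (comp-⊑ (u∈′ m) i p))) comp-root (indSub-spans comp-conn) ,
          (x , y , All.lookup q m , both m) , (λ v b → Sum.[ (λ { refl → here refl }) , (λ { refl → there m }) ] (only₂ b (u∈′ m))) , proj₁ (both m)
        inj′ : ∀ {y z} → y ∈ xs → z ∈ xs → indSub (comp u (S ─ x ─ y)) ≐ indSub (comp u (S ─ x ─ z)) → y ≡ z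
        inj′ my mz e = Sum.[ (λ r → ⊥-elim (All.lookup q my (sym r))) , id ] (only₂ (boundary-resp e (proj₂ (both my))) (u∈′ mz))
        dis : ∀ {T T′} → InU S u T × Two T × (∀ v → Boundary S T v → v ∈ x ∷ xs) × Boundary S T x → InU S u T′ × Two T′ × (∀ v → Boundary S T′ v → v ∈ xs) → ¬ T ≐ T′
        dis (_ , _ , _ , b) (_ , _ , h) e = All.lookup q (h x (boundary-resp e b)) refl
        join : ∀ {T} → (InU S u T × Two T × (∀ v → Boundary S T v → v ∈ x ∷ xs) × Boundary S T x) ⊎ (InU S u T × Two T × (∀ v → Boundary S T v → v ∈ xs)) →
          InU S u T × Two T × (∀ v → Boundary S T v → v ∈ x ∷ xs)
        join (inj₁ (a , b , c , _)) = a , b , c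
        join (inj₂ (a , b , c)) = a , b , λ v p → there (c v p)

      singles : ∀ {k} (O : VSet n) → O ⊑ S ─ u → (∀ v → O ∋ v → AtLeast (Spans (comp u (S ─ v))) k) →
        AtLeast (λ T → ∃ λ v → v ∈ elems O × Spans (comp u (S ─ v)) T) (card O * k)
      singles O f al = atLeast-Σ (elems-unique O) (λ m → al _ (∈-elems⁻ O m)) λ {v} {w} mv mw p q e →
          only₁ {w} {v} (spans-boundary q (boundary-resp e (boundary-spans p (has₁ (─-⊑ (f _ (∈-elems⁻ O mv))) (u∈′ (∈-elems⁻ O mv)))))) (u∈′ (∈-elems⁻ O mw))
        where
        u∈′ : ∀ {v} → O ∋ v → S ─ v ∋ u
        u∈′ p = ─-intro u∈ (─-≢ (f _ p) ∘ sym)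

      one-InU : ∀ {O : VSet n} → O ⊑ S ─ u → ∀ {T} → (∃ λ v → v ∈ elems O × Spans (comp u (S ─ v)) T) → InU S u T × One T × (∃ λ v → O ∋ v × Boundary S T v)
      one-InU {O} f {T} (v , m , t) = spans-InU (λ i p → ─-⊑ (comp-⊑ u∈′ i p)) comp-root t , (v , bd , λ w b → only₁ (spans-boundary t b) u∈′) , v , ∈-elems⁻ O m , bd
        where
        v∈ : S ─ u ∋ v
        v∈ = f v (∈-elems⁻ O m)
        u∈′ : S ─ v ∋ u
        u∈′ = ─-intro u∈ (─-≢ v∈ ∘ sym)
        bd : Boundary S T v
        bd = boundary-spans t (has₁ (─-⊑ v∈) u∈′)

    -- The summands are sorted by boundary: `N` subgraphs with empty boundary, three for each vertex
    -- of `O`, one for each other vertex besides `u`, and one for each pair of non-cut vertices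
    -- other than `u`. For `v` in `O` the component of `u` in `S − v` is all of `S − v`.
    rooted-count : ∀ {N} (O : VSet n) → O ⊑ nc S ─ u → (∀ v → O ∋ v → AtLeast (Spans (S ─ v)) 3) → AtLeast (Spans S) N →
      AtLeast (InU S u) (N + ((card O * 3 + card (S ─ u ∖ O)) + choose2 (card (nc S ─ u))))
    rooted-count {N} O f triple whole = atLeast-mono join (atLeast-+ dis₁ whole (atLeast-+ dis₂ (atLeast-+ dis₃ part₁ part₂) (pairs (elems-unique (nc S ─ u)) (∈-elems⁻ (nc S ─ u)))))
      where
      O′ : VSet n
      O′ = S ─ u ∖ O
      f₁ : O ⊑ S ─ u
      f₁ i p = ─-intro (nc-∈ (─-⊑ (f i p))) (─-≢ (f i p))
      f₂ : O′ ⊑ S ─ u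
      f₂ i p = ∖-⊑ p
      P₁ P₂ P₃ : Sub n → Set
      P₁ T = ∃ λ v → v ∈ elems O × Spans (comp u (S ─ v)) T
      P₂ T = ∃ λ v → v ∈ elems O′ × Spans (comp u (S ─ v)) T
      P₃ T = InU S u T × Two T × (∀ v → Boundary S T v → v ∈ elems (nc S ─ u))
      part₁ : AtLeast P₁ (card O * 3)
      part₁ = singles O f₁ λ v p → atLeast-mono (λ { (t , g) →
            InS-mono (λ i q → comp-complete (conn-walk (nc-conn (─-⊑ (f v p))) (─-intro u∈ (─-≢ (f v p) ∘ sym)) q)) t ,
            λ i q → g i (comp-⊑ (─-intro u∈ (─-≢ (f v p) ∘ sym)) i q) }) (triple v p)
      part₂ : AtLeast P₂ (card O′)
      part₂ = subst (AtLeast P₂) (*-identityʳ (card O′)) (singles O′ f₂ λ v p → atLeast-one _ (indSub-spans comp-conn))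
      dis₃ : ∀ {T T′} → P₁ T → P₂ T′ → ¬ T ≐ T′
      dis₃ p q e with one-InU f₁ p | one-InU f₂ q
      ... | _ , _ , v , v∈ , bv | _ , (x , _ , only) , w , w∈ , bw with trans (only v (boundary-resp e bv)) (sym (only w bw))
      ...   | refl = ∖-∌ w∈ v∈
      one : ∀ {T} → P₁ T ⊎ P₂ T → InU S u T × One T
      one (inj₁ p) = let (a , b , _) = one-InU f₁ p in a , b
      one (inj₂ p) = let (a , b , _) = one-InU f₂ p in a , b
      dis₂ : ∀ {T T′} → P₁ T ⊎ P₂ T → P₃ T′ → ¬ T ≐ T′
      dis₂ p (_ , two , _) = one-two (proj₂ (one p)) two
      dis₁ : ∀ {T T′} → Spans S T → (P₁ T′ ⊎ P₂ T′) ⊎ P₃ T′ → ¬ T ≐ T′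
      dis₁ (_ , g) (inj₁ p) e with one p
      ... | _ , v , b@(v∈ , _) , _ = proj₁ (proj₂ (boundary-resp (≐-sym e) b)) (g v v∈)
      dis₁ (_ , g) (inj₂ (_ , (v , _ , _ , b@(v∈ , _) , _) , _)) e = proj₁ (proj₂ (boundary-resp (≐-sym e) b)) (g v v∈)
      join : ∀ {T} → Spans S T ⊎ ((P₁ T ⊎ P₂ T) ⊎ P₃ T) → InU S u T
      join (inj₁ t) = spans-InU (λ _ p → p) u∈ t
      join (inj₂ (inj₁ p)) = proj₁ (one p)
      join (inj₂ (inj₂ (p , _))) = p

    -- The case `N = 1` with empty `O`, for sets that may be trees.
    rooted-bound : AtLeast (InU S u) (card S + choose2 (card (nc S ─ u)))
    rooted-bound = atLeast-≤ (≤-trans (+-monoˡ-≤ _ (≤-reflexive (card-─ u∈)))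
        (s≤s (+-monoˡ-≤ _ (≤-trans (card-mono {S′ = S ─ u ∖ none} (λ i p → ∖-intro p (λ { (mem ()) }))) (m≤n+m _ (card none * 3))))))
        (rooted-count none (λ { _ (mem ()) }) (λ { _ (mem ()) }) (atLeast-one _ (indSub-spans cS)))
      where
      none : VSet n
      none _ = false

  -- The detour goes from `x` to its other neighbour `z` and on to `y` inside `S − x`, which is
  -- connected.
  nc-nonBridge : ∀ {S x y z} → nc S ∋ x → Ind S x y → Ind S x z → z ≢ y → NonBridge S (x , y)
  nc-nonBridge {S} {x} {y} {z} p xy@(_ , y∈ , a) xz@(_ , z∈ , b) ne = xy , (xz , λ { (inj₁ (_ , e)) → ne e ; (inj₂ (e , _)) → Adj-≢ a e }) ◅
      Star.map (λ (i∈ , j∈ , c) → (─-⊑ i∈ , ─-⊑ j∈ , c) , λ { (inj₁ (e , _)) → ─-≢ i∈ e ; (inj₂ (_ , e)) → ─-≢ j∈ e })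
        (conn-walk (nc-conn p) (─-intro z∈ (λ e → Adj-≢ b (sym e))) (─-intro y∈ (λ e → Adj-≢ a (sym e))))

  module _ (c : Cyc) where

    cycleEdge : ℕ → Fin n × Fin n
    cycleEdge i = at c i , at c (suc i)

    cycle-edges : List (Fin n × Fin n)
    cycle-edges = applyUpTo cycleEdge (len c)

    length-cycle-edges : length cycle-edges ≡ len c
    length-cycle-edges = Listₚ.length-applyUpTo cycleEdge (len c)

    cycle-edges-distinct : AllPairs (λ e f → ¬ Same e f) cycle-edges
    cycle-edges-distinct = AllPairsₚ.applyUpTo⁺₁ cycleEdge (len c) h
      where
      h : ∀ {i j} → i < j → j < len c → ¬ Same (cycleEdge i) (cycleEdge j)
      h {i} {j} i<j j<n (inj₁ (e , _)) = <-irrefl (inj c 0 (<-trans i<j j<n) j<n e) i<j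
      -- Oppositely oriented equal edges would give `j = i + 1` and identify the vertices at `i` and
      -- `i + 2`, impossible for length at least 3.
      h {i} {j} i<j j<n (inj₂ (e , e′)) with inj c 0 (≤-trans (s≤s i<j) j<n) j<n e′
      ... | refl with inj c i (0<len c) (3≤len c) (trans (cong (at c) (+-identityʳ i)) (trans e (cong (at c) (+-comm 2 i))))
      ...   | ()

    cycleEdge-nonBridge : ∀ {X} → c within X → ∀ p → NonBridge X (cycleEdge p)
    cycleEdge-nonBridge {X} f p = (f p , f (suc p) , step c p) , reverse av-sym (subst (Star (Avoid X (cycleEdge p)) (at c (suc p))) back (go _ ≤-refl))
      where
      av-sym : ∀ {i j} → Avoid X (cycleEdge p) i j → Avoid X (cycleEdge p) j i
      av-sym (q , ns) = Ind-sym q , (ns ∘ same-flip)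
      l : ℕ
      l = proj₁ (len-suc c)
      eq : len c ≡ suc l
      eq = proj₂ (len-suc c)
      back : at c (suc p + l) ≡ at c p
      back = trans (cong (at c) (trans (sym (+-suc p l)) (trans (cong (p +_) (sym eq)) (+-comm p (len c))))) (per c p)
      go : ∀ j → j ≤ l → Star (Avoid X (cycleEdge p)) (at c (suc p)) (at c (suc p + j))
      go zero _ = subst (λ z → Star (Avoid X (cycleEdge p)) (at c (suc p)) (at c z)) (sym (+-identityʳ (suc p))) ε
      go (suc j) le = go j (≤-trans (n≤1+n j) le) ◅◅ (subst (Avoid X (cycleEdge p) (at c (suc p + j))) (cong (at c) (sym (+-suc (suc p) j)))
          ((f _ , f _ , step c (suc p + j)) , ns) ◅ ε)
        where
        j< : suc j < len c
        j< = subst (suc j <_) (sym eq) (s≤s le)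
        ns : ¬ Same (at c (suc p + j) , at c (suc (suc p + j))) (cycleEdge p)
        ns (inj₁ (e , _)) with inj c p j< (0<len c) (trans (cong (at c) (+-suc p j)) (trans e (cong (at c) (sym (+-identityʳ p)))))
        ... | ()
        ns (inj₂ (e , e′)) with inj c p j< (1<len c) (trans (cong (at c) (+-suc p j)) (trans e (cong (at c) (+-comm 1 p))))
        ... | refl with inj c p (3≤len c) (0<len c) (trans (cong (at c) (trans (+-comm p 2) (cong (suc ∘ suc) (sym (+-identityʳ p))))) (trans e′ (cong (at c) (sym (+-identityʳ p)))))
        ...   | ()

    cycle-edges-nonBridge : ∀ {X} → c within X → All (NonBridge X) cycle-edges
    cycle-edges-nonBridge f = Allₚ.applyUpTo⁺₁ cycleEdge (len c) (λ {i} _ → cycleEdge-nonBridge f i)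

    card-cset : card (cset c) ≡ len c
    card-cset = ≤-antisym (subst (card (cset c) ≤_) (Listₚ.length-applyUpTo (at c) (len c)) (card≤length h)) (len≤card c (cset-intro c))
      where
      h : ∀ i → cset c ∋ i → i ∈ vertices c
      h i p with cset-elim c p
      ... | j , j< , refl = ∈-applyUpTo⁺ (at c) j<

    offCycle : VSet n → Fin n → VSet n
    offCycle S u = nc S ─ u ∖ cset c

    -- Deleting a non-cut vertex off the cycle leaves the cycle intact, so the remaining set has at
    -- least three spanning connected subgraphs instead of one. Of the two extra ones,
    -- `rooted-cycle` spends one in place of a cycle edge and keeps the other as surplus.
    rooted-extra : ∀ {S u es} → ConnV S → S ∋ u → c within S → All (NonBridge S) es → AllPairs (λ e f → ¬ Same e f) es →
      AtLeast (InU S u) (card S + length es + 2 * card (offCycle S u) + choose2 (card (nc S ─ u)))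
    rooted-extra {S} {u} {es} cS u∈ f nb ds = atLeast-≤ (≤-reflexive arith) (rooted-count cS u∈ O (λ i p → ∖-⊑ p) triple (spanning cS nb ds))
      where
      O : VSet n
      O = offCycle S u
      triple : ∀ v → O ∋ v → AtLeast (Spans (S ─ v)) 3
      triple v p = atLeast-≤ (≤-trans (3≤len c) (≤-trans (≤-reflexive (sym length-cycle-edges)) (n≤1+n _)))
        (spanning (nc-conn (─-⊑ (∖-⊑ p))) (cycle-edges-nonBridge (λ i → ─-intro (f i) (λ e → ∖-∌ p (subst (cset c ∋_) e (cset-intro c i))))) cycle-edges-distinct)
      x y z w : ℕ
      x = length es
      y = card O
      z = card (S ─ u ∖ O)
      w = choose2 (card (nc S ─ u))
      cardS : card S ≡ suc (y + z)
      cardS = trans (card-─ u∈) (cong suc (≤-antisym (card-∪ {A = O} {S ─ u ∖ O} cov) (card-⊎ {A = O} {S ─ u ∖ O} (λ i p → ─-intro (nc-∈ (─-⊑ (∖-⊑ p))) (─-≢ {S = nc S} (∖-⊑ {X = cset c} p))) (λ i → ∖-⊑) (λ i p q → ∖-∌ q p))))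
        where
        cov : ∀ i → S ─ u ∋ i → O ∋ i ⊎ S ─ u ∖ O ∋ i
        cov i p with ∋? O i
        ... | yes q = inj₁ q
        ... | no q = inj₂ (∖-intro p q)
      arith : card S + x + 2 * y + w ≡ suc x + ((y * 3 + z) + w)
      arith rewrite cardS = solve 4 (λ x y z w → (con 1 :+ (y :+ z)) :+ x :+ con 2 :* y :+ w := con 1 :+ x :+ ((y :* con 3 :+ z) :+ w)) refl x y z w

    -- If every cycle vertex is a non-cut vertex other than u, then the edge by which the cycle is left towards u is no
    -- bridge either.
    rooted-cycle : ∀ {S u} → ConnV S → S ∋ u → c within S →
      AtLeast (InU S u) (card S + suc (triangle (card (nc S ─ u))) + card (offCycle S u))
    rooted-cycle {S} {u} cS u∈ f = main (⊑? (cset c) N)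
      where
      N on : VSet n
      N = nc S ─ u
      on i = N i ∧ cset c i
      off : VSet n
      off = offCycle S u
      cardN : card N ≤ card on + card off
      cardN = card-∪ {S = N} {on} {off} cov
        where
        cov : ∀ i → N ∋ i → on ∋ i ⊎ off ∋ i
        cov i p with ∋? (cset c) i
        ... | yes q = inj₁ (mem (∧-intro (is-mem p) (is-mem q)))
        ... | no q = inj₂ (∖-intro p q)
      done : ∀ es → All (NonBridge S) es → AllPairs (λ e f → ¬ Same e f) es → suc (card on) ≤ length es → AtLeast (InU S u) (card S + suc (triangle (card N)) + card off)
      done es nb ds le = atLeast-≤ (begin
          card S + suc (triangle (card N)) + card off                              ≡⟨ cong (λ t → card S + suc t + card off) (triangle-choose2 (card N)) ⟩
          card S + suc (card N + choose2 (card N)) + card off                      ≤⟨ +-monoˡ-≤ (card off) (+-monoʳ-≤ (card S) (s≤s (+-monoˡ-≤ (choose2 (card N)) cardN))) ⟩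
          card S + suc (card on + card off + choose2 (card N)) + card off          ≡⟨ solve 4 (λ s o f t → s :+ (con 1 :+ (o :+ f :+ t)) :+ f := s :+ (con 1 :+ o) :+ con 2 :* f :+ t) refl (card S) (card on) (card off) (choose2 (card N)) ⟩
          card S + suc (card on) + 2 * card off + choose2 (card N)                 ≤⟨ +-monoˡ-≤ (choose2 (card N)) (+-monoˡ-≤ (2 * card off) (+-monoʳ-≤ (card S) le)) ⟩
          card S + length es + 2 * card off + choose2 (card N)                     ∎) (rooted-extra cS u∈ f nb ds)
        where open ≤-Reasoning
      main : (∃ λ b → cset c ∋ b × ¬ (N ∋ b)) ⊎ cset c ⊑ N → AtLeast (InU S u) (card S + suc (triangle (card N)) + card off)
      -- A cycle vertex outside `N` makes `on` smaller than the cycle, so the cycle edges alone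
      -- suffice.
      main (inj₁ (b , b∈ , b∉)) = done cycle-edges (cycle-edges-nonBridge f) cycle-edges-distinct
        (subst (suc (card on) ≤_) (trans (sym (card-─ b∈)) (trans card-cset (sym length-cycle-edges))) (s≤s (card-mono {S = on} (λ i p → ─-intro (mem (∧-right {N i} (is-mem p))) (λ { refl → b∉ (mem (∧-left (is-mem p))) })))))
      main (inj₂ sub) with exit {X = cset c} (conn-walk cS (f 0) u∈) (cset-intro c 0) (λ p → ─-≢ (sub u p) refl)
      ... | x , y , x∈ , y∉ , xy with cset-elim c x∈
      ...   | i , _ , refl = done ((at c i , y) ∷ cycle-edges)
          (nc-nonBridge (─-⊑ (sub _ x∈)) xy (f i , f (suc i) , step c i) (λ e → y∉ (subst (cset c ∋_) e (cset-intro c (suc i)))) ∷ cycle-edges-nonBridge f)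
          (Allₚ.applyUpTo⁺₁ cycleEdge (len c) (λ {j} _ → λ { (inj₁ (_ , e)) → y∉ (subst (cset c ∋_) (sym e) (cset-intro c (suc j))) ; (inj₂ (_ , e)) → y∉ (subst (cset c ∋_) (sym e) (cset-intro c j)) }) ∷ cycle-edges-distinct)
          (s≤s (≤-trans (card-mono {S = on} (λ i p → mem (∧-right {N i} (is-mem p)))) (≤-reflexive (trans card-cset (sym length-cycle-edges)))))

-- Recursions for leaves and splittings

triangle-square : ∀ l → triangle (suc l) + triangle l ≡ suc l * suc l
triangle-square zero = refl
triangle-square (suc l) = trans (solve 2 (λ l t → (con 2 :+ l) :+ (con 1 :+ l :+ t) :+ (con 1 :+ l :+ t) := ((con 1 :+ l :+ t) :+ t) :+ (con 3 :+ con 2 :* l)) refl l (triangle l))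
  (trans (cong (_+ (3 + 2 * l)) (triangle-square l)) (solve 1 (λ l → (con 1 :+ l) :* (con 1 :+ l) :+ (con 3 :+ con 2 :* l) := (con 2 :+ l) :* (con 2 :+ l)) refl l))

triangle-mono : ∀ {a b} → a ≤ b → triangle a ≤ triangle b
triangle-mono z≤n = z≤n
triangle-mono (s≤s le) = +-mono-≤ (s≤s le) (triangle-mono le)

-- rootedCycle m counts the connected subgraphs of the cycle of length m through a given vertex,
-- and lollipop m k those of the cycle of length m with a tail of k vertices.
rootedCycle : ℕ → ℕ
rootedCycle m = suc (triangle m)

lollipop : ℕ → ℕ → ℕ
lollipop m k = m * m + 1 + triangle k + k * rootedCycle m

-- The increment to be matched when a leaf is attached to a non-cut vertex: the number of cut
-- vertices grows, that of non-cut vertices stays.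
lollipop-suc : ∀ m k → lollipop m (suc k) ≡ lollipop m k + (suc k + rootedCycle m)
lollipop-suc m k = solve 4 (λ q t k r → q :+ con 1 :+ ((con 1 :+ k) :+ t) :+ (r :+ k :* r) := (q :+ con 1 :+ t :+ k :* r) :+ ((con 1 :+ k) :+ r)) refl (m * m) (triangle k) k (rootedCycle m)

module Recursion {n : ℕ} (G : Graph n) where
  open Cuts G
  open Cycles G
  open Subgraphs G
  open Rooted G

  atLeast-delete : ∀ {S v a b} → AtLeast (InS (S ─ v)) a → AtLeast (InU S v) b → AtLeast (InS S) (a + b)
  atLeast-delete {S} {v} p q = atLeast-mono join (atLeast-+ (λ t (_ , v∈) e → ─-≢ (V⊑ t v (vertex-resp (≐-sym e) v v∈)) refl) p q)
    where
    join : ∀ {T} → InS (S ─ v) T ⊎ InU S v T → InS S T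
    join (inj₁ t) = InS-mono (λ _ → ─-⊑) t
    join (inj₂ (t , _)) = t

  InS-restrict : ∀ {S T v} → InS S T → ¬ (V T ∋ v) → InS (S ─ v) T
  InS-restrict t v∉ = record { V⊑ = λ i p → ─-intro (V⊑ t i p) (λ { refl → v∉ p }) ; E-sym = E-sym t ; E-V = E-V t ; E-adj = E-adj t ; root = root t ; root∈ = root∈ t ; walk = walk t }

  private
    ∌ : ∀ {S : VSet n} {v} → S v ≡ false → ¬ (S ∋ v)
    ∌ e p = true≢false (is-mem p) e

  atMost-delete : ∀ {S v a b} → AtMost (InS (S ─ v)) a → AtMost (InU S v) b → AtMost (InS S) (b + a)
  atMost-delete {S} {v} p q = atMost-split (λ T → V T v) (λ t e → t , mem e) (λ t e → InS-restrict t (∌ e)) q p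

  union : Sub n → Sub n → Sub n
  union T T′ = subgraph (λ i → V T i ∨ V T′ i) (λ i j → E T i j ∨ E T′ i j)

  union-InU : ∀ {A B S T T′ u} → A ⊑ S → B ⊑ S → InU A u T → InU B u T′ → InU S u (union T T′)
  union-InU {A} {B} {S} {T} {T′} {u} f g (t , u∈) (t′ , u∈′) = record
    { V⊑ = λ i p → vv i (∨-elim {V T i} (is-mem p))
    ; E-sym = λ {i} {j} p → es (∨-elim {E T i j} p)
    ; E-V = λ {i} {j} p → ev (∨-elim {E T i j} p)
    ; E-adj = λ {i} {j} p → ea (∨-elim {E T i j} p)
    ; root = u ; root∈ = mem (∨-introˡ (is-mem u∈))
    ; walk = λ i p → ww i (∨-elim {V T i} (is-mem p)) } , mem (∨-introˡ (is-mem u∈))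
    where
    vv : ∀ i → V T i ≡ true ⊎ V T′ i ≡ true → S ∋ i
    vv i (inj₁ p) = f i (V⊑ t i (mem p))
    vv i (inj₂ p) = g i (V⊑ t′ i (mem p))
    es : ∀ {i j} → Edge T i j ⊎ Edge T′ i j → Edge (union T T′) j i
    es (inj₁ p) = ∨-introˡ (E-sym t p)
    es {i} {j} (inj₂ p) = ∨-introʳ {E T j i} (E-sym t′ p)
    ev : ∀ {i j} → Edge T i j ⊎ Edge T′ i j → V (union T T′) ∋ i
    ev (inj₁ p) = mem (∨-introˡ (is-mem (E-V t p)))
    ev {i} (inj₂ p) = mem (∨-introʳ {V T i} (is-mem (E-V t′ p)))
    ea : ∀ {i j} → Edge T i j ⊎ Edge T′ i j → Adj i j
    ea (inj₁ p) = E-adj t p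
    ea (inj₂ p) = E-adj t′ p
    ww : ∀ i → V T i ≡ true ⊎ V T′ i ≡ true → Star (Edge (union T T′)) u i
    ww i (inj₁ p) = Star.map ∨-introˡ (walk-any t u∈ (mem p))
    ww i (inj₂ p) = Star.map (λ {x} {y} → ∨-introʳ {E T x y}) (walk-any t′ u∈′ (mem p))

  -- Gluing at `u` is injective: the sides share the vertex `u` and no edge, so a union determines
  -- its two parts.
  atLeast-split : ∀ {S u a b} (s : Split S u) → AtLeast (InU (Split.A s) u) a → AtLeast (InU (Split.B s) u) b → AtLeast (InU S u) (a * b)
  atLeast-split {S} {u} s = atLeast-* union (union-InU A⊑ B⊑) λ {T} {T₁} {T′} {T₁′} p p₁ q q₁ e →
      part s p q p₁ q₁ e ,
      part (swap s) q p q₁ p₁ ((λ i → trans (∨-comm (V T′ i) (V T i)) (trans (proj₁ e i) (∨-comm (V T₁ i) (V T₁′ i)))) ,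
                               (λ i j → trans (∨-comm (E T′ i j) (E T i j)) (trans (proj₂ e i j) (∨-comm (E T₁ i j) (E T₁′ i j)))))
    where
    open Split s
    half : (s : Split S u) → ∀ {T T′ X X′} → InU (Split.A s) u T → InU (Split.A s) u X → InU (Split.B s) u X′ → union T T′ ≐ union X X′ →
      (V T ⊑ V X) × (∀ {i j} → Edge T i j → Edge X i j)
    half s {T} {T′} {X} {X′} (t , _) (x , u∈) (x′ , _) (e , f) = vs , es
      where
      vs : V T ⊑ V X
      vs i p with ∨-elim {V X i} (trans (sym (e i)) (∨-introˡ (is-mem p)))
      ... | inj₁ q = mem q
      ... | inj₂ q with Split.meet s (V⊑ t i p) (V⊑ x′ i (mem q))
      ...   | refl = u∈
      es : ∀ {i j} → Edge T i j → Edge X i j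
      es {i} {j} p with ∨-elim {E X i j} (trans (sym (f i j)) (∨-introˡ p))
      ... | inj₁ q = q
      ... | inj₂ q = ⊥-elim (Adj-≢ (E-adj t p) (trans (Split.meet s (V⊑ t i (E-V t p)) (V⊑ x′ i (E-V x′ q)))
              (sym (Split.meet s (V⊑ t j (E-V t (E-sym t p))) (V⊑ x′ j (E-V x′ (E-sym x′ q)))))))
    part : (s : Split S u) → ∀ {T T′ X X′} → InU (Split.A s) u T → InU (Split.B s) u T′ → InU (Split.A s) u X → InU (Split.B s) u X′ → union T T′ ≐ union X X′ → T ≐ X
    part s {T} {T′} {X} {X′} t t′ x x′ e with half s {T} {T′} {X} {X′} t x x′ e | half s {X} {X′} {T} {T′} x t t′ (≐-sym {T = union T T′} {T′ = union X X′} e)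
    ... | vs , es | vs′ , es′ = ≐-intro vs vs′ es es′

  module _ {S : VSet n} {v u : Fin n} (l : Leaf S v u) where

    private
      v∈ : S ∋ v
      v∈ = proj₁ l
      u∈ : S ∋ u
      u∈ = proj₁ (proj₂ l)
      vu : Adj v u
      vu = proj₁ (proj₂ (proj₂ l))
      only : ∀ {y} → S ∋ y → Adj v y → y ≡ u
      only = proj₂ (proj₂ (proj₂ l))

      edge-uv : Sub n
      edge-uv = subgraph (λ i → (i == u) ∨ (i == v)) (λ i j → ⌊ same? (i , j) (v , u) ⌋)

      same-swap : ∀ {i j} → ⌊ same? (i , j) (v , u) ⌋ ≡ true → ⌊ same? (j , i) (v , u) ⌋ ≡ true
      same-swap {i} {j} p = ⌊⌋-intro (same? (j , i) (v , u)) (same-flip (⌊⌋-elim (same? (i , j) (v , u)) p))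

      edge-InU : InU S u edge-uv
      edge-InU = record
        { V⊑ = λ i p → vv (∨-elim {i == u} (is-mem p))
        ; E-sym = same-swap
        ; E-V = λ {i} {j} p → ev (⌊⌋-elim (same? (i , j) (v , u)) p)
        ; E-adj = λ {i} {j} p → ea (⌊⌋-elim (same? (i , j) (v , u)) p)
        ; root = u ; root∈ = mem (∨-introˡ (==-refl u)) ; walk = λ i p → ww (∨-elim {i == u} (is-mem p)) } , mem (∨-introˡ (==-refl u))
        where
        vv : ∀ {i} → (i == u) ≡ true ⊎ (i == v) ≡ true → S ∋ i
        vv (inj₁ p) = subst (S ∋_) (sym (==⇒≡ p)) u∈
        vv (inj₂ p) = subst (S ∋_) (sym (==⇒≡ p)) v∈
        ev : ∀ {i j} → Same (i , j) (v , u) → V edge-uv ∋ i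
        ev (inj₁ (refl , refl)) = mem (∨-introʳ {v == u} (==-refl v))
        ev (inj₂ (refl , refl)) = mem (∨-introˡ (==-refl u))
        ea : ∀ {i j} → Same (i , j) (v , u) → Adj i j
        ea (inj₁ (refl , refl)) = vu
        ea (inj₂ (refl , refl)) = Adj-sym vu
        ww : ∀ {i} → (i == u) ≡ true ⊎ (i == v) ≡ true → Star (Edge edge-uv) u i
        ww (inj₁ p) = subst (Star _ u) (sym (==⇒≡ p)) ε
        ww (inj₂ p) = subst (Star _ u) (sym (==⇒≡ p)) (⌊⌋-intro (same? (u , v) (v , u)) (inj₂ (refl , refl)) ◅ ε)

      point : Sub n
      point = indSub (_== v)

      point-InU : InU S v point
      point-InU = spans-InU (λ i p → subst (S ∋_) (sym (==⇒≡ (is-mem p))) v∈) (mem (==-refl v))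
        (indSub-spans (v , mem (==-refl v) , λ i p → subst (Star _ v) (sym (==⇒≡ (is-mem p))) ε))

      grow : Sub n → Sub n
      grow T = union edge-uv T

      grow-InU : ∀ {T} → InU (S ─ v) u T → InU S v (grow T)
      grow-InU p = proj₁ (union-InU (λ _ q → q) (λ _ → ─-⊑) edge-InU p) , mem (∨-introˡ (∨-introʳ {v == u} (==-refl v)))

      grow-inj : ∀ {T T′} → InU (S ─ v) u T → InU (S ─ v) u T′ → grow T ≐ grow T′ → T ≐ T′
      grow-inj {T} {T′} t t′ e = ≐-intro (vs {T} {T′} t t′ e) (vs {T′} {T} t′ t e′) (es {T} {T′} t e) (es {T′} {T} t′ e′)
        where
        e′ : grow T′ ≐ grow T
        e′ = ≐-sym {T = grow T} e
        vs : ∀ {T T′} → InU (S ─ v) u T → InU (S ─ v) u T′ → grow T ≐ grow T′ → V T ⊑ V T′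
        vs {T} {T′} (t , _) (t′ , u∈′) (e , _) i p with ∨-elim {(i == u) ∨ (i == v)} (trans (sym (e i)) (∨-introʳ {(i == u) ∨ (i == v)} (is-mem p)))
        ... | inj₂ q = mem q
        ... | inj₁ q with ∨-elim {i == u} q
        ...   | inj₁ r = subst (V T′ ∋_) (sym (==⇒≡ r)) u∈′
        ...   | inj₂ r = ⊥-elim (─-≢ (V⊑ t i p) (==⇒≡ r))
        es : ∀ {T T′} → InU (S ─ v) u T → grow T ≐ grow T′ → ∀ {i j} → Edge T i j → Edge T′ i j
        es {T} {T′} (t , _) (_ , f) {i} {j} p with ∨-elim {⌊ same? (i , j) (v , u) ⌋} (trans (sym (f i j)) (∨-introʳ {⌊ same? (i , j) (v , u) ⌋} p))
        ... | inj₂ q = q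
        ... | inj₁ q with ⌊⌋-elim (same? (i , j) (v , u)) q
        ...   | inj₁ (r , _) = ⊥-elim (─-≢ (V⊑ t i (E-V t p)) r)
        ...   | inj₂ (_ , r) = ⊥-elim (─-≢ (V⊑ t j (E-V t (E-sym t p))) r)

    -- Besides the point `v`, the subgraphs through the leaf arise from those through `u` by adding
    -- the edge `vu`.
    atLeast-leaf : ∀ {a} → AtLeast (InU (S ─ v) u) a → AtLeast (InU S v) (suc a)
    atLeast-leaf p = atLeast-mono join (atLeast-+ dis (atLeast-one {P = λ T → InU S v T × ¬ (V T ∋ u)} point (point-InU , λ q → Adj-≢ vu (sym (==⇒≡ (is-mem q)))))
        (atLeast-inject {Q = λ T → InU S v T × V T ∋ u} grow (λ {T} t → grow-InU t , mem (∨-introˡ (∨-introˡ (==-refl u)))) grow-inj p))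
      where
      dis : ∀ {T T′} → InU S v T × ¬ (V T ∋ u) → InU S v T′ × V T′ ∋ u → ¬ T ≐ T′
      dis (_ , ne) (_ , q) e = ne (vertex-resp (≐-sym e) u q)
      join : ∀ {T} → (InU S v T × ¬ (V T ∋ u)) ⊎ (InU S v T × V T ∋ u) → InU S v T
      join (inj₁ (t , _)) = t
      join (inj₂ (t , _)) = t

    private
      prune : Sub n → Sub n
      prune T = subgraph (V T ─ v) (λ i j → E T i j ∧ (not (i == v) ∧ not (j == v)))

      prune-edge⁺ : ∀ {T i j} → Edge T i j → i ≢ v → j ≢ v → Edge (prune T) i j
      prune-edge⁺ p a b = ∧-intro p (∧-intro (true-not (λ e → a (==⇒≡ e))) (true-not (λ e → b (==⇒≡ e))))

      prune-edge⁻ : ∀ {T i j} → Edge (prune T) i j → Edge T i j × i ≢ v × j ≢ v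
      prune-edge⁻ {T} {i} {j} p = ∧-left p , (λ { refl → not-true (∧-left (∧-right {E T i j} p)) (==-refl i) }) , (λ { refl → not-true (∧-right {not (i == v)} (∧-right {E T i j} p)) (==-refl j) })

      u≢v : u ≢ v
      u≢v e = Adj-≢ vu (sym e)

      prune-InU : ∀ {T} → InU S u T → InU (S ─ v) u (prune T)
      prune-InU {T} (t , u∈) = record
        { V⊑ = λ i p → ─-intro (V⊑ t i (─-⊑ p)) (─-≢ p)
        ; E-sym = λ p → let (a , b , c) = prune-edge⁻ {T} p in prune-edge⁺ {T} (E-sym t a) c b
        ; E-V = λ p → let (a , b , _) = prune-edge⁻ {T} p in ─-intro (E-V t a) b
        ; E-adj = λ p → E-adj t (proj₁ (prune-edge⁻ {T} p))
        ; root = u ; root∈ = ─-intro u∈ u≢v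
        ; walk = λ i p → subst₂ (Star (Edge (prune T))) (ρ-≢ u≢v) (ρ-≢ (─-≢ p)) (Star.kleisliStar ρ fold (walk-any t u∈ (─-⊑ p))) } , ─-intro u∈ u≢v
        where
        ρ : Fin n → Fin n
        ρ x with x ≡? v
        ... | yes _ = u
        ... | no _ = x
        ρ-≢ : ∀ {x} → x ≢ v → ρ x ≡ x
        ρ-≢ {x} p with x ≡? v
        ... | yes q = ⊥-elim (p q)
        ... | no _ = refl
        fold : ∀ {x y} → Edge T x y → Star (Edge (prune T)) (ρ x) (ρ y)
        fold {x} {y} p with x ≡? v | y ≡? v
        ... | yes refl | yes refl = ε
        ... | yes refl | no _ with only (V⊑ t y (E-V t (E-sym t p))) (E-adj t p)
        ...   | refl = ε
        fold {x} {y} p | no _ | yes refl with only (V⊑ t x (E-V t p)) (Adj-sym (E-adj t p))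
        ...   | refl = ε
        fold {x} {y} p | no x≢ | no y≢ = prune-edge⁺ {T} p x≢ y≢ ◅ ε

      first-edge : ∀ {T} → InS S T → V T ∋ v → V T ∋ u → Edge T v u
      first-edge t a b with walk-any t a b
      ... | ε = ⊥-elim (u≢v refl)
      ... | p ◅ _ with only (V⊑ t _ (E-V t (E-sym t p))) (E-adj t p)
      ...   | refl = p

      -- A connected subgraph containing both `u` and the leaf `v` must use the edge `vu`, so
      -- removing `v` loses no information.
      prune-inj : ∀ {T T′} → InU S u T × V T ∋ v → InU S u T′ × V T′ ∋ v → prune T ≐ prune T′ → T ≐ T′
      prune-inj {T} {T′} t t′ e = ≐-intro (vs {T} {T′} t′ e) (vs {T′} {T} t e′) (es {T} {T′} t t′ e) (es {T′} {T} t′ t e′)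
        where
        e′ : prune T′ ≐ prune T
        e′ = ≐-sym {T = prune T} e
        vs : ∀ {T T′} → InU S u T′ × V T′ ∋ v → prune T ≐ prune T′ → V T ⊑ V T′
        vs {T} {T′} (_ , v∈′) e i p with i ≡? v
        ... | yes refl = v∈′
        ... | no ne = ─-⊑ (vertex-resp {T = prune T} {T′ = prune T′} e i (─-intro p ne))
        es : ∀ {T T′} → InU S u T × V T ∋ v → InU S u T′ × V T′ ∋ v → prune T ≐ prune T′ → ∀ {i j} → Edge T i j → Edge T′ i j
        es {T} {T′} ((t , _) , _) ((t′ , u∈′) , v∈′) e {i} {j} p with i ≡? v | j ≡? v
        ... | no a | no b = proj₁ (prune-edge⁻ {T′} (edge-resp {T = prune T} {T′ = prune T′} e (prune-edge⁺ {T} p a b)))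
        ... | yes refl | _ with only (V⊑ t j (E-V t (E-sym t p))) (E-adj t p)
        ...   | refl = first-edge t′ v∈′ u∈′
        es {T} {T′} ((t , _) , _) ((t′ , u∈′) , v∈′) e {i} {j} p | no _ | yes refl with only (V⊑ t i (E-V t p)) (Adj-sym (E-adj t p))
        ...   | refl = E-sym t′ (first-edge t′ v∈′ u∈′)

    atMost-leaf : ∀ {a} → AtMost (InU (S ─ v) u) a → AtMost (InU S v) (a + 1)
    atMost-leaf m = atMost-split {Q = λ T → InU S u T × V T ∋ v} {R = λ T → InU S v T × ¬ (V T ∋ u)} (λ T → V T u) (λ (t , v∈′) e → (t , mem e) , v∈′) (λ t e → t , ∌ e)
        (atMost-inject prune (λ (t , _) → prune-InU t) prune-inj m)
        (atMost-code {B = Bool} (λ _ → true) (true ∷ []) (λ _ → here refl) lone)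
      where
      stay : ∀ {T} → InU S v T × ¬ (V T ∋ u) → ∀ {i} → Star (Edge T) v i → i ≡ v
      stay _ ε = refl
      stay ((t , _) , u∉) (p ◅ _) with only (V⊑ t _ (E-V t (E-sym t p))) (E-adj t p)
      ... | refl = ⊥-elim (u∉ (E-V t (E-sym t p)))
      noedge : ∀ {T} → InU S v T × ¬ (V T ∋ u) → ∀ {i j} → Edge T i j → ⊥
      noedge {T} h@((t , v∈′) , _) p = Adj-≢ (E-adj t p) (trans (stay h (walk-any t v∈′ (E-V t p))) (sym (stay h (walk-any t v∈′ (E-V t (E-sym t p))))))
      lone : ∀ {T T′} → InU S v T × ¬ (V T ∋ u) → InU S v T′ × ¬ (V T′ ∋ u) → true ≡ true → T ≐ T′
      lone {T} {T′} h h′ _ = ≐-intro (vs {T} {T′} h h′) (vs {T′} {T} h′ h) (λ p → ⊥-elim (noedge h p)) (λ p → ⊥-elim (noedge h′ p))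
        where
        vs : ∀ {T T′} → InU S v T × ¬ (V T ∋ u) → InU S v T′ × ¬ (V T′ ∋ u) → V T ⊑ V T′
        vs {T} {T′} h@((t , v∈′) , _) ((_ , v∈″) , _) i p = subst (V T′ ∋_) (sym (stay h (walk-any t v∈′ p))) v∈″

    -- A subgraph through `u` either avoids the leaf or contains it together with its edge, which
    -- doubles the count.
    atMost-leaf-nbr : ∀ {a} → AtMost (InU (S ─ v) u) a → AtMost (InU S u) (a + a)
    atMost-leaf-nbr m = atMost-split {Q = λ T → InU S u T × V T ∋ v} {R = InU (S ─ v) u} (λ T → V T v) (λ t e → t , mem e) (λ (t , u∈′) e → InS-restrict t (∌ e) , u∈′)
      (atMost-inject prune (λ (t , _) → prune-InU t) prune-inj m) m

  -- Non-cut vertices are deleted successively, each contributing at least the current cardinality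
  -- as a rooted count. Paths attain the bound.
  connected-bound : ∀ {S} → ConnV S → AtLeast (InS S) (triangle (card S))
  connected-bound {S} cS = go (card S) S refl cS
    where
    go : ∀ d S → card S ≡ d → ConnV S → AtLeast (InS S) (triangle (card S))
    go d S eq cS@(r , r∈ , w) with ⊑? S (_== r)
    ... | inj₂ sub = atLeast-≤ (triangle-mono {b = 1} (≤-trans (card-mono sub) (card-single r))) (atLeast-one _ (proj₁ (indSub-spans cS)))
    go zero S eq (r , r∈ , w) | inj₁ _ = ⊥-elim (<-irrefl refl (subst (1 ≤_) eq (card-pos r∈)))
    go (suc d) S eq cS@(r , r∈ , w) | inj₁ (b , b∈ , b∉) with removable {X = _== r} cS (r , mem (==-refl r) , λ i p → subst (Star _ r) (sym (==⇒≡ (is-mem p))) ε) (λ i p → subst (S ∋_) (sym (==⇒≡ (is-mem p))) r∈) b∈ b∉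
    ... | v , v∈ , _ , cv = atLeast-≤ (≤-reflexive (trans (cong triangle (card-─ v∈)) (trans (+-comm (suc (card (S ─ v))) _) (cong (triangle (card (S ─ v)) +_) (sym (card-─ v∈))))))
            (atLeast-delete (go d (S ─ v) (suc-injective (trans (sym (card-─ v∈)) eq)) cv) (atLeast-≤ (m≤m+n (card S) _) (rooted-bound cS v∈)))

  Chordless : Cyc → VSet n → Set
  Chordless c S = S ⊑ cset c × (∀ {i j} → Ind S i j → ∃ λ p → p < len c × Same (i , j) (cycleEdge c p))

  -- Strictness has two sources: a vertex off the cycle, through the surplus in `rooted-cycle`, or a
  -- chord, which is a further non-bridge edge. If neither exists, `S` induces exactly the cycle.
  two-connected : ∀ {S} c → ConnV S → c within S → S ⊑ nc S →
    AtLeast (InS S) (lollipop (card S) 0) × (AtLeast (InS S) (suc (lollipop (card S) 0)) ⊎ Chordless c S)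
  two-connected {S} c cS f all = bound (m≤m+n _ _) base , strict
    where
    u : Fin n
    u = at c 0
    l : ℕ
    l = card (S ─ u)
    cardS : card S ≡ suc l
    cardS = card-─ (f 0)
    ncS : card (nc S ─ u) ≡ l
    ncS = card-cong (λ i p → ─-intro (nc-∈ (─-⊑ p)) (─-≢ p)) (λ i p → ─-intro (all i (─-⊑ p)) (─-≢ p))
    cu : ConnV (S ─ u)
    cu = nc-conn (all u (f 0))
    arith : ∀ x → lollipop (card S) 0 + x ≡ triangle l + (card S + suc (triangle l) + x)
    arith x rewrite cardS = trans (cong (λ q → q + 1 + 0 + 0 + x) (sym (triangle-square l)))
      (solve 3 (λ l t x → con 1 :+ l :+ t :+ t :+ con 1 :+ con 0 :+ con 0 :+ x := t :+ (con 1 :+ l :+ (con 1 :+ t) :+ x)) refl l (triangle l) x)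
    bound : ∀ {N x} → N ≤ lollipop (card S) 0 + x → AtLeast (InU S u) (card S + suc (triangle l) + x) → AtLeast (InS S) N
    bound {x = x} le r = atLeast-≤ (≤-trans le (≤-reflexive (arith x))) (atLeast-delete (connected-bound cu) r)
    base : AtLeast (InU S u) (card S + suc (triangle l) + card (offCycle c S u))
    base = subst (λ t → AtLeast (InU S u) (card S + suc (triangle t) + card (offCycle c S u))) ncS (rooted-cycle c cS (f 0) f)
    one : suc (lollipop (card S) 0) ≤ lollipop (card S) 0 + 1
    one = ≤-reflexive (+-comm 1 _)
    strict : AtLeast (InS S) (suc (lollipop (card S) 0)) ⊎ Chordless c S
    strict with ⊑? S (cset c)
    ... | inj₁ (b , b∈ , b∉) = inj₁ (bound one (atLeast-≤ (+-monoʳ-≤ (card S + suc (triangle l)) (card-pos off)) base))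
      where
      off : offCycle c S u ∋ b
      off = ∖-intro (─-intro (all b b∈) (λ e → b∉ (subst (cset c ∋_) (sym e) (cset-intro c 0)))) b∉
    ... | inj₂ sub with any? (λ i → any? (λ j → ind? S i j ×-dec ¬? (any? (λ (p : Fin (len c)) → same? (i , j) (cycleEdge c (toℕ p))))))
    ...   | no none = inj₂ (sub , λ {i} {j} st → edge st)
      where
      edge : ∀ {i j} → Ind S i j → ∃ λ p → p < len c × Same (i , j) (cycleEdge c p)
      edge {i} {j} st with any? (λ (p : Fin (len c)) → same? (i , j) (cycleEdge c (toℕ p)))
      ... | yes (p , s) = toℕ p , toℕ<n p , s
      ... | no ns = ⊥-elim (none (i , j , st , ns))
    ...   | yes (i , j , st@(i∈ , _ , a) , ns) with cset-elim c (sub i i∈)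
    ...     | q , q< , refl = inj₁ (bound one (atLeast-≤ (begin
                card S + suc (triangle l) + 1                          ≡⟨ cong (λ t → card S + suc t + 1) (triangle-choose2 l) ⟩
                card S + suc (l + choose2 l) + 1                       ≡⟨ solve 3 (λ s l c → s :+ (con 1 :+ (l :+ c)) :+ con 1 := s :+ (con 1 :+ (con 1 :+ l)) :+ c) refl (card S) l (choose2 l) ⟩
                card S + suc (suc l) + choose2 l                       ≤⟨ +-monoˡ-≤ (choose2 l) (≤-trans (+-monoʳ-≤ (card S) (s≤s lenS)) (m≤m+n _ (2 * card (offCycle c S u)))) ⟩
                card S + suc (length (cycle-edges c)) + 2 * card (offCycle c S u) + choose2 l ≡⟨ cong (λ t → card S + suc (length (cycle-edges c)) + 2 * card (offCycle c S u) + choose2 t) (sym ncS) ⟩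
                card S + suc (length (cycle-edges c)) + 2 * card (offCycle c S u) + choose2 (card (nc S ─ u)) ∎)
              (rooted-extra c {es = (at c q , j) ∷ cycle-edges c} cS (f 0) f
                (nc-nonBridge (all _ i∈) st (i∈ , f (suc q) , step c q) (λ e → ns (fromℕ< q< , subst (λ p → Same (at c q , j) (cycleEdge c p)) (sym (toℕ-fromℕ< q<)) (inj₁ (refl , sym e)))) ∷ cycle-edges-nonBridge c f)
                (Allₚ.applyUpTo⁺₁ (cycleEdge c) (len c) (λ {p} p< s → ns (fromℕ< p< , subst (λ p → Same (at c q , j) (cycleEdge c p)) (sym (toℕ-fromℕ< p<)) s)) ∷ cycle-edges-distinct c))))
      where
      open ≤-Reasoning
      lenS : suc l ≤ length (cycle-edges c)
      lenS = subst₂ _≤_ cardS (trans (card-cset c) (sym (length-cycle-edges c))) (card-mono sub)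

-- Inequalities between the counts

triangle-double : ∀ l → triangle l + triangle l ≡ l * suc l
triangle-double zero = refl
triangle-double (suc l) = trans (solve 2 (λ l t → (con 1 :+ l :+ t) :+ (con 1 :+ l :+ t) := (t :+ t) :+ con 2 :* (con 1 :+ l)) refl l (triangle l))
  (trans (cong (_+ 2 * suc l) (triangle-double l)) (solve 1 (λ l → l :* (con 1 :+ l) :+ con 2 :* (con 1 :+ l) := (con 1 :+ l) :* (con 2 :+ l)) refl l))

triangle-≥ : ∀ l → l ≤ triangle l
triangle-≥ zero = z≤n
triangle-≥ (suc l) = m≤m+n (suc l) (triangle l)

-- The increment to be matched when a leaf is attached to a vertex that is already a cut vertex:
-- only the number of non-cut vertices grows.
lollipop-widen : ∀ m k → lollipop (suc m) k ≡ lollipop m k + (2 * m + 1 + k * suc m)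
lollipop-widen m k = solve 4 (λ m t k r → (con 1 :+ m) :* (con 1 :+ m) :+ con 1 :+ t :+ k :* (con 1 :+ ((con 1 :+ m) :+ r)) :=
  (m :* m :+ con 1 :+ t :+ k :* (con 1 :+ r)) :+ (con 2 :* m :+ con 1 :+ k :* (con 1 :+ m))) refl m (triangle k) k (triangle m)

module _ (a i d : ℕ) (a≡ : a ≡ i + d) where

  -- With c = a + 1 and k = i + 1 the last term is the surplus (c - 1)(c - k). The factor 2 is the
  -- rooted count of a single edge, and the other terms are 2m + k(m + 1) for m = a + 1.
  leafPair-identity : (i + rootedCycle (suc a)) * 2 ≡ 2 * suc a + suc i * suc (suc a) + a * d
  leafPair-identity = trans (solve 3 (λ i a t → (i :+ (con 1 :+ ((con 1 :+ a) :+ t))) :* con 2 := con 2 :* i :+ con 4 :+ con 2 :* a :+ (t :+ t)) refl i a (triangle a))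
    (trans (cong (2 * i + 4 + 2 * a +_) (triangle-double a)) rest)
    where
    rest : 2 * i + 4 + 2 * a + a * suc a ≡ 2 * suc a + suc i * suc (suc a) + a * d
    rest rewrite a≡ = solve 2 (λ i d → con 2 :* i :+ con 4 :+ con 2 :* (i :+ d) :+ (i :+ d) :* (con 1 :+ (i :+ d)) :=
      con 2 :* (con 1 :+ (i :+ d)) :+ (con 1 :+ i) :* (con 2 :+ (i :+ d)) :+ (i :+ d) :* d) refl i d

-- The rooted count of a side containing a cycle times that of the other side, against the increment in lollipop-widen.
module _ (a i j f : ℕ) (le : i + j ≤ a) (1≤a : 1 ≤ a) where

  private
    X N₀ : ℕ
    X = i + rootedCycle (suc a)
    N₀ = 2 * suc a + suc i * suc (suc a)

    i≤a : i ≤ a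
    i≤a = ≤-trans (m≤m+n i j) le

    base : N₀ ≤ X * 2
    base = ≤-trans (m≤m+n N₀ _) (≤-reflexive (sym (leafPair-identity a i (a ∸ i) (sym (m+[n∸m]≡n i≤a)))))

    X-big : suc (suc a) + triangle a ≤ X
    X-big = m≤n+m _ i

  -- Apart from the splitting vertex, `a` and `i` count the non-cut and cut vertices on the side
  -- with a cycle, `suc f` and `j` those on the other side. The second factor of `treeSide` is the
  -- bound of `rooted-bound` for that other side; `f = j = 0` is the single edge.
  treeSide treeNeed : ℕ
  treeSide = X * (2 + f + j + triangle f)
  treeNeed = 2 * (a + suc f) + suc (i + j) * suc (a + suc f)

  private
    open ≤-Reasoning

    side : treeSide ≡ X * 2 + (j * X + (f * X + triangle f * X))
    side = solve 4 (λ x f j t → x :* (con 2 :+ f :+ j :+ t) := x :* con 2 :+ (j :* x :+ (f :* x :+ t :* x))) refl X f j (triangle f)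

    need : treeNeed ≤ N₀ + (j * suc (suc a) + f * suc (suc (suc a)))
    need = begin
      treeNeed                                            ≡⟨ solve 4 (λ a i j f → con 2 :* (a :+ (con 1 :+ f)) :+ (con 1 :+ (i :+ j)) :* (con 1 :+ (a :+ (con 1 :+ f))) :=
                                                                (con 2 :* (con 1 :+ a) :+ (con 1 :+ i) :* (con 2 :+ a)) :+ (j :* (con 2 :+ a) :+ f :* (con 3 :+ (i :+ j)))) refl a i j f ⟩
      N₀ + (j * suc (suc a) + f * (3 + (i + j)))          ≤⟨ +-monoʳ-≤ N₀ (+-monoʳ-≤ (j * suc (suc a)) (*-monoʳ-≤ f (+-monoʳ-≤ 3 le))) ⟩
      N₀ + (j * suc (suc a) + f * suc (suc (suc a)))      ∎

    f-part : ∀ f → f * suc (suc (suc a)) + f ≤ f * X + triangle f * X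
    f-part f = begin
      f * suc (suc (suc a)) + f             ≡⟨ solve 2 (λ a f → f :* (con 3 :+ a) :+ f := f :* (con 2 :+ a) :+ f :* con 2) refl a f ⟩
      f * suc (suc a) + f * 2               ≤⟨ +-mono-≤ (*-monoʳ-≤ f big) (*-mono-≤ (triangle-≥ f) (≤-trans (s≤s (s≤s z≤n)) big)) ⟩
      f * X + triangle f * X                ∎
      where
      big : suc (suc a) ≤ X
      big = ≤-trans (m≤m+n _ _) X-big

    j-part : ∀ j → j * suc (suc a) + j ≤ j * X
    j-part j = begin
      j * suc (suc a) + j             ≡⟨ solve 2 (λ a j → j :* (con 2 :+ a) :+ j := j :* (con 2 :+ a :+ con 1)) refl a j ⟩
      j * (suc (suc a) + 1)           ≤⟨ *-monoʳ-≤ j (≤-trans (+-monoʳ-≤ (suc (suc a)) (≤-trans 1≤a (triangle-≥ a))) X-big) ⟩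
      j * X                           ∎

    -- Beyond the single edge, each unit of `j` or `f` raises the product by at least one more than
    -- the need. Equality is thus confined to `f = j = 0`, where the surplus `a * (a ∸ i)` decides.
    slack : treeNeed + (j + f) ≤ treeSide
    slack = begin
      treeNeed + (j + f)                                                       ≤⟨ +-monoˡ-≤ (j + f) need ⟩
      N₀ + (j * suc (suc a) + f * suc (suc (suc a))) + (j + f)                 ≡⟨ solve 5 (λ n p q j f → n :+ (p :+ q) :+ (j :+ f) := n :+ ((p :+ j) :+ (q :+ f))) refl N₀ (j * suc (suc a)) (f * suc (suc (suc a))) j f ⟩
      N₀ + ((j * suc (suc a) + j) + (f * suc (suc (suc a)) + f))               ≤⟨ +-mono-≤ base (+-mono-≤ (j-part j) (f-part f)) ⟩
      X * 2 + (j * X + (f * X + triangle f * X))                               ≡⟨ sym side ⟩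
      treeSide                                                                 ∎

  treeSide-≥ : treeNeed ≤ treeSide
  treeSide-≥ = ≤-trans (m≤m+n treeNeed (j + f)) slack

  treeSide-> : suc treeNeed ≤ treeSide ⊎ (f ≡ 0 × j ≡ 0 × i ≡ a)
  treeSide-> = split (zero-or-pos (j + f)) (zero-or-pos (a ∸ i))
    where
    zero-or-pos : ∀ x → x ≡ 0 ⊎ 1 ≤ x
    zero-or-pos zero = inj₁ refl
    zero-or-pos (suc x) = inj₂ (s≤s z≤n)
    +1 : suc treeNeed ≡ treeNeed + 1
    +1 = +-comm 1 treeNeed
    split : j + f ≡ 0 ⊎ 1 ≤ j + f → a ∸ i ≡ 0 ⊎ 1 ≤ a ∸ i → suc treeNeed ≤ treeSide ⊎ (f ≡ 0 × j ≡ 0 × i ≡ a)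
    split (inj₂ p) _ = inj₁ (≤-trans (≤-trans (≤-reflexive +1) (+-monoʳ-≤ treeNeed p)) slack)
    split (inj₁ p) (inj₁ q) = inj₂ (m+n≡0⇒n≡0 j p , m+n≡0⇒m≡0 j p , ≤-antisym i≤a (m∸n≡0⇒m≤n q))
    split (inj₁ p) (inj₂ q) = inj₁ (subst₂ (λ f j → suc (2 * (a + suc f) + suc (i + j) * suc (a + suc f)) ≤ X * (2 + f + j + triangle f)) (sym (m+n≡0⇒n≡0 j p)) (sym (m+n≡0⇒m≡0 j p)) (begin
      suc (2 * (a + 1) + suc (i + 0) * suc (a + 1))     ≡⟨ solve 2 (λ a i → con 1 :+ (con 2 :* (a :+ con 1) :+ (con 1 :+ (i :+ con 0)) :* (con 1 :+ (a :+ con 1))) := con 2 :* (con 1 :+ a) :+ (con 1 :+ i) :* (con 2 :+ a) :+ con 1) refl a i ⟩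
      N₀ + 1                                            ≤⟨ +-monoʳ-≤ N₀ (*-mono-≤ 1≤a q) ⟩
      N₀ + a * (a ∸ i)                                  ≡⟨ sym (leafPair-identity a i (a ∸ i) (sym (m+[n∸m]≡n i≤a))) ⟩
      X * 2                                             ∎))

-- Each further tail vertex adds more than `rootedCycle m` subgraphs.
lollipop-grow : ∀ m k d {x} → x ≤ rootedCycle m → lollipop m k + d * x ≤ lollipop m (d + k)
lollipop-grow m k zero le = ≤-reflexive (+-identityʳ _)
lollipop-grow m k (suc d) {x} le = begin
  lollipop m k + (x + d * x)                          ≡⟨ solve 3 (λ l x y → l :+ (x :+ y) := (l :+ y) :+ x) refl (lollipop m k) x (d * x) ⟩
  lollipop m k + d * x + x                            ≤⟨ +-mono-≤ (lollipop-grow m k d le) (≤-trans le (m≤n+m _ (suc (d + k)))) ⟩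
  lollipop m (d + k) + (suc (d + k) + rootedCycle m)  ≡⟨ sym (lollipop-suc m (d + k)) ⟩
  lollipop m (suc (d + k))                            ∎
  where open ≤-Reasoning

-- Two cycle sides in the extreme case where the number of cut vertices is as large as the smaller cycle; the polynomial
-- on the right is (4 times) the difference.
twoCycles-extreme : ∀ p e → let a = 2 + p ; b = a + e in
  suc (lollipop (a + b) (suc a)) ≤ rootedCycle (suc a) * (rootedCycle (suc b) + a)
twoCycles-extreme p e = *-cancelˡ-≤ 4 (≤-trans (m≤m+n (4 * suc (lollipop m (3 + p))) poly) (≤-reflexive (trans left (sym right))))
  where
  b m poly A B M : ℕ
  b = 2 + p + e
  m = 2 + p + b
  A = (3 + p) * (4 + p)
  B = (3 + p + e) * (4 + p + e)
  M = m * suc m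
  poly = 24 + 12 * e + 22 * p + 4 * (e * e) + 19 * (e * p) + 17 * (p * p) + 5 * (e * e * p) + 13 * (e * p * p) + 8 * (p * p * p) + e * e * p * p + 2 * (e * p * p * p) + p * p * p * p
  right : 4 * (rootedCycle (3 + p) * (rootedCycle (suc b) + (2 + p))) ≡ (2 + A) * (6 + 2 * p + B)
  right = trans (solve 3 (λ s t p → con 4 :* ((con 1 :+ s) :* (con 1 :+ t :+ (con 2 :+ p))) := (con 2 :+ (s :+ s)) :* (con 6 :+ con 2 :* p :+ (t :+ t))) refl (triangle (3 + p)) (triangle (suc b)) p)
    (cong₂ (λ x y → (2 + x) * (6 + 2 * p + y)) (triangle-double (3 + p)) (triangle-double (suc b)))
  left : 4 * suc (lollipop m (3 + p)) + poly ≡ (2 + A) * (6 + 2 * p + B)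
  left = trans (cong (_+ poly) (solve 4 (λ q t p s → con 4 :* (con 1 :+ (q :+ con 1 :+ t :+ (con 3 :+ p) :* (con 1 :+ s))) := con 4 :* q :+ con 8 :+ con 2 :* (t :+ t) :+ con 2 :* ((con 3 :+ p) :* (con 2 :+ (s :+ s)))) refl (m * m) (triangle (3 + p)) p (triangle m)))
    (trans (cong₂ (λ x y → 4 * (m * m) + 8 + 2 * x + 2 * ((3 + p) * (2 + y)) + poly) (triangle-double (3 + p)) (triangle-double m))
      (solve 2 (λ p e → let b = con 2 :+ p :+ e ; m = con 2 :+ p :+ b in
         con 4 :* (m :* m) :+ con 8 :+ con 2 :* ((con 3 :+ p) :* (con 4 :+ p)) :+ con 2 :* ((con 3 :+ p) :* (con 2 :+ m :* (con 1 :+ m))) :+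
         (con 24 :+ con 12 :* e :+ con 22 :* p :+ con 4 :* (e :* e) :+ con 19 :* (e :* p) :+ con 17 :* (p :* p) :+ con 5 :* (e :* e :* p) :+ con 13 :* (e :* p :* p) :+ con 8 :* (p :* p :* p) :+ e :* e :* p :* p :+ con 2 :* (e :* p :* p :* p) :+ p :* p :* p :* p)
         := (con 2 :+ (con 3 :+ p) :* (con 4 :+ p)) :* (con 6 :+ con 2 :* p :+ (con 3 :+ p :+ e) :* (con 4 :+ p :+ e))) refl p e))

private
  -- When `i + j` increases by one, the left side grows by at least `X`, while `X * (Y + (i + j))`
  -- grows by exactly `X`; so `i + j = a` is the worst case. Shifting `i` to the factor `X` only
  -- increases the product, since `X ≤ Y`.
  twoCycles-≤ : ∀ {a b} i j → 2 ≤ a → a ≤ b → i + j ≤ a →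
    suc (lollipop (a + b) (suc (i + j))) ≤ (i + rootedCycle (suc a)) * (j + rootedCycle (suc b))
  twoCycles-≤ {a} {b} i j 2≤a a≤b le = ≤-trans (+-cancelʳ-≤ (d * X) _ _ (begin
      suc (lollipop (a + b) (suc (i + j)) + d * X)       ≤⟨ s≤s (lollipop-grow (a + b) (suc (i + j)) d (s≤s (triangle-mono (≤-trans (≤-reflexive (+-comm 1 a)) (+-monoʳ-≤ a (≤-trans (≤-trans (s≤s z≤n) 2≤a) a≤b)))))) ⟩
      suc (lollipop (a + b) (d + suc (i + j)))           ≡⟨ cong (suc ∘ lollipop (a + b)) (trans (+-suc d (i + j)) (cong suc (m∸n+n≡m le))) ⟩
      suc (lollipop (a + b) (suc a))                     ≤⟨ extreme ⟩
      X * (Y + a)                                        ≡⟨ cong (λ z → X * (Y + z)) (sym (m+[n∸m]≡n le)) ⟩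
      X * (Y + (i + j + d))                              ≡⟨ solve 4 (λ x y s d → x :* (y :+ (s :+ d)) := x :* (y :+ s) :+ d :* x) refl X Y (i + j) d ⟩
      X * (Y + (i + j)) + d * X                          ∎)) (begin
      X * (Y + (i + j))                                  ≡⟨ solve 4 (λ x y i j → x :* (y :+ (i :+ j)) := x :* y :+ i :* x :+ x :* j) refl X Y i j ⟩
      X * Y + i * X + X * j                              ≤⟨ +-monoˡ-≤ (X * j) (+-monoʳ-≤ (X * Y) (≤-trans (*-monoʳ-≤ i (s≤s (triangle-mono (s≤s a≤b)))) (m≤m+n (i * Y) (i * j)))) ⟩
      X * Y + (i * Y + i * j) + X * j                    ≡⟨ solve 4 (λ x y i j → x :* y :+ (i :* y :+ i :* j) :+ x :* j := (i :+ x) :* (j :+ y)) refl X Y i j ⟩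
      (i + X) * (j + Y)                                  ∎)
    where
    open ≤-Reasoning
    X Y d : ℕ
    X = rootedCycle (suc a)
    Y = rootedCycle (suc b)
    d = a ∸ (i + j)
    extreme : suc (lollipop (a + b) (suc a)) ≤ X * (Y + a)
    extreme = subst₂ (λ x y → suc (lollipop (x + y) (suc x)) ≤ rootedCycle (suc x) * (rootedCycle (suc y) + x)) (m+[n∸m]≡n 2≤a)
      (trans (cong (_+ (b ∸ a)) (m+[n∸m]≡n 2≤a)) (m+[n∸m]≡n a≤b)) (twoCycles-extreme (a ∸ 2) (b ∸ a))

twoCycles : ∀ {a b} i j → 2 ≤ a → 2 ≤ b → i + j ≤ a → i + j ≤ b →
  suc (lollipop (a + b) (suc (i + j))) ≤ (i + rootedCycle (suc a)) * (j + rootedCycle (suc b))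
twoCycles {a} {b} i j 2≤a 2≤b le le′ with ≤-total a b
... | inj₁ a≤b = twoCycles-≤ i j 2≤a a≤b le
... | inj₂ b≤a = subst₂ (λ s t → suc (lollipop s (suc t)) ≤ (i + rootedCycle (suc a)) * (j + rootedCycle (suc b))) (+-comm b a) (+-comm j i)
      (≤-trans (twoCycles-≤ {b} {a} j i 2≤b b≤a (subst (_≤ b) (+-comm i j) le′)) (≤-reflexive (*-comm (j + rootedCycle (suc b)) (i + rootedCycle (suc a)))))

-- Extremal shapes and the induction

-- Labels of the lollipop: 0, …, m − 1 run around the cycle, m, m + 1, … along the tail attached at 0.
LEdge LAdj : ℕ → ℕ → ℕ → Set
LEdge m a b = (suc a ≡ b × (b < m ⊎ m < b)) ⊎ (a ≡ 0 × b ≡ m) ⊎ (suc a ≡ m × b ≡ 0)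
LAdj m a b = LEdge m a b ⊎ LEdge m b a

-- When the labels below `s` are in use, `p` is the free end of the tail: the next vertex, labelled
-- `s`, attaches to it.
Hangs : ℕ → ℕ → ℕ → Set
Hangs m p s = (s ≡ m × p ≡ 0) ⊎ (m < s × suc p ≡ s)

hangs⇒adj : ∀ {m p s} → Hangs m p s → LAdj m p s
hangs⇒adj (inj₁ (e , f)) = inj₁ (inj₂ (inj₁ (f , e)))
hangs⇒adj (inj₂ (lt , e)) = inj₁ (inj₁ (e , inj₂ lt))

adj⇒hangs : ∀ {m a s} → m ≤ s → a < s → LAdj m a s → Hangs m a s
adj⇒hangs le lt (inj₁ (inj₁ (e , inj₁ l))) = ⊥-elim (<⇒≱ l le)
adj⇒hangs le lt (inj₁ (inj₁ (e , inj₂ g))) = inj₂ (g , e)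
adj⇒hangs le lt (inj₁ (inj₂ (inj₁ (e , f)))) = inj₁ (f , e)
adj⇒hangs le () (inj₁ (inj₂ (inj₂ (e , refl))))
adj⇒hangs le lt (inj₂ (inj₁ (refl , _))) = ⊥-elim (<-asym lt ≤-refl)
adj⇒hangs le () (inj₂ (inj₂ (inj₁ (refl , f))))
adj⇒hangs le lt (inj₂ (inj₂ (inj₂ (refl , f)))) = ⊥-elim (<-irrefl refl le)

hangs-unique : ∀ {m p q s} → Hangs m p s → Hangs m q s → p ≡ q
hangs-unique (inj₁ (_ , refl)) (inj₁ (_ , refl)) = refl
hangs-unique (inj₁ (refl , _)) (inj₂ (lt , _)) = ⊥-elim (<-irrefl refl lt)
hangs-unique (inj₂ (lt , _)) (inj₁ (refl , _)) = ⊥-elim (<-irrefl refl lt)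
hangs-unique (inj₂ (_ , e)) (inj₂ (_ , f)) = suc-injective (trans e (sym f))

hangs-exists : ∀ {m s} → m ≤ s → 3 ≤ m → ∃ λ p → p < s × Hangs m p s
hangs-exists {m} {s} le 3≤ with m≤n⇒m<n∨m≡n le
... | inj₂ refl = 0 , ≤-trans (s≤s z≤n) 3≤ , inj₁ (refl , refl)
hangs-exists {m} {suc s} le 3≤ | inj₁ lt = s , ≤-refl , inj₂ (lt , refl)

LAdj-irrefl : ∀ {m a} → 3 ≤ m → ¬ LAdj m a a
LAdj-irrefl {m} {a} 3≤ p = go (Sum.[ id , id ] p)
  where
  go : ¬ LEdge m a a
  go (inj₁ (e , _)) = 1+n≢n e
  go (inj₂ (inj₁ (refl , refl))) = case 3≤
    where case : ¬ 3 ≤ 0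
          case ()
  go (inj₂ (inj₂ (refl , refl))) = case 3≤
    where case : ¬ 3 ≤ 1
          case (s≤s ())

_[_↦_] : ∀ {A : Set} → (ℕ → A) → ℕ → A → ℕ → A
(h [ s ↦ v ]) a with a ℕ.≟ s
... | yes _ = v
... | no _ = h a

↦-new : ∀ {A : Set} (h : ℕ → A) s v → (h [ s ↦ v ]) s ≡ v
↦-new h s v with s ℕ.≟ s
... | yes _ = refl
... | no ne = ⊥-elim (ne refl)

↦-old : ∀ {A : Set} (h : ℕ → A) {s} v {a} → a < s → (h [ s ↦ v ]) a ≡ h a
↦-old h {s} v {a} lt with a ℕ.≟ s
... | yes e = ⊥-elim (<-irrefl e lt)
... | no _ = refl

<suc-elim : ∀ {a s} → a < suc s → a < s ⊎ a ≡ s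
<suc-elim (s≤s le) = m≤n⇒m<n∨m≡n le

module Shapes {n : ℕ} (G : Graph n) where
  open Cuts G
  open Cycles G
  open Subgraphs G
  open Rooted G
  open Recursion G

  -- The labelling is a total function read below `s`, so that a tail vertex is added by an update
  -- at `s` and removed by lowering `s`.
  record IsLolli (S : VSet n) (m s : ℕ) (h : ℕ → Fin n) : Set where
    field
      3≤m : 3 ≤ m
      m≤s : m ≤ s
      into : ∀ {a} → a < s → S ∋ h a
      onto : ∀ {v} → S ∋ v → ∃ λ a → a < s × h a ≡ v
      h-inj : ∀ {a b} → a < s → b < s → h a ≡ h b → a ≡ b
      adj⇒ : ∀ {a b} → a < s → b < s → Adj (h a) (h b) → LAdj m a b
      adj⇐ : ∀ {a b} → a < s → b < s → LAdj m a b → Adj (h a) (h b)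
  open IsLolli public

  module Extend {S : VSet n} {v : Fin n} {m s : ℕ} {h : ℕ → Fin n} (v∈ : S ∋ v) (L : IsLolli (S ─ v) m s h) where

    h′ : ℕ → Fin n
    h′ = h [ s ↦ v ]

    old : ∀ {a} → a < s → h′ a ≡ h a
    old = ↦-old h v

    new : h′ s ≡ v
    new = ↦-new h s v

    extend-into : ∀ {a} → a < s ⊎ a ≡ s → S ∋ h′ a
    extend-into (inj₁ lt) = subst (S ∋_) (sym (old lt)) (─-⊑ (into L lt))
    extend-into (inj₂ refl) = subst (S ∋_) (sym new) v∈

    extend-onto : ∀ {w} → S ∋ w → ∃ λ a → a < suc s × h′ a ≡ w
    extend-onto {w} w∈ with w ≡? v
    ... | yes refl = s , ≤-refl , new
    ... | no ne with onto L (─-intro w∈ ne)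
    ...   | a , lt , e = a , m≤n⇒m≤1+n lt , trans (old lt) e

    fresh : ∀ {a} → a < s → h′ a ≢ h′ s
    fresh lt e = ─-≢ (into L lt) (trans (sym (old lt)) (trans e new))

    extend-inj : ∀ {a b} → a < s ⊎ a ≡ s → b < s ⊎ b ≡ s → h′ a ≡ h′ b → a ≡ b
    extend-inj (inj₁ p) (inj₁ q) e = h-inj L p q (trans (sym (old p)) (trans e (old q)))
    extend-inj (inj₁ p) (inj₂ refl) e = ⊥-elim (fresh p e)
    extend-inj (inj₂ refl) (inj₁ q) e = ⊥-elim (fresh q (sym e))
    extend-inj (inj₂ refl) (inj₂ refl) e = refl

  lolli-extend : ∀ {S v m s h p} → IsLolli (S ─ v) m s h → Leaf S v (h p) → p < s → Hangs m p s → IsLolli S m (suc s) (h [ s ↦ v ])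
  lolli-extend {S} {v} {m} {s} {h} {p} L (v∈ , _ , a , only) p<s hangs = record
    { 3≤m = 3≤m L ; m≤s = m≤n⇒m≤1+n (m≤s L)
    ; into = λ lt → extend-into (<suc-elim lt) ; onto = extend-onto ; h-inj = λ a b → extend-inj (<suc-elim a) (<suc-elim b)
    ; adj⇒ = λ a b → fwd (<suc-elim a) (<suc-elim b) ; adj⇐ = λ a b → bwd (<suc-elim a) (<suc-elim b) }
    where
    open Extend v∈ L
    at-new : ∀ {a} → a < s → Adj (h′ a) (h′ s) → LAdj m a s
    at-new lt e with h-inj L lt p<s (only (─-⊑ (into L lt)) (Adj-sym (subst₂ Adj (old lt) new e)))
    ... | refl = hangs⇒adj hangs
    new-at : ∀ {a} → a < s → LAdj m a s → Adj (h′ a) (h′ s)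
    new-at lt e with hangs-unique hangs (adj⇒hangs (m≤s L) lt e)
    ... | refl = subst₂ Adj (sym (old lt)) (sym new) (Adj-sym a)
    fwd : ∀ {a b} → a < s ⊎ a ≡ s → b < s ⊎ b ≡ s → Adj (h′ a) (h′ b) → LAdj m a b
    fwd (inj₁ p) (inj₁ q) e = adj⇒ L p q (subst₂ Adj (old p) (old q) e)
    fwd (inj₁ p) (inj₂ refl) e = at-new p e
    fwd (inj₂ refl) (inj₁ q) e = Sum.swap (at-new q (Adj-sym e))
    fwd (inj₂ refl) (inj₂ refl) e = ⊥-elim (Adj-≢ e refl)
    bwd : ∀ {a b} → a < s ⊎ a ≡ s → b < s ⊎ b ≡ s → LAdj m a b → Adj (h′ a) (h′ b)
    bwd (inj₁ p) (inj₁ q) e = subst₂ Adj (sym (old p)) (sym (old q)) (adj⇐ L p q e)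
    bwd (inj₁ p) (inj₂ refl) e = new-at p e
    bwd (inj₂ refl) (inj₁ q) e = Adj-sym (new-at q (Sum.swap e))
    bwd (inj₂ refl) (inj₂ refl) e = ⊥-elim (LAdj-irrefl (3≤m L) e)

  lolli-leaf : ∀ {S m s h} → IsLolli S m (suc s) h → m ≤ s → ∃ λ p → Leaf S (h s) (h p) × Hangs m p s
  lolli-leaf {S} {m} {s} {h} L le with hangs-exists le (3≤m L)
  ... | p , p<s , hangs = p , (into L ≤-refl , into L p< , Adj-sym (adj⇐ L p< ≤-refl (hangs⇒adj hangs)) , only) , hangs
    where
    p< : p < suc s
    p< = m≤n⇒m≤1+n p<s
    only : ∀ {y} → S ∋ y → Adj (h s) y → y ≡ h p
    only y∈ a with onto L y∈
    ... | b , b< , refl with <suc-elim b<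
    ...   | inj₁ lt = cong h (hangs-unique (adj⇒hangs le lt (Sum.swap (adj⇒ L ≤-refl b< a))) hangs)
    ...   | inj₂ refl = ⊥-elim (Adj-≢ a refl)

  lolli-isCycle : ∀ {S m s h} → IsLolli S m s h → IsCycle G (applyUpTo h m)
  lolli-isCycle {m = suc l} {h = h} L = isCycle-applyUpTo (3≤m L) (λ i<j j< e → <-irrefl (h-inj L (<-trans i<j (≤-trans j< (m≤s L))) (≤-trans j< (m≤s L)) e) i<j)
    (λ i lt → adj⇐ L (≤-trans (m≤n⇒m≤1+n lt) (m≤s L)) (≤-trans (s≤s lt) (m≤s L)) (inj₁ (inj₁ (refl , inj₁ (s≤s lt)))))
    (adj⇐ L (m≤s L) (≤-trans (s≤s z≤n) (m≤s L)) (inj₁ (inj₂ (inj₂ (refl , refl)))))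
  lolli-isCycle {m = zero} L with 3≤m L
  ... | ()

  lolli-cycle : ∀ {S} c → c within S → Chordless c S → IsLolli S (len c) (len c) (at c)
  lolli-cycle {S} c f (sub , edge) = record
    { 3≤m = 3≤len c ; m≤s = ≤-refl ; into = λ {a} _ → f a ; onto = λ p → cset-elim c (sub _ p) ; h-inj = inj c 0
    ; adj⇒ = λ {a} {b} p q e → fwd p q (edge (f a , f b , e)) ; adj⇐ = λ p q e → bwd p q e }
    where
    next : ∀ {p b} → p < len c → b < len c → at c b ≡ at c (suc p) → LEdge (len c) p b
    next {p} {b} p< b< e with m≤n⇒m<n∨m≡n p<
    ... | inj₁ lt with inj c 0 b< lt e
    ...   | refl = inj₁ (refl , inj₁ lt)
    next {p} {b} p< b< e | inj₂ eq = inj₂ (inj₂ (eq , inj c 0 b< (0<len c) (trans e (trans (cong (at c) (trans eq (sym (+-identityʳ (len c))))) (per c 0)))))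
    fwd : ∀ {a b} → a < len c → b < len c → (∃ λ p → p < len c × Same (at c a , at c b) (cycleEdge c p)) → LAdj (len c) a b
    fwd a< b< (p , p< , inj₁ (e , e′)) with inj c 0 a< p< e
    ... | refl = inj₁ (next a< b< e′)
    fwd a< b< (p , p< , inj₂ (e , e′)) with inj c 0 b< p< e′
    ... | refl = inj₂ (next b< a< e)
    edge′ : ∀ {a b} → a < len c → b < len c → LEdge (len c) a b → Adj (at c a) (at c b)
    edge′ a< b< (inj₁ (refl , _)) = step c _
    edge′ a< b< (inj₂ (inj₁ (_ , refl))) = ⊥-elim (<-irrefl refl b<)
    edge′ {a} a< b< (inj₂ (inj₂ (eq , refl))) = subst (Adj (at c a)) (trans (cong (at c) (trans eq (sym (+-identityʳ (len c))))) (per c 0)) (step c a)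
    bwd : ∀ {a b} → a < len c → b < len c → LAdj (len c) a b → Adj (at c a) (at c b)
    bwd a< b< (inj₁ e) = edge′ a< b< e
    bwd a< b< (inj₂ e) = Adj-sym (edge′ b< a< e)

  -- Q_{2k+1,k} is the lollipop with cycle and tail of length k, with its last leaf doubled.
  IsQ : VSet n → ℕ → Set
  IsQ S k = ∃ λ v → ∃ λ h → ∃ λ p → IsLolli (S ─ v) k (k + k) h × Leaf S v (h p) × suc (suc p) ≡ k + k

  Shape : VSet n → ℕ → ℕ → Set
  Shape S m k = (∃ λ h → IsLolli S m (m + k) h) ⊎ (m ≡ suc k × IsQ S k)

  -- The induction carries the equality case along, because the shape of `S` is built from the shape
  -- of `S` without a leaf.
  Result : VSet n → ℕ → ℕ → Set
  Result S m k = AtLeast (InS S) (lollipop m k) × (AtLeast (InS S) (suc (lollipop m k)) ⊎ Shape S m k)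

  ¬cut⇒nc : ∀ {S} → card (cut S) ≡ 0 → S ⊑ nc S
  ¬cut⇒nc {S} e i p with conn? (S ─ i)
  ... | yes c = nc-intro p c
  ... | no c = ⊥-elim (<-irrefl refl (subst (1 ≤_) e (card-pos (cut-intro p c))))

  chordless-len : ∀ {S} c → c within S → Chordless c S → card S ≡ len c
  chordless-len c f (sub , _) = trans (card-cong sub (cset-⊑ c f)) (card-cset c)

  result₀ : ∀ {S} c → ConnV S → c within S → card (cut S) ≡ 0 → Result S (card (nc S)) 0
  result₀ {S} c cS f e = subst (λ m → Result S m 0) (card-cong (¬cut⇒nc e) (λ _ → nc-∈)) (proj₁ tc , Sum.map₂ shape (proj₂ tc))
    where
    tc = two-connected c cS f (¬cut⇒nc e)
    shape : Chordless c S → Shape S (card S) 0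
    shape ch = inj₁ (at c , subst₂ (λ m s → IsLolli S m s (at c)) (sym (chordless-len c f ch)) (trans (sym (chordless-len c f ch)) (sym (+-identityʳ (card S)))) (lolli-cycle c f ch))

  avoiding : ∀ {S} c → c within S → ∀ u → ∃ λ b → S ∋ b × b ≢ u
  avoiding c f u with at c 0 ≡? u
  ... | no ne = at c 0 , f 0 , ne
  ... | yes e = at c 1 , f 1 , λ e′ → 1+n≢0 (inj c 0 (1<len c) (0<len c) (trans e′ (sym e)))

  module _ (x : Fin n) where

    -- The vertex `x` is left out of both numbers: it is a cut vertex of the whole set but may be a
    -- non-cut vertex of a side.
    sideNoncuts sideCuts : VSet n → ℕ
    sideNoncuts D = card (nc D ─ x)
    sideCuts D = card (D ─ x) ∸ sideNoncuts D

    card-side : ∀ {D} → D ∋ x → card D ≡ suc (sideNoncuts D + sideCuts D)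
    card-side {D} p = trans (card-─ p) (cong suc (sym (m+[n∸m]≡n (card-mono {S = nc D ─ x} (λ t p → ─-intro (nc-∈ (─-⊑ p)) (─-≢ p))))))

    len≤side : ∀ {D} → ConnV D → ∀ c → c within D → len c ≤ suc (sideNoncuts D)
    len≤side {D} cD c f = ≤-trans (len≤nc c cD f) (≤-trans (card-∪ {A = _== x} {nc D ─ x} cov) (+-monoˡ-≤ _ (card-single x)))
      where
      cov : ∀ t → nc D ∋ t → (_== x) ∋ t ⊎ nc D ─ x ∋ t
      cov t p with t ≡? x
      ... | yes refl = inj₁ (mem (==-refl x))
      ... | no ne = inj₂ (─-intro p ne)

    2≤side : ∀ {D} → ConnV D → ∀ c → c within D → 2 ≤ sideNoncuts D
    2≤side cD c f = ≤-pred (≤-trans (3≤len c) (len≤side cD c f))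

    side-rooted : ∀ {D} → ConnV D → D ∋ x → ∀ c → c within D → AtLeast (InU D x) (sideCuts D + rootedCycle (suc (sideNoncuts D)) + card (offCycle c D x))
    side-rooted {D} cD x∈ c f = atLeast-≤ (≤-reflexive (cong (_+ card (offCycle c D x)) eq)) (rooted-cycle c cD x∈ f)
      where
      eq : sideCuts D + rootedCycle (suc (sideNoncuts D)) ≡ card D + suc (triangle (sideNoncuts D))
      eq = trans (solve 3 (λ a i t → i :+ (con 1 :+ ((con 1 :+ a) :+ t)) := con 1 :+ (a :+ i) :+ (con 1 :+ t)) refl (sideNoncuts D) (sideCuts D) (triangle (sideNoncuts D)))
        (cong (_+ suc (triangle (sideNoncuts D))) (sym (card-side x∈)))

  module _ {S : VSet n} {x : Fin n} (x∈ : cut S ∋ x) (s : Split S x) where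
    open Split s

    noncuts-split : card (nc S) ≡ sideNoncuts x A + sideNoncuts x B
    noncuts-split = trans (sym (card-∌ (λ p → cut-¬conn x∈ (nc-conn p)))) (split-nc s)

    cuts-split : card (cut S) ≡ suc (sideCuts x A + sideCuts x B)
    cuts-split = +-cancelˡ-≡ (suc (card (nc S))) _ _ (trans (cong suc (card-nc-cut S)) (trans (split-card s) (trans (cong₂ _+_ (card-side x u∈A) (card-side x u∈B))
      (trans (solve 4 (λ a i b j → con 1 :+ (a :+ i) :+ (con 1 :+ (b :+ j)) := con 1 :+ (a :+ b) :+ (con 1 :+ (i :+ j))) refl (sideNoncuts x A) (sideCuts x A) (sideNoncuts x B) (sideCuts x B))
        (cong (λ z → suc z + suc (sideCuts x A + sideCuts x B)) (sym noncuts-split))))))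

    -- Here the girth enters. A cycle in `D` is at least as long as the number `1 + i + j` of cut
    -- vertices of `S`, and `D` has at least that many non-cut vertices, at most one of which is
    -- `x`.
    cuts≤side : GirthAtLeast G (card (cut S)) → ∀ {D} → ConnV D → ∀ c → c within D → sideCuts x A + sideCuts x B ≤ sideNoncuts x D
    cuts≤side girth cD c f = ≤-pred (≤-trans (≤-reflexive (sym cuts-split)) (≤-trans (girth⇒len girth c) (len≤side x cD c f)))

  -- Deleting a leaf

  module LeafCase {S : VSet n} {v u : Fin n} (cS : ConnV S) (l : Leaf S v u) (c : Cyc) (f : c within S) (girth : GirthAtLeast G (card (cut S))) where

    private
      H : VSet n
      H = S ─ v
      cH : ConnV H
      cH = leaf-conn cS l
      fH : c within H
      fH = within-leaf c f l
      u≢v : u ≢ v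
      u≢v e = Adj-≢ (proj₁ (proj₂ (proj₂ l))) (sym e)
      u∈H : H ∋ u
      u∈H = ─-intro (proj₁ (proj₂ l)) u≢v
      b = proj₁ (avoiding c fH u)
      b∈ : H ∋ b
      b∈ = proj₁ (proj₂ (avoiding c fH u))
      b≢u : b ≢ u
      b≢u = proj₂ (proj₂ (avoiding c fH u))
      sp : Split S u
      sp = leaf-split cS l (─-⊑ b∈) (─-≢ b∈) b≢u

      uv : VSet n
      uv = (_== u) ⊕ v

      card-uv : card (nc uv ─ u) ≡ 1
      card-uv = ≤-antisym (≤-trans (card-mono {S′ = _== v} sub) (card-single v)) (card-pos (─-intro (nc-intro (⊕-new {X = _== u}) conn) (u≢v ∘ sym)))
        where
        sub : nc uv ─ u ⊑ (_== v)
        sub i p with ⊕-elim (nc-∈ (─-⊑ p))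
        ... | inj₁ q = ⊥-elim (─-≢ p (==⇒≡ (is-mem q)))
        ... | inj₂ refl = mem (==-refl v)
        conn : ConnV (uv ─ v)
        conn = u , ─-intro (⊕-old {X = _== u} (mem (==-refl u))) u≢v , λ i p → go i p (⊕-elim (─-⊑ p))
          where
          go : ∀ i → uv ─ v ∋ i → (_== u) ∋ i ⊎ i ≡ v → Walk (uv ─ v) u i
          go i p (inj₁ q) = subst (Walk (uv ─ v) u) (sym (==⇒≡ (is-mem q))) ε
          go i p (inj₂ e) = ⊥-elim (─-≢ p e)

      u∉nc : ¬ (nc S ∋ u)
      u∉nc p with neighbour (nc-conn p) (─-intro (proj₁ l) (u≢v ∘ sym)) (─-intro (─-⊑ b∈) b≢u) (─-≢ b∈)
      ... | _ , q , a = ─-≢ q (proj₂ (proj₂ (proj₂ l)) (─-⊑ q) a)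

      nc-S : card (nc S) ≡ suc (card (nc H ─ u))
      nc-S = trans (sym (card-∌ u∉nc)) (trans (split-nc sp) (trans (cong (card (nc H ─ u) +_) card-uv) (+-comm _ 1)))

      card-S : card S ≡ suc (card H)
      card-S = card-─ (proj₁ l)

    -- A leaf at a non-cut vertex, which thereby becomes a cut vertex

    module Noncut (u∈nc : nc H ∋ u) where

      private
        m k : ℕ
        m = card (nc H)
        k = card (cut H)

      m-eq : card (nc S) ≡ m
      m-eq = trans nc-S (sym (card-─ u∈nc))

      k-eq : card (cut S) ≡ suc k
      k-eq = +-cancelˡ-≡ m _ _ (trans (cong (_+ card (cut S)) (sym m-eq)) (trans (card-nc-cut S) (trans card-S (trans (cong suc (sym (card-nc-cut H))) (sym (+-suc m k))))))

      private
        off : ℕ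
        off = card (offCycle c H u)

        -- `x` is a surplus in the count for `H`, `off` the surplus in the rooted bound; either of
        -- them makes the result strict.
        bound : ∀ x → AtLeast (InS H) (lollipop m k + x) → AtLeast (InS S) (lollipop m (suc k) + (x + off))
        bound x al = atLeast-≤ (≤-reflexive arith) (atLeast-delete al (atLeast-leaf l (rooted-cycle c cH u∈H fH)))
          where
          t : ℕ
          t = card (nc H ─ u)
          arith : lollipop m (suc k) + (x + off) ≡ lollipop m k + x + suc (card H + suc (triangle t) + off)
          arith = trans (cong (_+ (x + off)) (lollipop-suc m k)) (trans
            (cong₂ (λ a b → lollipop m k + (suc k + suc a) + (x + b)) (cong triangle (card-─ u∈nc)) (refl {x = off}))
            (trans (solve 6 (λ L k x o t r → L :+ (con 1 :+ k :+ (con 1 :+ (con 1 :+ t :+ r))) :+ (x :+ o) := L :+ x :+ (con 1 :+ ((con 1 :+ t :+ k) :+ (con 1 :+ r) :+ o))) refl (lollipop m k) k x off t (triangle t))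
              (cong (λ s → lollipop m k + x + suc (s + suc (triangle t) + off)) (trans (cong (_+ k) (sym (card-─ u∈nc))) (card-nc-cut H)))))

        Goal : Set
        Goal = Result S m (suc k)

        plain : AtLeast (InS H) (lollipop m k) → AtLeast (InS S) (lollipop m (suc k))
        plain al = atLeast-≤ (m≤m+n _ _) (bound 0 (subst (AtLeast (InS H)) (sym (+-identityʳ _)) al))

        strict-H : AtLeast (InS H) (suc (lollipop m k)) → AtLeast (InS S) (suc (lollipop m (suc k)))
        strict-H al = atLeast-≤ (≤-trans (≤-reflexive (+-comm 1 _)) (+-monoʳ-≤ _ (s≤s z≤n))) (bound 1 (subst (AtLeast (InS H)) (+-comm 1 _) al))

        strict-off : AtLeast (InS H) (lollipop m k) → 1 ≤ off → AtLeast (InS S) (suc (lollipop m (suc k)))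
        strict-off al le = atLeast-≤ (≤-trans (≤-reflexive (+-comm 1 _)) (+-monoʳ-≤ _ le)) (bound 0 (subst (AtLeast (InS H)) (sym (+-identityʳ _)) al))

        lift : ∀ {k′ h} → k ≡ k′ → IsLolli H m (m + k′) h → ∀ {p} → u ≡ h p → p < m + k′ → Hangs m p (m + k′) → Shape S m (suc k)
        lift {h = h} refl L refl p< hangs = inj₁ (h [ m + k ↦ v ] , subst (λ s → IsLolli S m s (h [ m + k ↦ v ])) (sym (+-suc m k)) (lolli-extend L l p< hangs))

        finish₀ : k ≡ 0 → Goal
        finish₀ k≡0 = plain al , go (two c fH)
          where
          m≡ : card H ≡ m
          m≡ = card-cong (¬cut⇒nc k≡0) (λ _ → nc-∈)
          two : ∀ c → c within H → AtLeast (InS H) (lollipop m k) × (AtLeast (InS H) (suc (lollipop m k)) ⊎ Chordless c H)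
          two c f = subst₂ (λ m k → AtLeast (InS H) (lollipop m k) × (AtLeast (InS H) (suc (lollipop m k)) ⊎ Chordless c H)) m≡ (sym k≡0) (two-connected c cH f (¬cut⇒nc k≡0))
          al : AtLeast (InS H) (lollipop m k)
          al = proj₁ (two c fH)
          -- Label 0 has to be the vertex carrying the tail, so the cycle is rotated to start at
          -- `u`.
          rotated : ∀ p → u ≡ at c p → AtLeast (InS S) (suc (lollipop m (suc k))) ⊎ Shape S m (suc k)
          rotated p e = Sum.map strict-H shape (proj₂ (two c′ f′))
            where
            c′ : Cyc
            c′ = rotate p c
            f′ : c′ within H
            f′ = rotate-within p c fH
            shape : Chordless c′ H → Shape S m (suc k)
            shape ch = lift k≡0 (subst₂ (λ m s → IsLolli H m s (at c′)) len≡ (trans len≡ (sym (+-identityʳ m))) (lolli-cycle c′ f′ ch))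
                (trans e (cong (at c) (sym (+-identityʳ p)))) (subst (0 <_) (trans len≡ (sym (+-identityʳ m))) (0<len c)) (inj₁ (+-identityʳ m , refl))
              where
              len≡ : len c ≡ m
              len≡ = trans (sym (chordless-len c′ f′ ch)) m≡
          go : AtLeast (InS H) (lollipop m k) × (AtLeast (InS H) (suc (lollipop m k)) ⊎ Chordless c H) → AtLeast (InS S) (suc (lollipop m (suc k))) ⊎ Shape S m (suc k)
          go (_ , inj₁ st) = inj₁ (strict-H st)
          go (_ , inj₂ (sub , _)) with cset-elim c (sub u u∈H)
          ... | p , _ , e = rotated p (sym e)

        finish : ∀ k′ → k ≡ suc k′ → Result H m k → Goal
        finish k′ k≡ (al , rest) = plain al , go rest
          where
          go : AtLeast (InS H) (suc (lollipop m k)) ⊎ Shape H m k → AtLeast (InS S) (suc (lollipop m (suc k))) ⊎ Shape S m (suc k)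
          go (inj₁ st) = inj₁ (strict-H st)
          -- This shape has a cycle of length `k`, against the girth, as `S` has `suc k` cut
          -- vertices.
          go (inj₂ (inj₂ (_ , _ , h , _ , L , _))) = ⊥-elim (<-irrefl refl (subst (_≤ k) k-eq (subst (card (cut S) ≤_) (Listₚ.length-applyUpTo h k) (girth _ (lolli-isCycle L)))))
          go (inj₂ (inj₁ (h , L))) with lolli-leaf L′ (m≤m+n m k′)
            where
            L′ : IsLolli H m (suc (m + k′)) h
            L′ = subst (λ s → IsLolli H m s h) (trans (cong (m +_) k≡) (+-suc m k′)) L
          ... | p , lf , _ with u ≡? h (m + k′)
          ...   | yes e = inj₂ (lift refl L e (≤-reflexive eq) (inj₂ (subst (m <_) eq (s≤s (m≤m+n m k′)) , eq)))
            where
            eq : suc (m + k′) ≡ m + k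
            eq = sym (trans (cong (m +_) k≡) (+-suc m k′))
          -- If `v` is not attached to the end of the tail, that end is a non-cut vertex off the
          -- cycle other than `u`, and the surplus is positive.
          ...   | no ne = inj₁ (strict-off al (card-pos {v = h (m + k′)} (∖-intro (─-intro (nc-intro (proj₁ lf) (leaf-conn cH lf)) (ne ∘ sym)) λ q → cs q)))
            where
            cs : ¬ (cset c ∋ h (m + k′))
            cs q = ─-≢ (cset-⊑ c (within-leaf c fH lf) _ q) refl

      noncut-result : Result H m k → Goal
      noncut-result r with k in eq
      ... | zero = subst (λ q → Result S m (suc q)) eq (finish₀ eq)
      ... | suc k′ = subst (λ q → Result S m (suc q)) eq (finish k′ eq (subst (Result H m) (sym eq) r))

    -- A leaf at a vertex that is already a cut vertex

    module Cut (u∈cut : cut H ∋ u) where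

      private
        m k : ℕ
        m = card (nc H)
        k = card (cut H)

        ncu : card (nc H ─ u) ≡ m
        ncu = card-∌ (λ p → cut-¬conn u∈cut (nc-conn p))

      m-eq : card (nc S) ≡ suc m
      m-eq = trans nc-S (cong suc ncu)

      k-eq : card (cut S) ≡ k
      k-eq = +-cancelˡ-≡ (suc m) _ _ (trans (cong (_+ card (cut S)) (sym m-eq)) (trans (card-nc-cut S) (trans card-S (cong suc (sym (card-nc-cut H))))))

      private
        Goal : Set
        Goal = Result S (suc m) k

        -- The increment of `lollipop-widen` less one, since the point `v` is supplied by
        -- `atLeast-leaf`.
        need : ℕ
        need = 2 * m + k * suc m

        bound : ∀ x y → AtLeast (InS H) (lollipop m k + x) → AtLeast (InU H u) (need + y) → AtLeast (InS S) (lollipop (suc m) k + (x + y))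
        bound x y p q = atLeast-≤ (≤-reflexive arith) (atLeast-delete p (atLeast-leaf l q))
          where
          arith : lollipop (suc m) k + (x + y) ≡ lollipop m k + x + suc (need + y)
          arith = trans (cong (_+ (x + y)) (lollipop-widen m k))
            (solve 5 (λ L m w x y → L :+ (con 2 :* m :+ con 1 :+ w) :+ (x :+ y) := L :+ x :+ (con 1 :+ (con 2 :* m :+ w :+ y))) refl (lollipop m k) m (k * suc m) x y)

        pad0 : ∀ {P N} → AtLeast P N → AtLeast P (N + 0)
        pad0 {P} = subst (AtLeast P) (sym (+-identityʳ _))

        pad1 : ∀ {P N} → AtLeast P (suc N) → AtLeast P (N + 1)
        pad1 {P} = subst (AtLeast P) (+-comm 1 _)

        unpad1 : ∀ {P N} → AtLeast P (N + 1) → AtLeast P (suc N)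
        unpad1 {P} = subst (AtLeast P) (+-comm _ 1)

      module _ (s : Split H u) (cA : Cyc) (fA : cA within Split.A s) where
        open Split s

        private
          a b′ i j f′ off : ℕ
          a = sideNoncuts u A
          b′ = sideNoncuts u B
          i = sideCuts u A
          j = sideCuts u B
          f′ = b′ ∸ 1
          off = card (offCycle cA A u)

          1≤b : 1 ≤ b′
          1≤b with removable {X = _== u} connB′ (u , mem (==-refl u) , λ t p → subst (Star _ u) (sym (==⇒≡ (is-mem p))) ε) (λ t p → subst (B ∋_) (sym (==⇒≡ (is-mem p))) u∈B)
                     (proj₁ (proj₂ b₀)) (λ p → proj₂ (proj₂ b₀) (==⇒≡ (is-mem p)))
          ... | w , w∈ , w≢ , cw = card-pos {v = w} (─-intro (nc-intro w∈ cw) (λ { refl → w≢ (mem (==-refl u)) }))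

          b-eq : b′ ≡ suc f′
          b-eq = sym (m+[n∸m]≡n 1≤b)

          m-split : m ≡ a + suc f′
          m-split = trans (noncuts-split u∈cut s) (cong (a +_) b-eq)

          k-split : k ≡ suc (i + j)
          k-split = cuts-split u∈cut s

          ij≤a : i + j ≤ a
          ij≤a = cuts≤side u∈cut s (subst (GirthAtLeast G) k-eq girth) connA cA fA

          1≤a : 1 ≤ a
          1≤a = ≤-trans (s≤s z≤n) (2≤side u connA cA fA)

          X Z : ℕ
          X = i + rootedCycle (suc a)
          Z = 2 + f′ + j + triangle f′

          need-eq : need ≡ treeNeed a i j f′ ij≤a 1≤a
          need-eq = cong₂ (λ m k → 2 * m + k * suc m) m-split k-split

          -- The side with the cycle gets the cycle bound including its surplus `off`, the other
          -- side the bound valid for every connected set.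
          product : AtLeast (InU H u) ((X + off) * Z)
          product = subst (λ z → AtLeast (InU H u) ((X + off) * z)) eq (atLeast-split s (side-rooted u connA u∈A cA fA) (rooted-bound connB′ u∈B))
            where
            eq : card B + choose2 b′ ≡ Z
            eq = trans (cong₂ (λ x y → x + choose2 y) (trans (card-side u u∈B) (cong (λ z → suc (z + j)) b-eq)) b-eq)
              (trans (cong (suc (suc f′ + j) +_) (sym (triangle-choose2 f′))) (solve 3 (λ f j t → con 1 :+ (con 1 :+ f :+ j) :+ t := con 2 :+ f :+ j :+ t) refl f′ j (triangle f′)))

          rooted-≥ : AtLeast (InU H u) need
          rooted-≥ = atLeast-≤ (≤-trans (≤-reflexive need-eq) (≤-trans (treeSide-≥ a i j f′ ij≤a 1≤a) (*-monoˡ-≤ Z (m≤m+n X off)))) product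

          rooted-> : suc (treeNeed a i j f′ ij≤a 1≤a) ≤ (X + off) * Z → AtLeast (InU H u) (suc need)
          rooted-> le = atLeast-≤ (≤-trans (≤-reflexive (cong suc need-eq)) le) product

          off-strict : 1 ≤ off → AtLeast (InU H u) (suc need)
          off-strict le = rooted-> (begin
            suc (treeNeed a i j f′ ij≤a 1≤a)      ≤⟨ s≤s (treeSide-≥ a i j f′ ij≤a 1≤a) ⟩
            suc (X * Z)                           ≤⟨ +-monoˡ-≤ (X * Z) (s≤s (z≤n {suc (f′ + j + triangle f′)})) ⟩
            Z + X * Z                             ≤⟨ *-monoˡ-≤ Z (≤-trans (≤-reflexive (+-comm 1 X)) (+-monoʳ-≤ X le)) ⟩
            (X + off) * Z                         ∎)
            where open ≤-Reasoning

          -- Here `B` is a single edge `uw`, and `m = k` rules out the second shape for `H`, so `H`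
          -- is a lollipop. If `w` ends its tail, `v` doubles that leaf. Otherwise the end of the
          -- tail is a non-cut vertex of `A` off the cycle, and the surplus makes the bound strict.
          extremal : f′ ≡ 0 → j ≡ 0 → i ≡ a → AtLeast (InS H) (lollipop m k) → Shape H m k → AtLeast (InS S) (suc (lollipop (suc m) k)) ⊎ Shape S (suc m) k
          extremal f≡ j≡ i≡ al sh = go sh
            where
            k≡ : k ≡ suc a
            k≡ = trans k-split (cong suc (trans (cong₂ _+_ i≡ j≡) (+-identityʳ a)))
            m≡ : m ≡ k
            m≡ = trans m-split (trans (cong (λ z → a + suc z) f≡) (trans (+-comm a 1) (sym k≡)))
            w : Fin n
            w = proj₁ b₀
            w∈ : B ─ u ∋ w
            w∈ = ─-intro (proj₁ (proj₂ b₀)) (proj₂ (proj₂ b₀))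
            B-single : ∀ {t} → B ∋ t → t ≡ u ⊎ t ≡ w
            B-single {t} t∈ with t ≡? u | t ≡? w
            ... | yes e | _ = inj₁ e
            ... | no _ | yes e = inj₂ e
            ... | no ne | no ne′ = ⊥-elim (<-irrefl refl (≤-trans (card-pos {S = B ─ u ─ w} (─-intro (─-intro t∈ ne) ne′)) (≤-reflexive zero-card)))
              where
              zero-card : card (B ─ u ─ w) ≡ 0
              zero-card = suc-injective (trans (sym (card-─ w∈)) (suc-injective (trans (sym (card-─ u∈B)) (trans (card-side u u∈B) (cong₂ (λ x y → suc (x + y)) (trans b-eq (cong suc f≡)) j≡)))))
            wu : Adj w u
            wu with neighbour connB′ (─-⊑ w∈) u∈B (─-≢ w∈ ∘ sym)
            ... | y , y∈ , ad with B-single y∈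
            ...   | inj₁ refl = ad
            ...   | inj₂ refl = ⊥-elim (Adj-≢ ad refl)
            1<k : 1 < k
            1<k = subst (1 <_) (sym k≡) (s≤s 1≤a)
            go : Shape H m k → AtLeast (InS S) (suc (lollipop (suc m) k)) ⊎ Shape S (suc m) k
            go (inj₂ (m≡′ , _)) = ⊥-elim (1+n≢n (trans (sym m≡′) m≡))
            go (inj₁ (h , L)) = last (k ∸ 1) (sym (m+[n∸m]≡n (<⇒≤ 1<k)))
              where
              last : ∀ k′ → k ≡ suc k′ → AtLeast (InS S) (suc (lollipop (suc m) k)) ⊎ Shape S (suc m) k
              last k′ kk with lolli-leaf (subst (λ s → IsLolli H m s h) (trans (cong (m +_) kk) (+-suc m k′)) L) (m≤m+n m k′)
              ... | p , lf , hangs with w ≡? h (m + k′)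
              ...   | yes refl = inj₂ (inj₂ (cong suc m≡ , v , h , p , subst₂ (λ x y → IsLolli H x y h) m≡ (cong (_+ k) m≡) L ,
                        subst (Leaf S v) (proj₂ (proj₂ (proj₂ lf)) u∈H wu) l , two hangs))
                where
                -- With more than one tail vertex the end hangs on another tail vertex, whose label
                -- is `2k − 2` because `m = k`.
                two : Hangs m p (m + k′) → suc (suc p) ≡ k + k
                two (inj₁ (e , _)) = ⊥-elim (<-irrefl (sym (trans kk (cong suc (+-cancelˡ-≡ m k′ 0 (trans e (sym (+-identityʳ m))))))) 1<k)
                two (inj₂ (_ , e)) = trans (cong suc e) (trans (sym (+-suc m k′)) (cong₂ _+_ m≡ (sym kk)))
              ...   | no ne = inj₁ (unpad1 (bound 0 1 (pad0 al) (pad1 (off-strict (card-pos {v = h (m + k′)} (∖-intro e-nc (λ q → ─-≢ (cset-⊑ cA (within-leaf cA (λ t → A⊑ _ (fA t)) lf) _ q) refl)))))))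
                where
                e∈nc : nc H ∋ h (m + k′)
                e∈nc = nc-intro (proj₁ lf) (leaf-conn cH lf)
                e≢u : h (m + k′) ≢ u
                e≢u e = cut-¬conn u∈cut (nc-conn (subst (nc H ∋_) e e∈nc))
                e∈A : A ∋ h (m + k′)
                e∈A with cover _ (proj₁ lf)
                ... | inj₁ q = q
                ... | inj₂ q with B-single q
                ...   | inj₁ e = ⊥-elim (e≢u e)
                ...   | inj₂ e = ⊥-elim (ne (sym e))
                e-nc : nc A ─ u ∋ h (m + k′)
                e-nc = split-nc⁻ s (─-intro e∈nc e≢u) e∈A

        side-result : Result H m k → Goal
        side-result (al , rest) = subst (AtLeast (InS S)) (+-identityʳ _) (bound 0 0 (pad0 al) (pad0 rooted-≥)) , go rest (treeSide-> a i j f′ ij≤a 1≤a)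
          where
          go : AtLeast (InS H) (suc (lollipop m k)) ⊎ Shape H m k → suc (treeNeed a i j f′ ij≤a 1≤a) ≤ treeSide a i j f′ ij≤a 1≤a ⊎ (f′ ≡ 0 × j ≡ 0 × i ≡ a) →
            AtLeast (InS S) (suc (lollipop (suc m) k)) ⊎ Shape S (suc m) k
          go (inj₁ st) _ = inj₁ (unpad1 (bound 1 0 (pad1 st) (pad0 rooted-≥)))
          go (inj₂ _) (inj₁ le) = inj₁ (unpad1 (bound 0 1 (pad0 al) (pad1 (rooted-> (≤-trans le (*-monoˡ-≤ Z (m≤m+n X off)))))))
          go (inj₂ sh) (inj₂ (p , q , r)) = extremal p q r al sh

      cut-result : Result H m k → Goal
      cut-result r with split-at cH u∈cut b∈ b≢u
      ... | s with split-cycle s c fH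
      ...   | inj₁ (cA , fA) = side-result s cA fA r
      ...   | inj₂ (cB , fB) = side-result (swap s) cB fB r

    -- On passing to `H` the number of cut vertices drops by one or stays, so the girth hypothesis
    -- is inherited.
    leaf-result : (GirthAtLeast G (card (cut H)) → Result H (card (nc H)) (card (cut H))) → Result S (card (nc S)) (card (cut S))
    leaf-result rec with conn? (H ─ u)
    ... | yes p = subst₂ (Result S) (sym m-eq) (sym k-eq) (noncut-result (rec (λ c q → ≤-trans (n≤1+n _) (subst (_≤ length c) k-eq (girth c q)))))
      where open Noncut (nc-intro u∈H p)
    ... | no p = subst₂ (Result S) (sym m-eq) (sym k-eq) (cut-result (rec (λ c q → subst (_≤ length c) k-eq (girth c q))))
      where open Cut (cut-intro u∈H p)

  split-leaf : ∀ {S u v w} (s : Split S u) → v ≢ u → Leaf (Split.A s) v w → Leaf S v w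
  split-leaf {S} {u} {v} {w} s v≢u (v∈ , w∈ , a , only) = A⊑ _ v∈ , A⊑ _ w∈ , a , only′
    where
    open Split s
    only′ : ∀ {y} → S ∋ y → Adj v y → y ≡ w
    only′ {y} y∈ e with cover y y∈
    ... | inj₁ p = only p e
    ... | inj₂ p with nocross v∈ p e
    ...   | inj₁ r = ⊥-elim (v≢u r)
    ...   | inj₂ refl = only u∈A e

  two-cycles-result : ∀ {S x} → cut S ∋ x → GirthAtLeast G (card (cut S)) → (s : Split S x) →
    ∀ cA → cA within Split.A s → ∀ cB → cB within Split.B s → AtLeast (InS S) (suc (lollipop (card (nc S)) (card (cut S))))
  two-cycles-result {S} {x} x∈ girth s cA fA cB fB = atLeast-≤ (≤-trans (≤-reflexive (cong₂ (λ m k → suc (lollipop m k)) (noncuts-split x∈ s) (cuts-split x∈ s)))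
        (twoCycles (sideCuts x A) (sideCuts x B) (2≤side x connA cA fA) (2≤side x connB′ cB fB) (cuts≤side x∈ s girth connA cA fA) (cuts≤side x∈ s girth connB′ cB fB)))
      (atLeast-mono proj₁ (atLeast-split s (rooted connA u∈A cA fA) (rooted connB′ u∈B cB fB)))
    where
    open Split s
    rooted : ∀ {D} → ConnV D → D ∋ x → ∀ c → c within D → AtLeast (InU D x) (sideCuts x D + rootedCycle (suc (sideNoncuts x D)))
    rooted {D} cD x∈ c f = atLeast-≤ (m≤m+n (sideCuts x D + rootedCycle (suc (sideNoncuts x D))) _) (side-rooted x cD x∈ c f)

  minimum : ∀ {S} → ConnV S → ∀ c → c within S → GirthAtLeast G (card (cut S)) → Result S (card (nc S)) (card (cut S))
  minimum {S} cS c f girth = go (card S) S refl cS c f girth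
    where
    go : ∀ d S → card S ≡ d → ConnV S → ∀ c → c within S → GirthAtLeast G (card (cut S)) → Result S (card (nc S)) (card (cut S))
    go zero S eq cS c f girth = ⊥-elim (<-irrefl refl (subst (1 ≤_) eq (card-pos (f 0))))
    go (suc d) S eq cS c f girth = cases (⊑? (cut S) (λ _ → false))
      where
      leaf : ∀ {v u} → Leaf S v u → Result S (card (nc S)) (card (cut S))
      leaf l = LeafCase.leaf-result cS l c f girth (go d _ (suc-injective (trans (sym (card-─ (proj₁ l))) eq)) (leaf-conn cS l) c (within-leaf c f l))
      cases : (∃ λ x → cut S ∋ x × _) ⊎ cut S ⊑ (λ _ → false) → Result S (card (nc S)) (card (cut S))
      cases (inj₂ none) = subst (Result S (card (nc S))) (sym k≡0) (result₀ c cS f k≡0)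
        where
        k≡0 : card (cut S) ≡ 0
        k≡0 = n≤0⇒n≡0 (card≤length {S = cut S} {xs = []} (λ i p → case (none i p)))
          where
          case : ∀ {i} → (λ _ → false) ∋ i → i ∈ []
          case (mem ())
      cases (inj₁ (x , x∈ , _)) with avoiding c f x
      ... | b , b∈ , b≢x with split-at cS x∈ b∈ b≢x
      ...   | s with find-leaf (Split.connA s) (Split.u∈A s) (Split.a₀ s) | find-leaf (Split.connB′ s) (Split.u∈B s) (Split.b₀ s)
      ...     | inj₁ (v , u , ne , l) | _ = leaf (split-leaf s ne l)
      ...     | inj₂ _ | inj₁ (v , u , ne , l) = leaf (split-leaf (swap s) ne l)
      ...     | inj₂ (cA , fA) | inj₂ (cB , fB) = let st = two-cycles-result x∈ girth s cA fA cB fB in atLeast-≤ (n≤1+n _) st , inj₁ st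

-- Exact counts for the extremal shapes

-- alternating m lists the words 1…10…01…1 of length m: the edge sets, read around a cycle from a vertex of it, of the
-- connected subgraphs through that vertex.
ascending alternating : ℕ → List (List Bool)
ascending zero = [] ∷ []
ascending (suc m) = map (false ∷_) (ascending m) ++ (replicate (suc m) true ∷ [])

alternating zero = [] ∷ []
alternating (suc m) = map (true ∷_) (alternating m) ++ map (false ∷_) (ascending m)

length-ascending : ∀ m → length (ascending m) ≡ suc m
length-ascending zero = refl
length-ascending (suc m) = trans (Listₚ.length-++ (map (false ∷_) (ascending m))) (trans (cong (_+ 1) (trans (Listₚ.length-map (false ∷_) (ascending m)) (length-ascending m))) (+-comm (suc m) 1))

length-alternating : ∀ m → length (alternating m) ≡ rootedCycle m
length-alternating zero = refl
length-alternating (suc m) = trans (Listₚ.length-++ (map (true ∷_) (alternating m))) (trans (cong₂ _+_ (trans (Listₚ.length-map (true ∷_) (alternating m)) (length-alternating m)) (trans (Listₚ.length-map (false ∷_) (ascending m)) (length-ascending m)))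
  (cong suc (+-comm (triangle m) (suc m))))

∈-ascending : ∀ m (g : ℕ → Bool) → (∀ {p q} → p < q → q < m → g p ≡ true → g q ≡ true) → applyUpTo g m ∈ ascending m
∈-ascending zero g h = here refl
∈-ascending (suc m) g h with g 0 in eq
... | false = ∈-++⁺ˡ (∈-map⁺ (false ∷_) (∈-ascending m (g ∘ suc) (λ p q → h (s≤s p) (s≤s q))))
... | true = ∈-++⁺ʳ (map (false ∷_) (ascending m)) (here (cong (true ∷_) (all-true m (g ∘ suc) (λ q → h (s≤s z≤n) (s≤s q) eq))))
  where
  all-true : ∀ m (g : ℕ → Bool) → (∀ {q} → q < m → g q ≡ true) → applyUpTo g m ≡ replicate m true
  all-true zero g h = refl
  all-true (suc m) g h = cong₂ _∷_ (h (s≤s z≤n)) (all-true m (g ∘ suc) (λ q → h (s≤s q)))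

∈-alternating : ∀ m (g : ℕ → Bool) → (∀ {i p q} → i < p → p < q → q < m → g i ≡ false → g p ≡ true → g q ≡ true) → applyUpTo g m ∈ alternating m
∈-alternating zero g h = here refl
∈-alternating (suc m) g h with g 0 in eq
... | true = ∈-++⁺ˡ (∈-map⁺ (true ∷_) (∈-alternating m (g ∘ suc) (λ a b c → h (s≤s a) (s≤s b) (s≤s c))))
... | false = ∈-++⁺ʳ (map (true ∷_) (alternating m)) (∈-map⁺ (false ∷_) (∈-ascending m (g ∘ suc) (λ p q → h (s≤s z≤n) (s≤s p) (s≤s q) eq)))

applyUpTo-inj : ∀ {A : Set} m {g h : ℕ → A} → applyUpTo g m ≡ applyUpTo h m → ∀ {i} → i < m → g i ≡ h i
applyUpTo-inj (suc m) e {zero} _ = Listₚ.∷-injectiveˡ e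
applyUpTo-inj (suc m) e {suc i} (s≤s lt) = applyUpTo-inj m (Listₚ.∷-injectiveʳ e) lt

module Exact {n : ℕ} (G : Graph n) where
  open Cuts G
  open Cycles G
  open Subgraphs G
  open Rooted G
  open Recursion G
  open Shapes G

  private
    Segment : VSet n → (ℕ → Fin n) → ℕ → Set
    Segment P h j = (∀ {a} → a < j → P ∋ h a) × (∀ {v} → P ∋ v → ∃ λ a → a < j × h a ≡ v)

    segment-delete : ∀ {P h j} → (∀ {a b} → a < suc j → b < suc j → h a ≡ h b → a ≡ b) → Segment P h (suc j) → Segment (P ─ h j) h j
    segment-delete {P} {h} {j} inj (f , g) = (λ lt → ─-intro (f (m≤n⇒m≤1+n lt)) (λ e → <-irrefl (inj (m≤n⇒m≤1+n lt) ≤-refl e) lt)) , back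
      where
      back : ∀ {v} → P ─ h j ∋ v → ∃ λ a → a < j × h a ≡ v
      back p with g (─-⊑ p)
      ... | a , a< , e with <suc-elim a<
      ...   | inj₁ lt = a , lt , e
      ...   | inj₂ refl = ⊥-elim (─-≢ p (sym e))

    empty-bound : ∀ {P} → (∀ {v} → ¬ (P ∋ v)) → AtMost (InS P) 0
    empty-bound none ([] , _ , _ , z≤n) = z≤n
    empty-bound none (T ∷ _ , t ∷ _ , _) = ⊥-elim (none (V⊑ t _ (root∈ t)))

    point-bound : ∀ {P v} → (∀ {w} → P ∋ w → w ≡ v) → AtMost (InU P v) 1
    point-bound {P} {v} only = atMost-code {B = Bool} (λ _ → true) (true ∷ []) (λ _ → here refl) (λ {T} {T′} t t′ _ → same {T} {T′} t t′)
      where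
      noedge : ∀ {T} → InU P v T → ∀ {i j} → ¬ Edge T i j
      noedge (t , _) p = Adj-≢ (E-adj t p) (trans (only (V⊑ t _ (E-V t p))) (sym (only (V⊑ t _ (E-V t (E-sym t p))))))
      vs : ∀ {T T′} → InU P v T → InU P v T′ → V T ⊑ V T′
      vs {T} {T′} (t , _) (_ , v∈) i p = subst (V T′ ∋_) (sym (only (V⊑ t i p))) v∈
      same : ∀ {T T′} → InU P v T → InU P v T′ → T ≐ T′
      same {T} {T′} t t′ = ≐-intro (vs {T} {T′} t t′) (vs {T′} {T} t′ t) (λ p → ⊥-elim (noedge t p)) (λ p → ⊥-elim (noedge t′ p))

    -- The count rooted at the end `h j` is proved along with the total, since that end is the leaf
    -- deleted in the induction.
    path-bound : ∀ j {P h} → (∀ {a b} → a < suc j → b < suc j → h a ≡ h b → a ≡ b) → (∀ {a} → suc a < suc j → Adj (h (suc a)) (h a)) →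
      (∀ {a b} → a < suc j → b < suc j → Adj (h a) (h b) → a ≡ suc b ⊎ b ≡ suc a) → Segment P h (suc j) →
      AtMost (InS P) (triangle (suc j)) × AtMost (InU P (h j)) (suc j)
    path-bound zero {P} {h} inj st only seg@(f , g) = (λ {M} → atMost-delete {v = h 0} (empty-bound λ p → none (proj₂ (segment-delete inj seg) p)) rooted {M}) , rooted
      where
      none : ∀ {v} → ¬ (∃ λ a → a < 0 × h a ≡ v)
      none (_ , () , _)
      one : ∀ {w} → (∃ λ a → a < 1 × h a ≡ w) → w ≡ h 0
      one (zero , _ , e) = sym e
      one (suc _ , s≤s () , _)
      rooted : AtMost (InU P (h 0)) 1
      rooted = point-bound (λ p → one (g p))
    path-bound (suc j) {P} {h} inj st only seg@(f , g) with path-bound j {P ─ h (suc j)} {h} (λ a b → inj (m≤n⇒m≤1+n a) (m≤n⇒m≤1+n b)) (λ a → st (m≤n⇒m≤1+n a))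
        (λ a b → only (m≤n⇒m≤1+n a) (m≤n⇒m≤1+n b)) (segment-delete inj seg)
    ... | total , end = (λ {M} → atMost-delete {v = h (suc j)} total rooted {M}) , rooted
      where
      lf : Leaf P (h (suc j)) (h j)
      lf = f ≤-refl , f (n≤1+n (suc j)) , st ≤-refl , λ y∈ a → uniq (g y∈) a
        where
        uniq : ∀ {y} → (∃ λ a → a < suc (suc j) × h a ≡ y) → Adj (h (suc j)) y → y ≡ h j
        uniq (a , a< , refl) e with only ≤-refl a< e
        ... | inj₁ eq = cong h (sym (suc-injective eq))
        ... | inj₂ refl = ⊥-elim (<-irrefl refl a<)
      rooted : AtMost (InU P (h (suc j))) (suc (suc j))
      rooted = subst (AtMost (InU P (h (suc j)))) (+-comm (suc j) 1) (atMost-leaf lf end)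

  module _ {S : VSet n} {m : ℕ} {h : ℕ → Fin n} (L : IsLolli S m m h) where

    private
      l′ l : ℕ
      l′ = m ∸ 2
      l = suc l′
      m≡ : m ≡ suc l
      m≡ = sym (m+[n∸m]≡n (≤-trans (n≤1+n 2) (3≤m L)))

      0<m : 0 < m
      0<m = ≤-trans (s≤s z≤n) (3≤m L)

      next : ℕ → ℕ
      next i with suc i ℕ.≟ m
      ... | yes _ = 0
      ... | no _ = suc i

      next-last : ∀ {i} → suc i ≡ m → next i ≡ 0
      next-last {i} e with suc i ℕ.≟ m
      ... | yes _ = refl
      ... | no ne = ⊥-elim (ne e)

      next-suc : ∀ {i} → suc i < m → next i ≡ suc i
      next-suc {i} lt with suc i ℕ.≟ m
      ... | yes e = ⊥-elim (<-irrefl e lt)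
      ... | no _ = refl

      LEdge⇒next : ∀ {a b} → b < m → LEdge m a b → b ≡ next a
      LEdge⇒next b< (inj₁ (refl , _)) = sym (next-suc b<)
      LEdge⇒next b< (inj₂ (inj₁ (_ , refl))) = ⊥-elim (<-irrefl refl b<)
      LEdge⇒next b< (inj₂ (inj₂ (e , refl))) = sym (next-last e)

      bit : Sub n → ℕ → Bool
      bit T i = E T (h i) (h (next i))

      code : Sub n → List Bool
      code T = applyUpTo (bit T) m

      -- A missing edge i and a missing edge q cut the vertices i+1, …, q off from the root h 0.
      gap : ∀ {T} → InU S (h 0) T → ∀ {i p q} → i < p → p < q → q < m → bit T i ≡ false → bit T p ≡ true → bit T q ≡ true
      gap {T} (t , r∈) {i} {p} {q} i<p p<q q<m bi bp with bit T q in bq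
      ... | true = refl
      ... | false = ⊥-elim (contra (inv (0 , 0<m , refl , inj₁ z≤n) (walk-any t r∈ (E-V t bp))))
        where
        Good : Fin n → Set
        Good v = ∃ λ a → a < m × h a ≡ v × (a ≤ i ⊎ q < a)
        forward : ∀ {a} → a < m → (a ≤ i ⊎ q < a) → bit T a ≡ true → Good (h (next a))
        forward {a} a< g e with m≤n⇒m<n∨m≡n a<
        ... | inj₂ eq = 0 , 0<m , cong h (sym (next-last eq)) , inj₁ z≤n
        ... | inj₁ lt = suc a , lt , cong h (sym (next-suc lt)) , side g
          where
          side : a ≤ i ⊎ q < a → suc a ≤ i ⊎ q < suc a
          side (inj₂ g) = inj₂ (m≤n⇒m≤1+n g)
          side (inj₁ g) with m≤n⇒m<n∨m≡n g
          ... | inj₁ lt = inj₁ lt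
          ... | inj₂ refl = ⊥-elim (true≢false e bi)
        backward : ∀ {a b} → a < m → b < m → (a ≤ i ⊎ q < a) → LEdge m b a → bit T b ≡ true → Good (h b)
        backward {a} {b} a< b< g ed e = b , b< , refl , side ed g
          where
          ¬q : b ≢ q
          ¬q refl = true≢false e bq
          side : LEdge m b a → a ≤ i ⊎ q < a → b ≤ i ⊎ q < b
          side (inj₁ (refl , _)) (inj₁ g) = inj₁ (≤-trans (n≤1+n b) g)
          side (inj₁ (refl , _)) (inj₂ (s≤s g)) = inj₂ (≤∧≢⇒< g (¬q ∘ sym))
          side (inj₂ (inj₁ (_ , refl))) _ = ⊥-elim (<-irrefl refl a<)
          side (inj₂ (inj₂ (eq , refl))) _ = inj₂ (≤∧≢⇒< (≤-pred (subst (q <_) (sym eq) q<m)) (¬q ∘ sym))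
        one : ∀ {x y} → Good x → Edge T x y → Good y
        one (a , a< , refl , g) e with onto L (V⊑ t _ (E-V t (E-sym t e)))
        ... | b , b< , refl with adj⇒ L a< b< (E-adj t e)
        ...   | inj₁ ed with LEdge⇒next b< ed
        ...     | refl = forward a< g e
        one (a , a< , refl , g) e | b , b< , refl | inj₂ ed with LEdge⇒next a< ed
        ...     | refl = backward a< b< g ed (E-sym t e)
        inv : ∀ {x y} → Good x → Star (Edge T) x y → Good y
        inv g ε = g
        inv g (e ◅ w) = inv (one g e) w
        contra : ¬ Good (h p)
        contra (a , a< , e , g) with h-inj L a< (<-trans p<q q<m) e
        contra (a , a< , e , inj₁ le) | refl = <⇒≱ i<p le
        contra (a , a< , e , inj₂ lt) | refl = <-asym p<q lt

      -- The vertices of a connected subgraph through `h 0` are those reached from it by its edges,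
      -- so the bits determine them too.
      code-inj : ∀ {T T′} → InU S (h 0) T → InU S (h 0) T′ → code T ≡ code T′ → T ≐ T′
      code-inj {T} {T′} t t′ e = ≐-intro (vs {T} {T′} t t′ e) (vs {T′} {T} t′ t (sym e)) (es {T} {T′} t t′ e) (es {T′} {T} t′ t (sym e))
        where
        es : ∀ {T T′} → InU S (h 0) T → InU S (h 0) T′ → code T ≡ code T′ → ∀ {i j} → Edge T i j → Edge T′ i j
        es {T} {T′} (t , _) (t′ , _) e p with onto L (V⊑ t _ (E-V t p)) | onto L (V⊑ t _ (E-V t (E-sym t p)))
        ... | a , a< , refl | b , b< , refl with adj⇒ L a< b< (E-adj t p)
        ...   | inj₁ ed with LEdge⇒next b< ed
        ...     | refl = trans (sym (applyUpTo-inj m e a<)) p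
        es {T} {T′} (t , _) (t′ , _) e p | a , a< , refl | b , b< , refl | inj₂ ed with LEdge⇒next a< ed
        ...     | refl = E-sym t′ (trans (sym (applyUpTo-inj m e b<)) (E-sym t p))
        vs : ∀ {T T′} → InU S (h 0) T → InU S (h 0) T′ → code T ≡ code T′ → V T ⊑ V T′
        vs {T} {T′} T∈@(t , r∈) T′∈@(t′ , r∈′) e i p = reached r∈′ (walk-any t r∈ p)
          where
          reached : ∀ {x y} → V T′ ∋ x → Star (Edge T) x y → V T′ ∋ y
          reached q ε = q
          reached q (ed ◅ w) = reached (E-V t′ (E-sym t′ (es {T} {T′} T∈ T′∈ e ed))) w

    rootedCycle-atMost : AtMost (InU S (h 0)) (rootedCycle m)
    rootedCycle-atMost = subst (AtMost (InU S (h 0))) (length-alternating m) (atMost-code code (alternating m) (λ {T} t → ∈-alternating m (bit T) (gap t)) code-inj)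

    -- Without `h 0` the cycle is a path on `l = m − 1` vertices, and the two triangular numbers add
    -- up to `m * m`.
    cycle-atMost : AtMost (InS S) (lollipop m 0)
    cycle-atMost = subst (AtMost (InS S)) arith (λ {M} → atMost-delete {v = h 0} (proj₁ (path-bound l′ {S ─ h 0} {h ∘ suc}
        (λ a b e → suc-injective (h-inj L (up a) (up b) e))
        (λ a → Adj-sym (adj⇐ L (up (<-trans ≤-refl a)) (up a) (inj₁ (inj₁ (refl , inj₁ (up a))))))
        (λ a b e → only a b (adj⇒ L (up a) (up b) e))
        ((λ a → ─-intro (into L (up a)) (λ e → 1+n≢0 (h-inj L (up a) 0<m e))) , back))) rootedCycle-atMost {M})
      where
      up : ∀ {a} → a < l → suc a < m
      up lt = subst (_ <_) (sym m≡) (s≤s lt)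
      arith : rootedCycle m + triangle l ≡ lollipop m 0
      arith rewrite m≡ = trans (cong suc (triangle-square l)) (solve 1 (λ q → con 1 :+ q := q :+ con 1 :+ con 0 :+ con 0) refl (suc l * suc l))
      oneway : ∀ {a b} → a < l → b < l → LEdge m (suc a) (suc b) → b ≡ suc a
      oneway a b (inj₁ (e , _)) = sym (suc-injective e)
      oneway a b (inj₂ (inj₁ (() , _)))
      oneway a b (inj₂ (inj₂ (_ , ())))
      only : ∀ {a b} → a < l → b < l → LAdj m (suc a) (suc b) → a ≡ suc b ⊎ b ≡ suc a
      only a b (inj₁ e) = inj₂ (oneway a b e)
      only a b (inj₂ e) = inj₁ (oneway b a e)
      back : ∀ {v} → S ─ h 0 ∋ v → ∃ λ a → a < l × h (suc a) ≡ v
      back p with onto L (─-⊑ p)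
      ... | zero , _ , e = ⊥-elim (─-≢ p (sym e))
      ... | suc a , a< , e = a , ≤-pred (subst (suc a <_) m≡ a<) , e

    private
      conn-cycle : ConnV S
      conn-cycle = h 0 , into L 0<m , λ v p → let (a , a< , e) = onto L p in subst (Walk S (h 0)) e (go a a<)
        where
        go : ∀ a → a < m → Walk S (h 0) (h a)
        go zero _ = ε
        go (suc a) lt = go a (<-trans ≤-refl lt) ◅◅ ((into L (<-trans ≤-refl lt) , into L lt , adj⇐ L (<-trans ≤-refl lt) lt (inj₁ (inj₁ (refl , inj₁ lt)))) ◅ ε)

      card≤m : card S ≤ m
      card≤m = subst (card S ≤_) (Listₚ.length-applyUpTo h m) (card≤length (λ v p → let (a , a< , e) = onto L p in subst (_∈ applyUpTo h m) e (∈-applyUpTo⁺ h a<)))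

      cyc : ∃ λ c → len c ≡ m × c within S
      cyc with isCycle⇒cyc {h 0} {applyUpTo (h ∘ suc) l} (subst (λ z → IsCycle G (applyUpTo h z)) m≡ (lolli-isCycle L))
      ... | c , len≡ , f = c , trans len≡ (trans (cong suc (Listₚ.length-applyUpTo (h ∘ suc) l)) (sym m≡)) , f mem′
        where
        mem′ : ∀ {x} → x ∈ applyUpTo h (suc l) → S ∋ x
        mem′ q with ∈-applyUpTo⁻ h q
        ... | a , a< , refl = into L (subst (a <_) (sym m≡) a<)

      c₀ : Cyc
      c₀ = proj₁ cyc
      len₀ : len c₀ ≡ m
      len₀ = proj₁ (proj₂ cyc)
      f₀ : c₀ within S
      f₀ = proj₂ (proj₂ cyc)

      card≡ : card S ≡ m
      card≡ = ≤-antisym card≤m (subst (_≤ card S) len₀ (len≤card c₀ f₀))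

      -- A cycle of length `m` forces at least `m` non-cut vertices, and `S` has no more vertices
      -- than that.
      all-nc : S ⊑ nc S
      all-nc i p with ∋? (nc S) i
      ... | yes q = q
      ... | no q = ⊥-elim (<-irrefl refl (≤-trans (s≤s (subst (_≤ card (nc S)) len₀ (len≤nc c₀ conn-cycle f₀)))
              (≤-trans (s≤s (card-mono {S = nc S} {S ─ i} (λ j r → ─-intro (nc-∈ r) (λ { refl → q r })))) (≤-trans (≤-reflexive (sym (card-─ p))) card≤m))))

    cycle-atLeast : AtLeast (InS S) (lollipop m 0)
    cycle-atLeast = subst (λ z → AtLeast (InS S) (lollipop z 0)) card≡ (proj₁ (two-connected c₀ conn-cycle f₀ all-nc))

    rootedCycle-atLeast : AtLeast (InU S (h 0)) (rootedCycle m)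
    rootedCycle-atLeast = atLeast-≤ (≤-trans (≤-reflexive eq) (m≤m+n _ (card (offCycle c₀ S (h 0))))) (rooted-cycle c₀ conn-cycle (into L 0<m) f₀)
      where
      ncl : card (nc S ─ h 0) ≡ l
      ncl = trans (card-cong (λ i p → ─-intro (nc-∈ (─-⊑ p)) (─-≢ p)) (λ i p → ─-intro (all-nc i (─-⊑ p)) (─-≢ p))) (suc-injective (trans (sym (card-─ (into L 0<m))) (trans card≡ m≡)))
      eq : rootedCycle m ≡ card S + suc (triangle (card (nc S ─ h 0)))
      eq = trans (cong rootedCycle m≡) (trans (cong suc (sym (+-suc l (triangle l)))) (cong₂ (λ x y → x + suc (triangle y)) (sym (trans card≡ m≡)) (sym ncl)))

  lolli-shrink : ∀ {S m s h} → m ≤ s → IsLolli S m (suc s) h → IsLolli (S ─ h s) m s h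
  lolli-shrink {S} {m} {s} {h} le L = record
    { 3≤m = 3≤m L ; m≤s = le ; into = proj₁ seg ; onto = proj₂ seg ; h-inj = λ a b → h-inj L (up a) (up b)
    ; adj⇒ = λ a b → adj⇒ L (up a) (up b) ; adj⇐ = λ a b → adj⇐ L (up a) (up b) }
    where
    up : ∀ {a} → a < s → a < suc s
    up = m≤n⇒m≤1+n
    seg : Segment (S ─ h s) h s
    seg = segment-delete (h-inj L) (into L , onto L)

  -- The count rooted at the free end of the tail is carried along, because the next tail vertex is
  -- a leaf hanging there.
  lolli-atMost : ∀ k {S m s h} → s ≡ m + k → IsLolli S m s h → AtMost (InS S) (lollipop m k) × (∀ {p} → Hangs m p s → AtMost (InU S (h p)) (k + rootedCycle m))
  lolli-atMost zero {S} {m} {h = h} refl L = (λ {M} → cycle-atMost L₀ {M}) , rooted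
    where
    L₀ : IsLolli S m m h
    L₀ = subst (λ s → IsLolli S m s h) (+-identityʳ m) L
    rooted : ∀ {p} → Hangs m p (m + 0) → AtMost (InU S (h p)) (rootedCycle m)
    rooted (inj₁ (_ , refl)) = rootedCycle-atMost L₀
    rooted (inj₂ (lt , _)) = ⊥-elim (<-irrefl (sym (+-identityʳ m)) lt)
  lolli-atMost (suc k) {S} {m} {h = h} refl L = (λ {M} → subst (AtMost (InS S)) arith (λ {M} → atMost-delete {v = h (m + k)} (proj₁ rec) end {M}) {M}) , rooted
    where
    L′ : IsLolli S m (suc (m + k)) h
    L′ = subst (λ s → IsLolli S m s h) (+-suc m k) L
    rec = lolli-atMost k refl (lolli-shrink (m≤m+n m k) L′)
    lf = lolli-leaf L′ (m≤m+n m k)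
    end : AtMost (InU S (h (m + k))) (suc k + rootedCycle m)
    end = subst (AtMost (InU S (h (m + k)))) (+-comm (k + rootedCycle m) 1) (atMost-leaf (proj₁ (proj₂ lf)) (proj₂ rec (proj₂ (proj₂ lf))))
    arith : suc k + rootedCycle m + lollipop m k ≡ lollipop m (suc k)
    arith = trans (+-comm _ (lollipop m k)) (sym (lollipop-suc m k))
    rooted : ∀ {p} → Hangs m p (m + suc k) → AtMost (InU S (h p)) (suc k + rootedCycle m)
    rooted {p} hg with hangs-unique {m} {p} {m + k} hg (inj₂ (subst (m <_) (sym (+-suc m k)) (s≤s (m≤m+n m k)) , sym (+-suc m k)))
    ... | refl = end

  -- This direction serves the converse for `Q`: an upper bound on its count must be compared with
  -- `F` of the lollipop itself.
  lolli-atLeast : ∀ k {S m s h} → s ≡ m + k → IsLolli S m s h → AtLeast (InS S) (lollipop m k) × (∀ {p} → Hangs m p s → AtLeast (InU S (h p)) (k + rootedCycle m))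
  lolli-atLeast zero {S} {m} {h = h} refl L = cycle-atLeast L₀ , rooted
    where
    L₀ : IsLolli S m m h
    L₀ = subst (λ s → IsLolli S m s h) (+-identityʳ m) L
    rooted : ∀ {p} → Hangs m p (m + 0) → AtLeast (InU S (h p)) (rootedCycle m)
    rooted (inj₁ (_ , refl)) = rootedCycle-atLeast L₀
    rooted (inj₂ (lt , _)) = ⊥-elim (<-irrefl (sym (+-identityʳ m)) lt)
  lolli-atLeast (suc k) {S} {m} {h = h} refl L = subst (AtLeast (InS S)) (sym (lollipop-suc m k)) (atLeast-delete (proj₁ rec) end) , rooted
    where
    L′ : IsLolli S m (suc (m + k)) h
    L′ = subst (λ s → IsLolli S m s h) (+-suc m k) L
    rec = lolli-atLeast k refl (lolli-shrink (m≤m+n m k) L′)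
    lf = lolli-leaf L′ (m≤m+n m k)
    end : AtLeast (InU S (h (m + k))) (suc k + rootedCycle m)
    end = atLeast-leaf (proj₁ (proj₂ lf)) (proj₂ rec (proj₂ (proj₂ lf)))
    rooted : ∀ {p} → Hangs m p (m + suc k) → AtLeast (InU S (h p)) (suc k + rootedCycle m)
    rooted {p} hg with hangs-unique {m} {p} {m + k} hg (inj₂ (subst (m <_) (sym (+-suc m k)) (s≤s (m≤m+n m k)) , sym (+-suc m k)))
    ... | refl = end

  -- After the deletion of `v` a lollipop with tail length `k` remains. Subgraphs through `v` are
  -- the point and those extending a subgraph through `h p`; the latter number is twice the count
  -- rooted at the tail end of the lollipop with one tail vertex fewer.
  Q-atMost : ∀ {S k} → IsQ S k → AtMost (InS S) (lollipop (suc k) k)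
  Q-atMost {S} {zero} (v , h , p , L , _) with 3≤m L
  ... | ()
  Q-atMost {S} {suc k′} (v , h , p , L , lf , eq) = subst (AtMost (InS S)) arith (λ {M} → atMost-delete {v = v} (proj₁ (lolli-atMost k refl L)) (atMost-leaf lf rooted) {M})
    where
    k : ℕ
    k = suc k′
    eqs : k + k ≡ suc (k + k′)
    eqs = +-suc k k′
    L′ : IsLolli (S ─ v) k (suc (k + k′)) h
    L′ = subst (λ s → IsLolli (S ─ v) k s h) eqs L
    p-eq : suc p ≡ k + k′
    p-eq = suc-injective (trans eq eqs)
    2≤k′ : 2 ≤ k′
    2≤k′ = ≤-pred (3≤m L)
    hangs : Hangs k p (k + k′)
    hangs = inj₂ (subst (_≤ k + k′) (+-comm k 1) (+-monoʳ-≤ k (≤-trans (s≤s z≤n) 2≤k′)) , p-eq)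
    end-leaf : Leaf (S ─ v) (h (k + k′)) (h p)
    end-leaf with lolli-leaf L′ (m≤m+n k k′)
    ... | q , lf′ , hg = subst (λ z → Leaf (S ─ v) (h (k + k′)) (h z)) (hangs-unique hg hangs) lf′
    rooted : AtMost (InU (S ─ v) (h p)) ((k′ + rootedCycle k) + (k′ + rootedCycle k))
    rooted = atMost-leaf-nbr end-leaf (proj₂ (lolli-atMost k′ refl (lolli-shrink (m≤m+n k k′) L′)) hangs)
    arith : (k′ + rootedCycle k) + (k′ + rootedCycle k) + 1 + lollipop k k ≡ lollipop (suc k) k
    arith = trans (solve 3 (λ k t L → (k :+ (con 1 :+ t)) :+ (k :+ (con 1 :+ t)) :+ con 1 :+ L := L :+ (con 2 :* k :+ con 3 :+ (t :+ t))) refl k′ (triangle k) (lollipop k k))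
      (trans (cong (λ z → lollipop k k + (2 * k′ + 3 + z)) (triangle-double k)) (trans (cong (λ z → lollipop k k + (z + k * suc k)) (solve 1 (λ k → con 2 :* k :+ con 3 := con 2 :* (con 1 :+ k) :+ con 1) refl k′)) (sym (lollipop-widen k k))))

-- The graphs L and Q

≡ᵇ⇒≡ : ∀ a b → (a ≡ᵇ b) ≡ true → a ≡ b
≡ᵇ⇒≡ zero zero _ = refl
≡ᵇ⇒≡ (suc a) (suc b) p = cong suc (≡ᵇ⇒≡ a b p)

edgeB-intro : ∀ {es a b} → (a , b) ∈ es → edgeB es a b ≡ true
edgeB-intro {a = a} {b} m = any-intro (λ p → (proj₁ p ≡ᵇ a) ∧ (proj₂ p ≡ᵇ b)) m (∧-intro (≡ᵇ-refl a) (≡ᵇ-refl b))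

edgeB-elim : ∀ es {a b} → edgeB es a b ≡ true → (a , b) ∈ es
edgeB-elim es {a} {b} p with any-elim (λ p → (proj₁ p ≡ᵇ a) ∧ (proj₂ p ≡ᵇ b)) es p
... | (x , y) , m , q with ≡ᵇ⇒≡ x a (∧-left q) | ≡ᵇ⇒≡ y b (∧-right {x ≡ᵇ a} q)
...   | refl | refl = m

fromEdges-elim : ∀ {n} es {i j : Fin n} → adj (fromEdges n es) i j ≡ true → (toℕ i , toℕ j) ∈ es ⊎ (toℕ j , toℕ i) ∈ es
fromEdges-elim es {i} {j} p = Sum.map (edgeB-elim es) (edgeB-elim es) (∨-elim {edgeB es (toℕ i) (toℕ j)} (∧-right {not (toℕ i ≡ᵇ toℕ j)} p))

fromEdges-intro : ∀ {n} es {i j : Fin n} → toℕ i ≢ toℕ j → (toℕ i , toℕ j) ∈ es ⊎ (toℕ j , toℕ i) ∈ es → adj (fromEdges n es) i j ≡ true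
fromEdges-intro es {i} {j} ne m = ∧-intro (true-not (ne ∘ ≡ᵇ⇒≡ (toℕ i) (toℕ j)))
  (Sum.[ (λ m → ∨-introˡ (edgeB-intro m)) , (λ m → ∨-introʳ {edgeB es (toℕ i) (toℕ j)} (edgeB-intro m)) ] m)

∈-pathEdges⁻ : ∀ (t : ℕ → ℕ) m {a b} → (a , b) ∈ pathEdges (applyUpTo t m) → ∃ λ i → suc i < m × a ≡ t i × b ≡ t (suc i)
∈-pathEdges⁻ t (suc (suc m)) (here refl) = 0 , s≤s (s≤s z≤n) , refl , refl
∈-pathEdges⁻ t (suc (suc m)) (there p) with ∈-pathEdges⁻ (t ∘ suc) (suc m) p
... | i , lt , e , e′ = suc i , s≤s lt , e , e′

∈-pathEdges⁺ : ∀ (t : ℕ → ℕ) m {i} → suc i < m → (t i , t (suc i)) ∈ pathEdges (applyUpTo t m)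
∈-pathEdges⁺ t (suc zero) (s≤s ())
∈-pathEdges⁺ t (suc (suc m)) {zero} lt = here refl
∈-pathEdges⁺ t (suc (suc m)) {suc i} (s≤s lt) = there (∈-pathEdges⁺ (t ∘ suc) (suc m) lt)

tail : ℕ → ℕ → ℕ
tail m zero = 0
tail m (suc i) = m + i

tailPath : ∀ m k → 0 ∷ map (m +_) (upTo k) ≡ applyUpTo (tail m) (suc k)
tailPath m k = cong (0 ∷_) (Listₚ.map-upTo (m +_) k)

lollipopEdges : ℕ → ℕ → List (ℕ × ℕ)
lollipopEdges m k = cycleEdges m ++ pathEdges (0 ∷ map (m +_) (upTo k))

lollipopEdges⇒ : ∀ {m k a b} → 3 ≤ m → (a , b) ∈ lollipopEdges m k → LEdge m a b × a < m + k × b < m + k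
lollipopEdges⇒ {m} {k} {a} {b} 3≤ p with ∈-++⁻ (cycleEdges m) p
... | inj₁ q with ∈-++⁻ (pathEdges (upTo m)) q
...   | inj₁ r with ∈-pathEdges⁻ id m r
...     | i , lt , refl , refl = inj₁ (refl , inj₁ lt) , ≤-trans (<-trans ≤-refl lt) (m≤m+n m k) , ≤-trans lt (m≤m+n m k)
lollipopEdges⇒ {m} {k} 3≤ p | inj₁ q | inj₂ (here refl) = inj₂ (inj₂ (sm , refl)) , ≤-trans (≤-reflexive sm) (m≤m+n m k) , ≤-trans 0<m (m≤m+n m k)
  where
  0<m : 0 < m
  0<m = ≤-trans (s≤s z≤n) 3≤
  sm : suc (m ∸ 1) ≡ m
  sm = m+[n∸m]≡n 0<m
lollipopEdges⇒ {m} {k} {a} {b} 3≤ p | inj₂ q with ∈-pathEdges⁻ (tail m) (suc k) {a} {b} (subst (λ z → (a , b) ∈ pathEdges z) (tailPath m k) q)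
... | zero , s≤s lt , refl , refl = inj₂ (inj₁ (refl , +-identityʳ m)) , ≤-trans 0<m (m≤m+n m k) , +-monoʳ-< m lt
  where
  0<m : 0 < m
  0<m = ≤-trans (s≤s z≤n) 3≤
... | suc i , s≤s lt , refl , refl = inj₁ (sym (+-suc m i) , inj₂ (subst (m <_) (sym (+-suc m i)) (s≤s (m≤m+n m i)))) , +-monoʳ-< m (<-trans ≤-refl lt) , +-monoʳ-< m lt

lollipopEdges⇐ : ∀ {m k a b} → LEdge m a b → b < m + k → (a , b) ∈ lollipopEdges m k
lollipopEdges⇐ {m} {k} (inj₁ (refl , inj₁ lt)) b< = ∈-++⁺ˡ (∈-++⁺ˡ (∈-pathEdges⁺ id m lt))
lollipopEdges⇐ {m} {k} {a} {b} (inj₁ (e , inj₂ gt)) b< = ∈-++⁺ʳ (cycleEdges m) (subst (λ z → (a , b) ∈ pathEdges z) (sym (tailPath m k))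
    (subst₂ (λ x y → (x , y) ∈ pathEdges (applyUpTo (tail m) (suc k))) ea eb (∈-pathEdges⁺ (tail m) (suc k) {suc i} (s≤s i<))))
  where
  i : ℕ
  i = a ∸ m
  ea : m + i ≡ a
  ea = m+[n∸m]≡n (≤-pred (subst (m <_) (sym e) gt))
  eb : m + suc i ≡ b
  eb = trans (+-suc m i) (trans (cong suc ea) e)
  i< : suc i < k
  i< = +-cancelˡ-< m _ _ (subst (_< m + k) (sym eb) b<)
lollipopEdges⇐ {m} {k} (inj₂ (inj₁ (refl , refl))) b< = ∈-++⁺ʳ (cycleEdges m) (subst (λ z → (0 , m) ∈ pathEdges z) (sym (tailPath m k))
    (subst (λ y → (0 , y) ∈ pathEdges (applyUpTo (tail m) (suc k))) (+-identityʳ m) (∈-pathEdges⁺ (tail m) (suc k) {0} (s≤s (+-cancelˡ-< m _ _ (subst (_< m + k) (sym (+-identityʳ m)) b<))))))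
lollipopEdges⇐ {m} {k} (inj₂ (inj₂ (refl , refl))) b< = ∈-++⁺ˡ (∈-++⁺ʳ (pathEdges (upTo m)) (here refl))

label : ∀ {n} → ℕ → Fin (suc n)
label {n} a with a ℕ.<? suc n
... | yes lt = fromℕ< lt
... | no _ = Fin.zero

toℕ-label : ∀ {n a} → a < suc n → toℕ (label {n} a) ≡ a
toℕ-label {n} {a} lt with a ℕ.<? suc n
... | yes lt′ = toℕ-fromℕ< lt′
... | no ¬lt = ⊥-elim (¬lt lt)

label-toℕ : ∀ {n} (i : Fin (suc n)) → label (toℕ i) ≡ i
label-toℕ i = toℕ-injective (toℕ-label (toℕ<n i))

module _ {n : ℕ} (G : Graph (suc n)) where
  open Cuts G
  open Shapes G

  labelled-lolli : ∀ {S m s} → 3 ≤ m → m ≤ s → s ≤ suc n → (∀ {i} → S ∋ i → toℕ i < s) → (∀ {i} → toℕ i < s → S ∋ i) →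
    (∀ {i j} → toℕ i < s → toℕ j < s → Adj i j → LAdj m (toℕ i) (toℕ j)) → (∀ {i j} → toℕ i < s → toℕ j < s → LAdj m (toℕ i) (toℕ j) → Adj i j) →
    IsLolli S m s label
  labelled-lolli {S} {m} {s} 3≤ m≤ s≤ below above fwd bwd = record
    { 3≤m = 3≤ ; m≤s = m≤ ; into = λ a< → above (small a<) ; onto = λ {v} p → toℕ v , below p , label-toℕ v
    ; h-inj = λ a< b< e → trans (sym (name a<)) (trans (cong toℕ e) (name b<))
    ; adj⇒ = λ a< b< e → subst₂ (LAdj m) (name a<) (name b<) (fwd (small a<) (small b<) e)
    ; adj⇐ = λ a< b< e → bwd (small a<) (small b<) (subst₂ (LAdj m) (sym (name a<)) (sym (name b<)) e) }
    where
    name : ∀ {a} → a < s → toℕ (label {n} a) ≡ a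
    name a< = toℕ-label (≤-trans a< s≤)
    small : ∀ {a} → a < s → toℕ (label {n} a) < s
    small a< = subst (_< s) (sym (name a<)) a<

L-lolli : ∀ {n k} → k + 3 ≤ suc n → Shapes.IsLolli (L (suc n) k) full (suc n ∸ k) (suc n) label
L-lolli {n} {k} le = labelled-lolli (L (suc n) k) 3≤ (m∸n≤m (suc n) k) ≤-refl (λ {i} _ → toℕ<n i) (λ _ → mem refl)
    (λ _ _ e → Sum.map (λ q → proj₁ (lollipopEdges⇒ 3≤ q)) (λ q → proj₁ (lollipopEdges⇒ 3≤ q)) (fromEdges-elim (lollipopEdges m k) e))
    (λ {i} {j} _ _ e → fromEdges-intro (lollipopEdges m k) (λ eq → LAdj-irrefl 3≤ (subst (LAdj m (toℕ i)) (sym eq) e)) (Sum.map (λ q → lollipopEdges⇐ q (bound j)) (λ q → lollipopEdges⇐ q (bound i)) e))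
  where
  m : ℕ
  m = suc n ∸ k
  k≤ : k ≤ suc n
  k≤ = ≤-trans (m≤m+n k 3) le
  3≤ : 3 ≤ m
  3≤ = subst (_≤ m) (m+n∸m≡n k 3) (∸-monoˡ-≤ k le)
  bound : ∀ (i : Fin (suc n)) → toℕ i < m + k
  bound i = subst (toℕ i <_) (sym (m∸n+n≡m k≤)) (toℕ<n i)

lastOr-applyUpTo : ∀ d (t : ℕ → ℕ) j → lastOr d (applyUpTo t (suc j)) ≡ t j
lastOr-applyUpTo d t zero = refl
lastOr-applyUpTo d t (suc j) = lastOr-applyUpTo (t 0) (t ∘ suc) j

-- The edge list of `Q` with cycle length and leaves as parameters, so that the truncated
-- differences in its definition can be replaced along equations.
QEdges : ℕ → ℕ → ℕ → ℕ → List (ℕ × ℕ)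
QEdges c k x y = cycleEdges c ++ pathEdges (0 ∷ map (c +_) (upTo (k ∸ 1))) ++ ((z , x) ∷ (z , y) ∷ [])
  where
  z : ℕ
  z = lastOr 0 (0 ∷ map (c +_) (upTo (k ∸ 1)))

module _ (k : ℕ) (3≤k : 3 ≤ k) where

  private
    -- The graph has `suc n = 2k + 1` vertices; `p = 2k − 2` is the centre of the star, with leaves
    -- `suc p` and `n`.
    k″ n p : ℕ
    k″ = k ∸ 2
    n = k + k
    p = k + k″

    k≡ : k ≡ suc (suc k″)
    k≡ = sym (m+[n∸m]≡n (≤-trans (n≤1+n 2) 3≤k))

    p-eq : suc (suc p) ≡ k + k
    p-eq = trans (sym (trans (+-suc k (suc k″)) (cong suc (+-suc k k″)))) (cong (k +_) (sym k≡))

    c≡ : suc n ∸ k ∸ 1 ≡ k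
    c≡ = trans (∸-+-assoc (suc n) k 1) (trans (cong (suc n ∸_) (+-comm k 1)) (m+n∸m≡n k k))

    x≡ : suc n ∸ 2 ≡ suc p
    x≡ = cong (_∸ 1) (sym p-eq)

    ctr≡ : lastOr 0 (0 ∷ map (k +_) (upTo (k ∸ 1))) ≡ p
    ctr≡ = trans (cong (lastOr 0) (tailPath k (k ∸ 1))) (trans (lastOr-applyUpTo 0 (tail k) (k ∸ 1)) (cong (λ z → tail k (z ∸ 1)) k≡))

    es : List (ℕ × ℕ)
    es = QEdges (suc n ∸ k ∸ 1) k (suc n ∸ 2) (suc n ∸ 1)

    es≡ : es ≡ cycleEdges k ++ pathEdges (0 ∷ map (k +_) (upTo (k ∸ 1))) ++ ((p , suc p) ∷ (p , n) ∷ [])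
    es≡ = trans (cong₂ (λ c x → QEdges c k x n) c≡ x≡) (cong (λ z → cycleEdges k ++ pathEdges (0 ∷ map (k +_) (upTo (k ∸ 1))) ++ ((z , suc p) ∷ (z , n) ∷ [])) ctr≡)

    short : List (ℕ × ℕ)
    short = lollipopEdges k (k ∸ 1)

    es≡′ : es ≡ short ++ ((p , suc p) ∷ (p , n) ∷ [])
    es≡′ = trans es≡ (sym (Listₚ.++-assoc (cycleEdges k) (pathEdges (0 ∷ map (k +_) (upTo (k ∸ 1)))) _))

    short≤ : ∀ {a} → a < k + (k ∸ 1) → a < n
    short≤ lt = ≤-trans lt (+-monoʳ-≤ k (m∸n≤m k 1))

    sp<n : suc p < n
    sp<n = ≤-reflexive p-eq

    p<n : p < n
    p<n = <-trans ≤-refl sp<n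

    k<sp : k < suc p
    k<sp = s≤s (m≤m+n k k″)

    es⇒ : ∀ {a b} → (a , b) ∈ es → (LEdge k a b × a < n × b < n) ⊎ (a ≡ p × b ≡ n)
    es⇒ {a} {b} q with ∈-++⁻ short (subst ((a , b) ∈_) es≡′ q)
    ... | inj₁ r with lollipopEdges⇒ {k = k ∸ 1} 3≤k r
    ...   | e , a< , b< = inj₁ (e , short≤ a< , short≤ b<)
    es⇒ q | inj₂ (here refl) = inj₁ (inj₁ (refl , inj₂ k<sp) , p<n , sp<n)
    es⇒ q | inj₂ (there (here refl)) = inj₂ (refl , refl)

    es⇐ : ∀ {a b} → LEdge k a b → b < n → (a , b) ∈ es
    es⇐ {a} {b} e b< with b ℕ.<? k + (k ∸ 1)
    ... | yes lt = subst ((a , b) ∈_) (sym es≡′) (∈-++⁺ˡ (lollipopEdges⇐ e lt))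
    ... | no ge = subst ((a , b) ∈_) (sym es≡′) (∈-++⁺ʳ short (here (cong₂ _,_ (end e) b≡)))
      where
      b≡ : b ≡ suc p
      b≡ = ≤-antisym (≤-pred (subst (suc b ≤_) (sym p-eq) b<)) (subst (_≤ b) (trans (cong (λ z → k + (z ∸ 1)) k≡) (+-suc k k″)) (≮⇒≥ ge))
      end : LEdge k a b → a ≡ p
      end (inj₁ (e , _)) = suc-injective (trans e b≡)
      end (inj₂ (inj₁ (_ , e))) = ⊥-elim (<-irrefl (trans (sym e) b≡) k<sp)
      end (inj₂ (inj₂ (_ , e))) = ⊥-elim (0≢1+n (trans (sym e) b≡))

    q : Graph (suc n)
    q = Q (suc n) k

    open Shapes q
    open Cuts q

    v : Fin (suc n)
    v = label n

    toℕ-v : toℕ v ≡ n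
    toℕ-v = toℕ-label {n} ≤-refl

    below : ∀ {i} → full ─ v ∋ i → toℕ i < n
    below {i} r = ≤∧≢⇒< (≤-pred (toℕ<n i)) (λ e → ─-≢ r (toℕ-injective (trans e (sym toℕ-v))))

    lolli : IsLolli (full ─ v) k (k + k) label
    lolli = labelled-lolli q 3≤k (m≤m+n k k) (n≤1+n n) below (λ lt → ─-intro (mem refl) (λ { refl → <-irrefl toℕ-v lt }))
      (λ {i} {j} i< j< e → Sum.map (λ r → keep j< (es⇒ r)) (λ r → keep i< (es⇒ r)) (fromEdges-elim es e))
      (λ {i} {j} i< j< e → fromEdges-intro es (λ eq → LAdj-irrefl 3≤k (subst (LAdj k (toℕ i)) (sym eq) e)) (Sum.map (λ r → es⇐ r j<) (λ r → es⇐ r i<) e))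
      where
      keep : ∀ {a b} → b < n → (LEdge k a b × a < n × b < n) ⊎ (a ≡ p × b ≡ n) → LEdge k a b
      keep _ (inj₁ (e , _)) = e
      keep lt (inj₂ (_ , e)) = ⊥-elim (<-irrefl e lt)

    leaf : Leaf full v (label p)
    leaf = mem refl , mem refl ,
      fromEdges-intro es (λ e → <-irrefl (trans (sym lp) (trans (sym e) toℕ-v)) p<n) (inj₂ (subst₂ (λ a b → (a , b) ∈ es) (sym lp) (sym toℕ-v) (subst ((p , n) ∈_) (sym es≡′) (∈-++⁺ʳ short (there (here refl)))))) ,
      λ {y} _ e → toℕ-injective (trans (Sum.[ (λ r → from (es⇒ r)) , (λ r → to (es⇒ r)) ] (fromEdges-elim es e)) (sym lp))
      where
      lp : toℕ (label {n} p) ≡ p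
      lp = toℕ-label (m≤n⇒m≤1+n p<n)
      from : ∀ {b} → (LEdge k (toℕ v) b × toℕ v < n × b < n) ⊎ (toℕ v ≡ p × b ≡ n) → b ≡ p
      from (inj₁ (_ , lt , _)) = ⊥-elim (<-irrefl toℕ-v lt)
      from (inj₂ (e , _)) = ⊥-elim (<-irrefl (trans (sym e) toℕ-v) p<n)
      to : ∀ {a} → (LEdge k a (toℕ v) × a < n × toℕ v < n) ⊎ (a ≡ p × toℕ v ≡ n) → a ≡ p
      to (inj₁ (_ , _ , lt)) = ⊥-elim (<-irrefl toℕ-v lt)
      to (inj₂ (e , _)) = e

  Q-isQ : Shapes.IsQ (Q (suc (k + k)) k) full k
  Q-isQ = v , label , p , lolli , leaf , p-eq

-- Isomorphisms from labellings, and invariance of `F`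

record Labelling {n : ℕ} (G : Graph n) (R : ℕ → ℕ → Set) (h : ℕ → Fin n) : Set where
  field
    l-onto : ∀ v → ∃ λ a → a < n × h a ≡ v
    l-inj : ∀ {a b} → a < n → b < n → h a ≡ h b → a ≡ b
    l-adj⇒ : ∀ {a b} → a < n → b < n → adj G (h a) (h b) ≡ true → R a b
    l-adj⇐ : ∀ {a b} → a < n → b < n → R a b → adj G (h a) (h b) ≡ true
open Labelling

labelling-≅ : ∀ {n} {G G′ : Graph n} {R h h′} → Labelling G R h → Labelling G′ R h′ → G ≅ G′
labelling-≅ {n} {G} {G′} {R} {h} {h′} l l′ = mk⤖ (to-inj , to-surj) , λ i j → bool-ext (fwd i j) (bwd i j)
  where
  ix : Fin n → ℕ
  ix i = proj₁ (l-onto l i)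
  ix< : ∀ i → ix i < n
  ix< i = proj₁ (proj₂ (l-onto l i))
  h-ix : ∀ i → h (ix i) ≡ i
  h-ix i = proj₂ (proj₂ (l-onto l i))
  to : Fin n → Fin n
  to i = h′ (ix i)
  to-inj : ∀ {i j} → to i ≡ to j → i ≡ j
  to-inj {i} {j} e = trans (sym (h-ix i)) (trans (cong h (l-inj l′ (ix< i) (ix< j) e)) (h-ix j))
  to-surj : ∀ y → ∃ λ x → ∀ {z} → z ≡ x → to z ≡ y
  to-surj y with l-onto l′ y
  ... | a , a< , e = h a , λ { refl → trans (cong h′ (l-inj l (ix< (h a)) a< (h-ix (h a)))) e }
  fwd : ∀ i j → adj G i j ≡ true → adj G′ (to i) (to j) ≡ true
  fwd i j e = l-adj⇐ l′ (ix< i) (ix< j) (l-adj⇒ l (ix< i) (ix< j) (subst₂ (λ x y → adj G x y ≡ true) (sym (h-ix i)) (sym (h-ix j)) e))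
  bwd : ∀ i j → adj G′ (to i) (to j) ≡ true → adj G i j ≡ true
  bwd i j e = subst₂ (λ x y → adj G x y ≡ true) (h-ix i) (h-ix j) (l-adj⇐ l (ix< i) (ix< j) (l-adj⇒ l′ (ix< i) (ix< j) e))

lolli-labelling : ∀ {n m h} (G : Graph n) → Shapes.IsLolli G full m n h → Labelling G (LAdj m) h
lolli-labelling G L = record { l-onto = λ v → onto L (mem refl) ; l-inj = h-inj L ; l-adj⇒ = adj⇒ L ; l-adj⇐ = adj⇐ L }
  where open Shapes G

-- Label `2k` is the doubled leaf; like label `2k − 1` it is attached to `2k − 2`.
QAdj : ℕ → ℕ → ℕ → Set
QAdj k a b = (a < k + k × b < k + k × LAdj k a b) ⊎ (suc (suc a) ≡ k + k × b ≡ k + k) ⊎ (a ≡ k + k × suc (suc b) ≡ k + k)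

Q-labelling : ∀ {k} (G : Graph (suc (k + k))) → Shapes.IsQ G full k → ∃ λ h → Labelling G (QAdj k) h
Q-labelling {k} G (v , h , p , L , (_ , _ , vp , only) , p-eq) = h [ k + k ↦ v ] , record
    { l-onto = λ w → extend-onto (mem refl) ; l-inj = λ a b → extend-inj (<suc-elim a) (<suc-elim b) ; l-adj⇒ = λ a b → fwd (<suc-elim a) (<suc-elim b) ; l-adj⇐ = λ a b → bwd (<suc-elim a) (<suc-elim b) }
  where
  open Shapes G
  open Cuts G
  open Extend {S = full} {v} (mem refl) L
  s : ℕ
  s = k + k
  p<s : p < s
  p<s = ≤-trans (n≤1+n (suc p)) (≤-reflexive p-eq)
  at-new : ∀ {a} → a < s → Adj (h′ a) (h′ s) → a ≡ p
  at-new lt e = h-inj L lt p<s (only (mem refl) (Adj-sym (subst₂ Adj (old lt) new e)))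
  new-at : Adj (h′ p) (h′ s)
  new-at = subst₂ Adj (sym (old p<s)) (sym new) (Adj-sym vp)
  is-p : ∀ {a} → suc (suc a) ≡ s → a ≡ p
  is-p e = suc-injective (suc-injective (trans e (sym p-eq)))
  fwd : ∀ {a b} → a < s ⊎ a ≡ s → b < s ⊎ b ≡ s → Adj (h′ a) (h′ b) → QAdj k a b
  fwd (inj₁ p) (inj₁ q) e = inj₁ (p , q , adj⇒ L p q (subst₂ Adj (old p) (old q) e))
  fwd (inj₁ p) (inj₂ refl) e = inj₂ (inj₁ (trans (cong (suc ∘ suc) (at-new p e)) p-eq , refl))
  fwd (inj₂ refl) (inj₁ q) e = inj₂ (inj₂ (refl , trans (cong (suc ∘ suc) (at-new q (Adj-sym e))) p-eq))
  fwd (inj₂ refl) (inj₂ refl) e = ⊥-elim (Adj-≢ e refl)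
  bwd : ∀ {a b} → a < s ⊎ a ≡ s → b < s ⊎ b ≡ s → QAdj k a b → Adj (h′ a) (h′ b)
  bwd _ _ (inj₁ (p , q , e)) = subst₂ Adj (sym (old p)) (sym (old q)) (adj⇐ L p q e)
  bwd _ _ (inj₂ (inj₁ (e , refl))) = subst (λ z → Adj (h′ z) (h′ s)) (sym (is-p e)) new-at
  bwd _ _ (inj₂ (inj₂ (refl , e))) = Adj-sym (subst (λ z → Adj (h′ z) (h′ s)) (sym (is-p e)) new-at)

module Inverse {n : ℕ} (f : Fin n ⤖ Fin n) where
  open Bijection f public using (to; injective; surjective)

  from : Fin n → Fin n
  from y = proj₁ (surjective y)

  to-from : ∀ y → to (from y) ≡ y
  to-from y = proj₂ (surjective y) refl

  from-to : ∀ x → from (to x) ≡ x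
  from-to x = injective (to-from (to x))

  from-injective : ∀ {x y} → from x ≡ from y → x ≡ y
  from-injective {x} {y} e = trans (sym (to-from x)) (trans (cong to e) (to-from y))

≅-sym : ∀ {n} {G H : Graph n} → G ≅ H → H ≅ G
≅-sym {H = H} (f , pres) = mk⤖ (from-injective , λ y → to y , λ { refl → from-to y }) , λ i j → sym (trans (pres (from i) (from j)) (cong₂ (adj H) (to-from i) (to-from j)))
  where open Inverse f

≅⇒F≤ : ∀ {n} {G H : Graph n} → G ≅ H → F G ≤ F H
≅⇒F≤ {n} {G} {H} (f , pres) = SH.F-atMost (atLeast-inject push (λ {T} → push-InS {T}) (λ {T} {T′} _ _ → push-inj {T} {T′}) SG.F-atLeast)
  where
  module SG = Subgraphs G
  module SH = Subgraphs H
  open Inverse f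
  push : Sub n → Sub n
  push T = subgraph (V T ∘ from) (λ i j → E T (from i) (from j))
  push-edge : ∀ {T i j} → Edge T i j → Edge (push T) (to i) (to j)
  push-edge {T} {i} {j} e = trans (cong₂ (E T) (from-to i) (from-to j)) e
  push-InS : ∀ {T} → SG.InS full T → SH.InS full (push T)
  push-InS {T} t = record
    { V⊑ = λ _ _ → mem refl ; E-sym = SG.E-sym t ; E-V = λ e → mem (is-mem (SG.E-V t e))
    ; E-adj = λ {i} {j} e → trans (sym (trans (pres (from i) (from j)) (cong₂ (adj H) (to-from i) (to-from j)))) (SG.E-adj t e)
    ; root = to (SG.root t) ; root∈ = mem (trans (cong (V T) (from-to (SG.root t))) (is-mem (SG.root∈ t)))
    ; walk = λ i p → subst (Star (Edge (push T)) (to (SG.root t))) (to-from i) (Star.gmap to (push-edge {T}) (SG.walk t (from i) (mem (is-mem p)))) }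
  push-inj : ∀ {T T′} → push T ≐ push T′ → T ≐ T′
  push-inj {T} {T′} (e , e′) = (λ i → subst (λ x → V T x ≡ V T′ x) (from-to i) (e (to i))) , λ i j → subst₂ (λ x y → E T x y ≡ E T′ x y) (from-to i) (from-to j) (e′ (to i) (to j))

≅⇒F≡ : ∀ {n} {G H : Graph n} → G ≅ H → F G ≡ F H
≅⇒F≡ {G = G} {H} i = ≤-antisym (≅⇒F≤ {G = G} {H} i) (≅⇒F≤ {G = H} {G} (≅-sym {G = G} {H} i))

≅-cycle : ∀ {n} {G H : Graph n} → G ≅ H → Cycles.Cyc G → Cycles.Cyc H
≅-cycle {G = G} {H} (f , pres) c = record
  { len = len c ; at = to ∘ at c ; 3≤len = 3≤len c ; per = λ i → cong to (per c i)
  ; step = λ i → trans (sym (pres (at c i) (at c (suc i)))) (step c i) ; inj = λ p a b e → inj c p a b (injective e) }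
  where
  open Cycles G
  open Bijection f using (to; injective)

-- For k = 2 the cycle of Q degenerates to the single edge {0, 1}.
Q-5-2-acyclic : ¬ Cycles.Cyc (Q 5 2)
Q-5-2-acyclic c = <-irrefl refl (≤-trans (3≤len c) (≤-trans (len≤card c {core} inside) (≤-refl {2})))
  where
  open Cycles (Q 5 2)
  open Cuts (Q 5 2)
  -- Vertices 1, 3 and 4 are leaves, so a cycle would have to lie within {0, 2}, which is too small.
  core : VSet 5
  core Fin.zero = true
  core (Fin.suc (Fin.suc Fin.zero)) = true
  core _ = false
  leaf : ∀ v u → Adj v u → (∀ y → Adj v y → y ≡ u) → ∀ i → at c i ≢ v
  leaf v u a only i e = leaf-¬deg2 {full} {v} {u} (mem refl , mem refl , a , λ {y} _ → only y) (subst (Deg2 full) e (on-cycle-deg2 c (λ _ → mem refl) i))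
  only? : ∀ v u → Dec (∀ y → Adj v y → y ≡ u)
  only? v u = all? (λ y → (adj (Q 5 2) v y Bool.≟ true) →-dec (y ≟ᶠ u))
  inside : ∀ i → core ∋ at c i
  inside i with at c i in eq
  ... | Fin.zero = mem refl
  ... | Fin.suc Fin.zero = ⊥-elim (leaf (# 1) (# 0) refl (toWitness {a? = only? (# 1) (# 0)} _) i eq)
  ... | Fin.suc (Fin.suc Fin.zero) = mem refl
  ... | Fin.suc (Fin.suc (Fin.suc Fin.zero)) = ⊥-elim (leaf (# 3) (# 2) refl (toWitness {a? = only? (# 3) (# 2)} _) i eq)
  ... | Fin.suc (Fin.suc (Fin.suc (Fin.suc Fin.zero))) = ⊥-elim (leaf (# 4) (# 2) refl (toWitness {a? = only? (# 4) (# 2)} _) i eq)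

-- Members of the class and the equality cases

module _ {n k : ℕ} (k+3≤n : k + 3 ≤ suc n) (G : Graph (suc n)) (G∈ : InC' (suc n) k k G) where
  open Cuts G
  open Cycles G
  open Subgraphs G
  open Shapes G

  private
    connected : Connected G
    connected = proj₁ G∈

    conn : ConnV full
    conn = connected⇒ connected

  member-cycle : Cyc
  member-cycle with cycle-or-acyclic full conn
  ... | inj₁ (c , _) = c
  ... | inj₂ none = ⊥-elim (proj₂ (proj₂ (proj₂ G∈)) (connected , acyclic))
    where
    acyclic : ∀ c → ¬ IsCycle G c
    acyclic (v ∷ vs) cyc = let (c , _ , f) = isCycle⇒cyc cyc in none c (f (λ _ → mem refl))

  private
    cuts : card (cut full) ≡ k
    cuts = trans (card-cong {S = cut full} {isCut G} (λ v p → mem (trans (isCut-connB v) (is-mem p))) (λ v p → mem (trans (sym (isCut-connB v)) (is-mem p)))) (proj₁ (proj₂ G∈))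

    card-full : card (full {suc n}) ≡ suc n
    card-full = ≤-antisym (subst (card (full {suc n}) ≤_) (Listₚ.length-tabulate id) (card≤length {S = full} {xs = allFin (suc n)} (λ i _ → ∈-allFin i))) (subst (_≤ card (full {suc n})) (Listₚ.length-tabulate id) (length≤card {S = full} (Uniqueₚ.allFin⁺ (suc n)) (λ _ → mem refl)))

    noncuts : card (nc full) ≡ suc n ∸ k
    noncuts = trans (sym (m+n∸n≡m (card (nc full)) k)) (cong (_∸ k) (trans (cong (card (nc full) +_) (sym cuts)) (trans (card-nc-cut full) card-full)))

  member-result : Result full (suc n ∸ k) k
  member-result = subst₂ (Result full) noncuts cuts (minimum conn member-cycle (λ _ → mem refl) (subst (GirthAtLeast G) (sym cuts) (proj₁ (proj₂ (proj₂ G∈)))))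

  private
    m+k : suc n ∸ k + k ≡ suc n
    m+k = m∸n+n≡m (≤-trans (m≤m+n k 3) k+3≤n)

  F-L≤ : F (L (suc n) k) ≤ lollipop (suc n ∸ k) k
  F-L≤ = proj₁ (Exact.lolli-atMost (L (suc n) k) k (sym m+k) (L-lolli k+3≤n)) (Subgraphs.F-atLeast (L (suc n) k))

  F-L≥ : lollipop (suc n ∸ k) k ≤ F (L (suc n) k)
  F-L≥ = Subgraphs.F-atMost (L (suc n) k) (proj₁ (Exact.lolli-atLeast (L (suc n) k) k (sym m+k) (L-lolli k+3≤n)))

  F-member≥ : lollipop (suc n ∸ k) k ≤ F G
  F-member≥ = F-atMost (proj₁ member-result)

  equality⇒shape : F G ≡ F (L (suc n) k) → G ≅ L (suc n) k ⊎ (suc n ≡ suc (k + k) × IsQ full k)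
  equality⇒shape e with proj₂ member-result
  ... | inj₁ st = ⊥-elim (<-irrefl (sym e) (≤-trans (s≤s F-L≤) (F-atMost st)))
  ... | inj₂ (inj₁ (h , M)) = inj₁ (labelling-≅ (lolli-labelling G (subst (λ s → IsLolli full (suc n ∸ k) s h) m+k M)) (lolli-labelling (L (suc n) k) (L-lolli k+3≤n)))
  ... | inj₂ (inj₂ (m≡ , qs)) = inj₂ (trans (sym m+k) (cong (_+ k) m≡) , qs)

isQ⇒≅Q : ∀ {n k} (G : Graph n) → n ≡ suc (k + k) → Shapes.IsQ G full k → G ≅ Q n k
isQ⇒≅Q {k = k} G refl qs@(_ , _ , _ , M , _) = labelling-≅ (proj₂ (Q-labelling G qs)) (proj₂ (Q-labelling (Q (suc (k + k)) k) (Q-isQ k (Shapes.3≤m M))))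

F-Q≤ : ∀ {k} → 3 ≤ k → F (Q (suc (k + k)) k) ≤ lollipop (suc k) k
F-Q≤ {k} 3≤k = Exact.Q-atMost (Q (suc (k + k)) k) (Q-isQ k 3≤k) (Subgraphs.F-atLeast (Q (suc (k + k)) k))

-- From `k + 3 ≤ 2k + 1` follows `k ≥ 2`. For `k = 2` the graph `Q 5 2` has no cycle, whereas
-- members of the class have one; for `k ≥ 3` the upper bound for `Q` meets the lower bound for
-- members.
≅Q⇒equality : ∀ {n k} → suc n ≡ suc (k + k) → (k+3≤n : k + 3 ≤ suc n) → (G : Graph (suc n)) → InC' (suc n) k k G → G ≅ Q (suc n) k → F G ≡ F (L (suc n) k)
≅Q⇒equality {k = zero} refl (s≤s ()) G G∈ i
≅Q⇒equality {k = suc zero} refl (s≤s (s≤s (s≤s ()))) G G∈ i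
≅Q⇒equality {k = suc (suc zero)} refl le G G∈ i = ⊥-elim (Q-5-2-acyclic (≅-cycle {G = G} {H = Q 5 2} i (member-cycle le G G∈)))
≅Q⇒equality {k = suc (suc (suc k′))} refl le G G∈ i = ≤-antisym
    (≤-trans (≤-reflexive (≅⇒F≡ {G = G} {H = Q (suc (k + k)) k} i)) (≤-trans (F-Q≤ {k} (s≤s (s≤s (s≤s z≤n)))) (≤-trans (≤-reflexive (cong (λ m → lollipop m k) (sym m≡))) (F-L≥ le G G∈))))
    (≤-trans (F-L≤ le G G∈) (F-member≥ le G G∈))
  where
  k : ℕ
  k = suc (suc (suc k′))
  m≡ : suc (k + k) ∸ k ≡ suc k
  m≡ = trans (cong (_∸ k) (sym (+-suc k k))) (m+n∸m≡n k (suc k))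

theorem4p9 : (n k : ℕ) → 1 ≤ k → k + 3 ≤ n → (G : Graph n) → InC' n k k G →
    (F (L n k) ≤ F G)
    × (¬ (n ≡ 2 * k + 1) → ((F G ≡ F (L n k)) ⇔ (G ≅ L n k)))
    × (n ≡ 2 * k + 1 → ((F G ≡ F (L n k)) ⇔ ((G ≅ L n k) ⊎ (G ≅ Q n k))))
theorem4p9 zero zero _ ()
theorem4p9 zero (suc k) _ ()
theorem4p9 (suc n) k 1≤k le G G∈ = ≤-trans (F-L≤ le G G∈) (F-member≥ le G G∈) , (λ ne → mk⇔ (only-L ne) ≅L⇒) , λ e → mk⇔ (L-or-Q e) Sum.[ ≅L⇒ , ≅Q⇒equality (odd⇒ e) le G G∈ ]
  where
  odd≡ : 2 * k + 1 ≡ suc (k + k)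
  odd≡ = solve 1 (λ k → con 2 :* k :+ con 1 := con 1 :+ (k :+ k)) refl k
  odd⇒ : suc n ≡ 2 * k + 1 → suc n ≡ suc (k + k)
  odd⇒ e = trans e odd≡
  ≅L⇒ : G ≅ L (suc n) k → F G ≡ F (L (suc n) k)
  ≅L⇒ = ≅⇒F≡ {G = G} {H = L (suc n) k}
  only-L : ¬ (suc n ≡ 2 * k + 1) → F G ≡ F (L (suc n) k) → G ≅ L (suc n) k
  only-L ne e with equality⇒shape le G G∈ e
  ... | inj₁ i = i
  ... | inj₂ (eq , _) = ⊥-elim (ne (trans eq (sym odd≡)))
  L-or-Q : suc n ≡ 2 * k + 1 → F G ≡ F (L (suc n) k) → (G ≅ L (suc n) k) ⊎ (G ≅ Q (suc n) k)
  L-or-Q odd e with equality⇒shape le G G∈ e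
  ... | inj₁ i = inj₁ i
  ... | inj₂ (eq , qs) = inj₂ (isQ⇒≅Q G eq qs)
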